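{- Let $t\ge2$, $n\ge1$, $\omega$ a primitive $t$-th root of unity, $X=(x_1,\dots,x_n)$, $X^t=(x_1^t,\dots,x_n^t)$, $\overline{X}^t=(x_1^{ -t},\dots,x_n^{ -t})$, $-X^t=(-x_1^t,\dots,-x_n^t)$. Let $\lambda$ be a partition with $\ell(\lambda)\le tn$, with $n_i=n_i(\lambda,tn)$ and $t$-quotient $(\lambda^{(0)},\dots,\lambda^{(t-1)})$ computed with $m=tn$. Consider the even orthogonal character $\mathrm{o}^{\mathrm{even}}_\lambda$ in the $tn$ variables $(X,\omega X,\dots,\omega^{t-1}X)$. (1) If the $t$-core of $\lambda$ is not an orthogonal $t$-core, then $\mathrm{o}^{\mathrm{even}}_\lambda(X,\omega X,\dots,\omega^{t-1}X)=0$. (2) If the $t$-core of $\lambda$ is an orthogonal $t$-core of rank $r$, then \[ \mathrm{o}^{\mathrm{even}}_\lambda(X,\omega X,\dots,\omega^{t-1}X)=(-1)^{\epsilon}\operatorname{sgn}(\sigma_\lambda)\,\mathrm{o}^{\mathrm{even}}_{\lambda^{(0)}}(X^t)\prod_{i=1}^{\lfloor (t-1)/2\rfloor} s_{\mu^{(2)}_i}(X^t,\overline{X}^t)\times\begin{cases}(-1)^{\sum_{j=1}^n\lambda^{(t/2)}_j}\,\mathrm{so}_{\lambda^{(t/2)}}(-X^t)& t\text{ even},\\ 1 & t\text{ odd},\end{cases} \] where $\epsilon=-\sum_{i=\lfloor (t+2)/2\rfloor}^{t-1}\binom{n_i}{2}+\begin{cases}\frac{n(n+t-1)}2+nr & t\text{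 even},\\ \frac{(t-1)n}{2}& t\text{ odd},\end{cases}$ and, for $1\le i\le\lfloor(t-1)/2\rfloor$, $\mu^{(2)}_i$ is the sequence of length $2n$ whose $j$-th entry is $\lambda^{(t-i)}_1+\lambda^{(i)}_j$ for $1\le j\le n_i$ and $\lambda^{(t-i)}_1-\lambda^{(t-i)}_{2n+1-j}$ for $n_i<j\le 2n$ (i.e. $\lambda^{(t-i)}_1+(\lambda^{(i)},-\mathrm{rev}(\lambda^{(t-i)}))$).
   Context: Beta sets and $t$-quotients: for $\ell(\lambda)\le m$, $\beta(\lambda,m)=(\lambda_j+m-j)_{j=1}^m$; $n_i(\lambda,m)$ is the number of entries congruent to $i$ mod $t$; writing those entries in decreasing order as $t\tilde\beta^{(i)}_j+i$ ($1\le j\le n_i$), $\lambda^{(i)}$ is the partition with $n_i$ parts (possibly zero) $\lambda^{(i)}_j=\tilde\beta^{(i)}_j-n_i+j$. The $t$-core is obtained by successively removing border strips of size $t$. Frobenius coordinates: if $\rho$ has rank $k$ (largest $k$ with $\rho_k\ge k$), $\rho=(\alpha|\beta)$ with $\alpha_i=\rho_i-i$, $\beta_i=\rho'_i-i$. A partition is orthogonal if it has the form $(\alpha|\alpha-1)$, i.e. $\beta_i=\alpha_i-1$ for all $i$ (empty partition included); an orthogonal $t$-core is an orthogonal partition that is a $t$-core. $\sigma_\lambda\in S_{tn}$ is the permutation such that $(\beta_{\sigma_\lambda(1)},\dots,\beta_{\sigma_\lambda(tn)})$ (with $\beta=\beta(\lambda,tn)$) lists the entries congruent to $0$ mod $t$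 in decreasing order, then those congruent to $1$, ..., then those congruent to $t-1$. Characters in $N$ variables $y$, for a weakly decreasing integer sequence $\mu$ of length $N$: $s_\mu(y)=\det(y_i^{\mu_j+N-j})/\det(y_i^{N-j})$; $\mathrm{so}_\mu(y)=\det(y_i^{\mu_j+N-j+1}-y_i^{ -(\mu_j+N-j)})/\det(y_i^{N-j+1}-y_i^{ -(N-j)})$; $\mathrm{o}^{\mathrm{even}}_\mu(y)=\det(y_i^{\mu_j+N-j}+y_i^{ -(\mu_j+N-j)})/\big((1+\delta_{\mu_N,0})\det(y_i^{N-j}+y_i^{ -(N-j)})\big)$, $\delta$ the Kronecker delta. Here $\mathrm{o}^{\mathrm{even}}_{\lambda^{(0)}}$ and $\mathrm{so}_{\lambda^{(t/2)}}$ are in $n$ variables and $s_{\mu^{(2)}_i}$ in $2n$ variables. -}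

module Defs where

open import Level using (_⊔_)
open import Data.Bool using (Bool; true; false; if_then_else_)
open import Data.Nat as ℕ using (ℕ; zero; suc; _+_; _*_; _∸_; _≤_; _<_; _≡ᵇ_; _≤ᵇ_; _<ᵇ_)
open import Data.Nat.DivMod using (_%_; _/_)
open import Data.Nat.ListAction using (sum)
open import Data.Nat.Combinatorics using (_C_)
open import Data.Integer as ℤ using (ℤ; +_; -[1+_]; ∣_∣)
open import Data.Fin as Fin using (Fin; toℕ; punchIn; remQuot; splitAt)
open import Data.Product using (Σ; ∃; _×_; _,_; proj₁; proj₂)
open import Data.Sum using (_⊎_; inj₁; inj₂)
open import Data.List as List using (List; []; _∷_; length; map; filterᵇ; upTo; applyUpTo; zip; concatMap; foldr)
open import Data.List.Relation.Unary.All using (All)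
open import Data.List.Relation.Unary.Linked using (Linked)
open import Relation.Nullary using (¬_)
open import Relation.Binary.PropositionalEquality using (_≡_)
open import Relation.Binary.Construct.Closure.ReflexiveTransitive using (Star)
open import Algebra.Bundles using (CommutativeRing)

-- Natural-number helpers (t ≥ 2 in the theorem, so the t = 0 clauses are
-- never used; they only avoid NonZero instance bookkeeping).

modt : ℕ → ℕ → ℕ
modt zero    a = a
modt (suc t) a = a % suc t

divt : ℕ → ℕ → ℕ
divt zero    a = 0
divt (suc t) a = a / suc t

isEven : ℕ → Bool
isEven k = k % 2 ≡ᵇ 0

IsPartition : List ℕ → Set
IsPartition ρ = Linked (λ a b → b ≤ a) ρ × All (λ a → 0 < a) ρ

part : List ℕ → ℕ → ℕ
part []       _       = 0
part (a ∷ ρ)  zero    = a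
part (a ∷ ρ)  (suc i) = part ρ i

InSkew : List ℕ → List ℕ → ℕ × ℕ → Set
InSkew ρ ν (i , j) = (j < part ρ i) × (part ν i ≤ j)

Adjacent : ℕ × ℕ → ℕ × ℕ → Set
Adjacent (i , j) (i' , j') =
  ((suc i ≡ i') × (j ≡ j')) ⊎ ((i ≡ suc i') × (j ≡ j')) ⊎
  ((i ≡ i') × (suc j ≡ j')) ⊎ ((i ≡ i') × (j ≡ suc j'))

SkewConnected : List ℕ → List ℕ → Set
SkewConnected ρ ν = ∀ c d → InSkew ρ ν c → InSkew ρ ν d →
  Star (λ a b → Adjacent a b × InSkew ρ ν a × InSkew ρ ν b) c d

NoTwoByTwo : List ℕ → List ℕ → Set
NoTwoByTwo ρ ν = ∀ i j → ¬ (InSkew ρ ν (i , j) × InSkew ρ ν (suc i , j) ×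
                             InSkew ρ ν (i , suc j) × InSkew ρ ν (suc i , suc j))

-- ν is obtained from ρ by removing a border strip (rim hook) of size t:
-- ρ/ν is a connected skew shape of size t containing no 2×2 square.
RemoveStrip : ℕ → List ℕ → List ℕ → Set
RemoveStrip t ρ ν =
  IsPartition ν × (∀ i → part ν i ≤ part ρ i) × (sum ρ ≡ sum ν + t) ×
  SkewConnected ρ ν × NoTwoByTwo ρ ν

IsTCore : ℕ → List ℕ → Set
IsTCore t c = ¬ (∃ λ ν → RemoveStrip t c ν)

TCoreOf : ℕ → List ℕ → List ℕ → Set
TCoreOf t ρ c = Star (RemoveStrip t) ρ c × IsTCore t c

-- ρ'_k (k 1-indexed)
conjPart : List ℕ → ℕ → ℕ
conjPart ρ k = length (filterᵇ (λ a → k ≤ᵇ a) ρ)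

maxℕ : List ℕ → ℕ
maxℕ = foldr ℕ._⊔_ 0

rank : List ℕ → ℕ
rank ρ = maxℕ (map (λ k → if k ≤ᵇ part ρ (k ∸ 1) then k else 0) (applyUpTo suc (length ρ)))

frobα : List ℕ → ℕ → ℤ
frobα ρ i = (+ part ρ (i ∸ 1)) ℤ.- (+ i)

frobβ : List ℕ → ℕ → ℤ
frobβ ρ i = (+ conjPart ρ i) ℤ.- (+ i)

Orthogonal : List ℕ → Set
Orthogonal ρ = ∀ i → 1 ≤ i → i ≤ rank ρ → frobβ ρ i ≡ frobα ρ i ℤ.- (+ 1)

betaSet : ℕ → List ℕ → List ℕ
betaSet m ρ = map (λ j → part ρ j + (m ∸ suc j)) (upTo m)

-- entries of β(λ,m) congruent to i mod t, in decreasing order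
betaRes : ℕ → ℕ → List ℕ → ℕ → List ℕ
betaRes m t ρ i = filterᵇ (λ b → modt t b ≡ᵇ i) (betaSet m ρ)

nRes : ℕ → ℕ → List ℕ → ℕ → ℕ
nRes m t ρ i = length (betaRes m t ρ i)

-- λ^{(i)} : n_i parts (possibly zero), λ^{(i)}_j = β̃_j − n_i + j (j 1-indexed)
quot : ℕ → ℕ → List ℕ → ℕ → List ℕ
quot m t ρ i =
  map (λ p → (divt t (proj₂ p) + suc (proj₁ p)) ∸ nRes m t ρ i)
      (zip (upTo (nRes m t ρ i)) (betaRes m t ρ i))

-- one-line notation (0-indexed positions) of σ_λ ∈ S_m
sigmaList : ℕ → ℕ → List ℕ → List ℕ
sigmaList m t ρ =
  concatMap (λ i → filterᵇ (λ p → modt t (part (betaSet m ρ) p) ≡ᵇ i) (upTo m)) (upTo t)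

inversions : List ℕ → ℕ
inversions []       = 0
inversions (a ∷ xs) = length (filterᵇ (λ b → b <ᵇ a) xs) + inversions xs

record Field c ℓ : Set (Level.suc (c ⊔ ℓ)) where
  field
    commutativeRing : CommutativeRing c ℓ
  open CommutativeRing commutativeRing public
    using (Carrier; _≈_; 0#; 1#)
    renaming (_+_ to _+ᴷ_; _*_ to _*ᴷ_; -_ to -ᴷ_; _-_ to _-ᴷ_)
  field
    inv         : Carrier → Carrier
    inv-correct : ∀ x → ¬ (x ≈ 0#) → x *ᴷ inv x ≈ 1#
    1≉0         : ¬ (1# ≈ 0#)

module FieldDefs {c ℓ} (K : Field c ℓ) where
  open Field K public

  pow : Carrier → ℕ → Carrier
  pow x zero    = 1#
  pow x (suc k) = x *ᴷ pow x k

  zpow : Carrier → ℤ → Carrier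
  zpow x (+ k)     = pow x k
  zpow x -[1+ k ]  = pow (inv x) (suc k)

  signR : ℕ → Carrier
  signR zero    = 1#
  signR (suc k) = -ᴷ signR k

  signZ : ℤ → Carrier
  signZ e = signR ∣ e ∣

  sumF : ∀ {N} → (Fin N → Carrier) → Carrier
  sumF {zero}  f = 0#
  sumF {suc N} f = f Fin.zero +ᴷ sumF (λ j → f (Fin.suc j))

  prodL : List Carrier → Carrier
  prodL = foldr _*ᴷ_ 1#

  det : ∀ N → (Fin N → Fin N → Carrier) → Carrier
  det zero    M = 1#
  det (suc N) M =
    sumF (λ j → signR (toℕ j) *ᴷ (M Fin.zero j *ᴷ det N (λ a b → M (Fin.suc a) (punchIn j b))))

  -- μ_j + N − j  (j 1-indexed), here with 0-indexed j
  expo : ∀ N → (Fin N → ℤ) → Fin N → ℤ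
  expo N μ j = μ j ℤ.+ (+ (N ∸ suc (toℕ j)))

  lastZero : ∀ N → (Fin N → ℤ) → Bool
  lastZero zero    μ = false
  lastZero (suc N) μ = isZ (μ (Fin.fromℕ N))
    where
    isZ : ℤ → Bool
    isZ (+ zero) = true
    isZ _        = false

  zeroSeq : ∀ N → Fin N → ℤ
  zeroSeq N _ = + 0

  sNum sDen : ∀ N → (Fin N → ℤ) → (Fin N → Carrier) → Carrier
  sNum N μ y = det N (λ i j → zpow (y i) (expo N μ j))
  sDen N μ y = sNum N (zeroSeq N) y

  schur : ∀ N → (Fin N → ℤ) → (Fin N → Carrier) → Carrier
  schur N μ y = sNum N μ y *ᴷ inv (sDen N μ y)

  soNum soDen : ∀ N → (Fin N → ℤ) → (Fin N → Carrier) → Carrier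
  soNum N μ y = det N (λ i j → zpow (y i) (expo N μ j ℤ.+ + 1) -ᴷ zpow (y i) (ℤ.- expo N μ j))
  soDen N μ y = soNum N (zeroSeq N) y

  so : ∀ N → (Fin N → ℤ) → (Fin N → Carrier) → Carrier
  so N μ y = soNum N μ y *ᴷ inv (soDen N μ y)

  oNum oDen : ∀ N → (Fin N → ℤ) → (Fin N → Carrier) → Carrier
  oNum N μ y = det N (λ i j → zpow (y i) (expo N μ j) +ᴷ zpow (y i) (ℤ.- expo N μ j))
  oDen N μ y = (1# +ᴷ (if lastZero N μ then 1# else 0#)) *ᴷ oNum N (zeroSeq N) y

  oEven : ∀ N → (Fin N → ℤ) → (Fin N → Carrier) → Carrier
  oEven N μ y = oNum N μ y *ᴷ inv (oDen N μ y)

  -- a partition (list) viewed as a sequence of length N (padded by zeros)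
  seqOf : ∀ N → List ℕ → Fin N → ℤ
  seqOf N ρ j = + part ρ (toℕ j)

  IsPrimitiveRoot : ℕ → Carrier → Set ℓ
  IsPrimitiveRoot t ω = (pow ω t ≈ 1#) × (∀ k → 1 ≤ k → k < t → ¬ (pow ω k ≈ 1#))

  -- (X, ωX, …, ω^{t−1}X) : entry a·n + b is ω^a x_b
  rootVars : ∀ t n → Carrier → (Fin n → Carrier) → Fin (t * n) → Carrier
  rootVars t n ω X k = pow ω (toℕ (proj₁ (remQuot {t} n k))) *ᴷ X (proj₂ (remQuot {t} n k))

  powVars : ∀ n → ℕ → (Fin n → Carrier) → Fin n → Carrier
  powVars n t X b = pow (X b) t

  powInvVars : ∀ n → ℕ → (Fin n → Carrier) → Fin (n + n) → Carrier
  powInvVars n t X k with splitAt n k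
  ... | inj₁ b = pow (X b) t
  ... | inj₂ b = zpow (X b) (ℤ.- (+ t))

  negPowVars : ∀ n → ℕ → (Fin n → Carrier) → Fin n → Carrier
  negPowVars n t X b = -ᴷ pow (X b) t

  mu2 : ℕ → (n' : ℕ) → List ℕ → ℕ → Fin (n' + n') → ℤ
  mu2 t n' ρ i j =
    if toℕ j <ᵇ nRes (t * n') t ρ i
    then (+ part (quot (t * n') t ρ (t ∸ i)) 0) ℤ.+ (+ part (quot (t * n') t ρ i) (toℕ j))
    else (+ part (quot (t * n') t ρ (t ∸ i)) 0) ℤ.- (+ part (quot (t * n') t ρ (t ∸ i)) ((n' + n') ∸ suc (toℕ j)))

  epsilon : ℕ → ℕ → List ℕ → ℕ → ℤ
  epsilon t n ρ r =
    ℤ.- (+ sum (map (λ i → nRes (t * n) t ρ i C 2)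
                         (filterᵇ (λ i → ((t + 2) / 2) ≤ᵇ i) (upTo t))))
    ℤ.+ (if isEven t then + ((n * (n + t ∸ 1)) / 2 + n * r) else + (((t ∸ 1) * n) / 2))

  rhs : ℕ → ∀ n → Carrier → (Fin n → Carrier) → List ℕ → ℕ → Carrier
  rhs t n ω X ρ r =
    signZ (epsilon t n ρ r) *ᴷ (signR (inversions (sigmaList (t * n) t ρ)) *ᴷ
    (oEven n (seqOf n (quot (t * n) t ρ 0)) (powVars n t X) *ᴷ
    (prodL (map (λ i → schur (n + n) (mu2 t n ρ i) (powInvVars n t X)) (applyUpTo suc ((t ∸ 1) / 2))) *ᴷ
    (if isEven t
     then signR (sum (quot (t * n) t ρ (t / 2))) *ᴷ
          so n (seqOf n (quot (t * n) t ρ (t / 2))) (negPowVars n t X)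
     else 1#))))

  lhs : ∀ t n → Carrier → (Fin n → Carrier) → List ℕ → Carrier
  lhs t n ω X ρ = oEven (t * n) (seqOf (t * n) ρ) (rootVars t n ω X)

{-# OPTIONS --safe #-}

-- Write β for the beta set of λ. A discrete Fourier transform in the exponent a of the rows
-- ω^a x_b turns the numerator (y^β + y^−β) into a matrix that couples the rows of index k only
-- with the columns β ≡ ±k mod t. Ordering rows and columns by the pairs {i, t − i} makes it
-- block diagonal, so the determinant vanishes unless n₀ = n and n_i + n_{t−i} = 2n for all i,
-- and otherwise it is, up to sign, the product of the numerators on the right-hand side. The
-- Fourier determinant is the same for λ and for the empty partition, so it cancels in the
-- quotient, and the signs come from sorting the columns by residue and from the pairing.
--
-- Removing border strips preserves the n_i, and the beta set of a t-core is closed under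
-- subtracting t, hence determined by the n_i. A partition is orthogonal exactly when its beta
-- set with m = tn elements is symmetric about m (x is a bead if and only if 2m − x is not, and
-- m itself is not a bead), which for a core amounts to the conditions on the n_i. Its rank is
-- Σ max(n_i − n, 0), which gives the parity needed in the sign.

module Submission where

open import Defs
open import Level using (_⊔_)
open import Algebra.Bundles using (CommutativeRing)
open import Data.Bool using (Bool; true; false; if_then_else_; T)
open import Data.Empty using (⊥; ⊥-elim)
open import Data.Unit using (tt)
open import Data.Nat using (ℕ; zero; suc; _+_; _*_; _∸_; _≤_; _<_; _>_; _≡ᵇ_; _≤ᵇ_; _<ᵇ_; z≤n; s≤s; _/_; _%_)
import Data.Nat as ℕ
import Data.Nat.Properties as ℕₚ
open ℕₚ
  using (*-cancelʳ-≡; *-cancelˡ-≡; *-distribʳ-+; *-distribˡ-+; *-monoˡ-≤; *-suc; *-zeroʳ; +-cancelʳ-<; +-cancelʳ-≡;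
    +-cancelʳ-≤; +-cancelˡ-<; +-cancelˡ-≡; +-cancelˡ-≤; +-mono-<; +-mono-<-≤; +-mono-≤; +-mono-≤-<; +-monoʳ-<;
    +-monoʳ-≤; +-monoˡ-<; +-monoˡ-≤; +-suc; +-∸-assoc; +-∸-comm; 0∸n≡0; <-asym; <-cmp; <-trans; <-≤-trans; <ᵇ⇒<;
    <⇒<ᵇ; <⇒≢; <⇒≤; <⇒≯; <⇒≱; [m+n]∸[m+o]≡n∸o; m+[n∸m]≡n; m+n∸m≡n; m+n∸n≡m; m+n≡0⇒m≡0; m+n≡0⇒n≡0; m<m+n; m<n+m;
    m<n⇒0<n∸m; m<n⇒m<1+n; m∸[m∸n]≡n; m∸n+n≡m; m∸n≡0⇒m≤n; m∸n≤m; m≤m+n; m≤m⊔n; m≤n+m; m≤n⇒m<n∨m≡n; m≤n⇒m∸n≡0;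
    m≤n⇒m≤1+n; m≤n⇒m⊓n≡m; m≤n⊔m; m≥n⇒m⊓n≡n; n<1+n; n∸n≡0; n≢0⇒n>0; n≤0⇒n≡0; n≤1+n; n≮0; n≮n; pred[m∸n]≡m∸[1+n];
    suc-injective; suc-pred; ∸-monoʳ-<; ∸-monoʳ-≤; ∸-monoˡ-≤; ≡ᵇ⇒≡; ≡⇒≡ᵇ; ≤-<-trans; ≤-antisym; ≤-pred; ≤-refl;
    ≤-reflexive; ≤-total; ≤-trans; ≤ᵇ⇒≤; ≤′⇒≤; ≤⇒≤ᵇ; ≤⇒≤′; ≤⇒≯; ≤∧≢⇒<; ≮⇒≥; ≰⇒>; ⊓-idem; ⊔-sel)
open import Data.Fin using (Fin; toℕ; punchIn)
import Data.Fin as Fin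
open import Data.List using (List; []; _∷_; _++_; length; map; reverse; tabulate; allFin; lookup; filterᵇ; upTo; downFrom; applyUpTo; concatMap; zip)
open import Data.List.Membership.Propositional using (_∈_; _∉_)
open import Data.List.Relation.Unary.Any using (here; there)
open import Data.List.Relation.Unary.All using (All; []; _∷_)
open import Data.List.Relation.Unary.AllPairs using (AllPairs; []; _∷_)
open import Data.List.Relation.Unary.Unique.Propositional using (Unique)
open import Data.List.Relation.Binary.Permutation.Propositional using (_↭_; ↭-refl; ↭-sym; ↭-trans; ↭-prep; ↭-swap; ↭-reflexive)
open import Data.Product using (∃; _×_; _,_; proj₁; proj₂)
open import Data.Sum using (_⊎_; inj₁; inj₂; [_,_]′)
open import Relation.Nullary using (¬_; Dec; yes; no; contradiction)
open import Relation.Binary.Definitions using (DecidableEquality; Tri; tri<; tri≈; tri>)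
open import Relation.Binary.PropositionalEquality using (_≡_; _≢_; cong; cong₂; subst; subst₂; module ≡-Reasoning)
import Relation.Binary.PropositionalEquality as ≡
open import Function using (_∘_; id; flip)
import Data.List.Properties as Listₚ
import Data.List.Membership.Propositional.Properties as ∈ₚ
import Data.List.Relation.Unary.All as All
import Data.List.Relation.Binary.Permutation.Propositional as ↭
import Data.List.Relation.Binary.Permutation.Propositional.Properties as ↭ₚ
import Data.List.Relation.Unary.Unique.Propositional.Properties as Uniqueₚ
import Data.List.Relation.Unary.All.Properties as Allₚ
open import Data.Bool.Properties using (T?)
open import Data.Nat.Tactic.RingSolver using (solve-∀)
open import Data.List.Relation.Unary.Linked using (Linked; []; [-]; _∷_)
import Data.List.Relation.Unary.Linked as Linked
import Data.List.Relation.Unary.AllPairs.Properties as AllPairsₚ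
open import Data.Nat.ListAction using (sum)
import Data.Nat.DivMod as DivMod
open import Data.Integer using (ℤ) renaming (+_ to pos)
import Data.Integer as ℤ
import Data.Integer.Properties as ℤₚ
open import Relation.Binary.Construct.Closure.ReflexiveTransitive using (Star; ε; _◅_; _◅◅_)
import Relation.Binary.Construct.Closure.ReflexiveTransitive as Star
open import Relation.Unary using (Decidable)
open import Data.List.Membership.DecPropositional ℕₚ._≟_ using (_∈?_)
import Data.Integer.Tactic.RingSolver as ℤRing
import Data.Nat.ListAction.Properties as Sumₚ
open import Data.Nat.Combinatorics using (_C_; nCk+nC[k+1]≡[n+1]C[k+1]; nC1≡n)
import Data.Fin.Properties as Finₚ

-- Determinants indexed by lists

-- The obstacle is the signs: that of σ_λ, that of the pairing of classes and ε must be compared.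
-- Determinants are therefore indexed by lists of row and column labels, where a reordering of
-- columns is a rearrangement of a list, and each sign is computed once for an arbitrary
-- antisymmetric functional. The empty partition passes through the same steps as λ: its beta set is
-- sorted with an explicit sign, and its blocks are the denominators of the right-hand side. One
-- factorization thus yields numerator and denominator, the row scalings by powers of x either
-- cancel between the two or multiply to 1, and only denominators of characters are inverted. The
-- rank enters ε for even t alone: there the block of residue t/2 makes the number of classes that
-- an upper class has to cross odd, at the cost of (-1)^(n n_(t-i)). For n_i + n_(t-i) = 2n, the
-- number n_(t-i) + n has the parity of max(n_i - n, 0) + max(n_(t-i) - n, 0), and these terms add
-- up to the rank.

module ListDeterminant {c ℓ} (K : Field c ℓ) where
  open FieldDefs K public
  open CommutativeRing commutativeRing public
    using ( setoid; refl; sym; trans; reflexive; +-cong; +-congˡ; +-congʳ; *-cong; *-congˡ; *-congʳ; -‿cong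
          ; +-identityˡ; +-identityʳ; +-comm; +-assoc; *-identityˡ; *-identityʳ; *-comm; *-assoc
          ; distribˡ; distribʳ; zeroˡ; zeroʳ; -‿inverseʳ; ring; commutativeSemiring)
  open import Algebra.Properties.Ring ring public
    using (-‿distribˡ-*; -‿distribʳ-*; -0#≈0#; -‿involutive; -‿+-comm)
  open import Algebra.Solver.Ring.NaturalCoefficients.Default commutativeSemiring public
    using (solve; _:=_; _:+_; _:*_)
  open import Relation.Binary.Reasoning.Setoid setoid public

  0≈-0 : 0# ≈ -ᴷ 0#
  0≈-0 = sym -0#≈0#

  -- expand h (c₀ ∷ c₁ ∷ …) = Σⱼ (-1)ʲ h cⱼ (all c's but cⱼ)
  expand : ∀ {a} {C : Set a} → (C → List C → Carrier) → List C → Carrier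
  expand h []       = 0#
  expand h (x ∷ xs) = h x xs +ᴷ (-ᴷ expand (λ y ys → h y (x ∷ ys)) xs)

  -- Expansion along the first row. Lists of different lengths get the value 0: this lets blocks
  -- factor off without a condition on sizes, and it is the source of the vanishing in the
  -- unbalanced case.
  Det : ∀ {a b} {R : Set a} {C : Set b} → (R → C → Carrier) → List R → List C → Carrier
  Det M []       []      = 1#
  Det M []       (_ ∷ _) = 0#
  Det M (r ∷ rs) cs      = expand (λ x xs → M r x *ᴷ Det M rs xs) cs

  sumL : ∀ {a} {S : Set a} → (S → Carrier) → List S → Carrier
  sumL f []       = 0#
  sumL f (s ∷ ss) = f s +ᴷ sumL f ss

  prodOver : ∀ {a} {S : Set a} → (S → Carrier) → List S → Carrier
  prodOver f []       = 1#
  prodOver f (s ∷ ss) = f s *ᴷ prodOver f ss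

  module _ {a} {S : Set a} where
    sumL-cong : ∀ {f g : S → Carrier} ss → (∀ {s} → s ∈ ss → f s ≈ g s) → sumL f ss ≈ sumL g ss
    sumL-cong []       e = refl
    sumL-cong (s ∷ ss) e = +-cong (e (here ≡.refl)) (sumL-cong ss (λ s∈ → e (there s∈)))

    sumL-zero : ∀ {f : S → Carrier} ss → (∀ {s} → s ∈ ss → f s ≈ 0#) → sumL f ss ≈ 0#
    sumL-zero []       e = refl
    sumL-zero (s ∷ ss) e = trans (+-cong (e (here ≡.refl)) (sumL-zero ss (λ s∈ → e (there s∈)))) (+-identityˡ 0#)

    sumL-++ : ∀ (f : S → Carrier) xs ys → sumL f (xs ++ ys) ≈ sumL f xs +ᴷ sumL f ys
    sumL-++ f []       ys = sym (+-identityˡ _)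
    sumL-++ f (x ∷ xs) ys = trans (+-congˡ (sumL-++ f xs ys)) (sym (+-assoc _ _ _))

    sumL-+ : ∀ (f g : S → Carrier) ss → sumL (λ s → f s +ᴷ g s) ss ≈ sumL f ss +ᴷ sumL g ss
    sumL-+ f g []       = sym (+-identityˡ 0#)
    sumL-+ f g (s ∷ ss) = trans (+-congˡ (sumL-+ f g ss))
      (solve 4 (λ p q r u → ((p :+ q) :+ (r :+ u)) := ((p :+ r) :+ (q :+ u))) refl (f s) (g s) (sumL f ss) (sumL g ss))

    sumL-neg : ∀ (f : S → Carrier) ss → sumL (λ s → -ᴷ f s) ss ≈ -ᴷ sumL f ss
    sumL-neg f []       = 0≈-0
    sumL-neg f (s ∷ ss) = trans (+-congˡ (sumL-neg f ss)) (-‿+-comm _ _)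

    sumL-*ˡ : ∀ k (f : S → Carrier) ss → sumL (λ s → k *ᴷ f s) ss ≈ k *ᴷ sumL f ss
    sumL-*ˡ k f []       = sym (zeroʳ k)
    sumL-*ˡ k f (s ∷ ss) = trans (+-congˡ (sumL-*ˡ k f ss)) (sym (distribˡ k _ _))

    sumL-↭ : ∀ (f : S → Carrier) {xs ys} → xs ↭ ys → sumL f xs ≈ sumL f ys
    sumL-↭ f ↭.refl         = refl
    sumL-↭ f (↭.prep x p)   = +-congˡ (sumL-↭ f p)
    sumL-↭ f (↭.swap x y p) = trans (+-congˡ (+-congˡ (sumL-↭ f p)))
      (solve 3 (λ p q r → (p :+ (q :+ r)) := (q :+ (p :+ r))) refl (f x) (f y) _)
    sumL-↭ f (↭.trans p q)  = trans (sumL-↭ f p) (sumL-↭ f q)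

    prodOver-cong : ∀ {f g : S → Carrier} ss → (∀ {s} → s ∈ ss → f s ≈ g s) → prodOver f ss ≈ prodOver g ss
    prodOver-cong []       e = refl
    prodOver-cong (s ∷ ss) e = *-cong (e (here ≡.refl)) (prodOver-cong ss (λ s∈ → e (there s∈)))

    prodOver-++ : ∀ (f : S → Carrier) xs ys → prodOver f (xs ++ ys) ≈ prodOver f xs *ᴷ prodOver f ys
    prodOver-++ f []       ys = sym (*-identityˡ _)
    prodOver-++ f (x ∷ xs) ys = trans (*-congˡ (prodOver-++ f xs ys)) (sym (*-assoc _ _ _))

    prodOver-* : ∀ (f g : S → Carrier) ss → prodOver (λ s → f s *ᴷ g s) ss ≈ prodOver f ss *ᴷ prodOver g ss
    prodOver-* f g []       = sym (*-identityˡ 1#)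
    prodOver-* f g (s ∷ ss) = trans (*-congˡ (prodOver-* f g ss))
      (solve 4 (λ p q r u → ((p :* q) :* (r :* u)) := ((p :* r) :* (q :* u))) refl (f s) (g s) (prodOver f ss) (prodOver g ss))

    prodOver-1 : ∀ {f : S → Carrier} ss → (∀ {s} → s ∈ ss → f s ≈ 1#) → prodOver f ss ≈ 1#
    prodOver-1 []       e = refl
    prodOver-1 (s ∷ ss) e = trans (*-cong (e (here ≡.refl)) (prodOver-1 ss (λ s∈ → e (there s∈)))) (*-identityˡ 1#)

  module _ {a} {C : Set a} where
    expand-cong : ∀ {h g : C → List C → Carrier} cs →
                  (∀ x xs → x ∷ xs ↭ cs → h x xs ≈ g x xs) → expand h cs ≈ expand g cs
    expand-cong []       e = refl
    expand-cong (x ∷ cs) e = +-cong (e x cs ↭-refl)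
      (-‿cong (expand-cong cs (λ y ys p → e y (x ∷ ys) (↭-trans (↭-swap y x ↭-refl) (↭-prep x p)))))

    expand-zero : ∀ {h : C → List C → Carrier} cs →
                  (∀ x xs → x ∷ xs ↭ cs → h x xs ≈ 0#) → expand h cs ≈ 0#
    expand-zero {h} cs e = trans (expand-cong cs e) (zeros cs)
      where
      zeros : ∀ cs → expand (λ _ _ → 0#) cs ≈ 0#
      zeros []       = refl
      zeros (x ∷ cs) = trans (+-congˡ (trans (-‿cong (zeros cs)) -0#≈0#)) (+-identityˡ 0#)

    expand-+ : ∀ (h g : C → List C → Carrier) cs →
               expand (λ x xs → h x xs +ᴷ g x xs) cs ≈ expand h cs +ᴷ expand g cs
    expand-+ h g []       = sym (+-identityˡ 0#)
    expand-+ h g (x ∷ cs) = begin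
      (h x cs +ᴷ g x cs) +ᴷ (-ᴷ expand (λ y ys → h y (x ∷ ys) +ᴷ g y (x ∷ ys)) cs)
        ≈⟨ +-congˡ (trans (-‿cong (expand-+ _ _ cs)) (sym (-‿+-comm _ _))) ⟩
      (h x cs +ᴷ g x cs) +ᴷ ((-ᴷ expand (λ y ys → h y (x ∷ ys)) cs) +ᴷ (-ᴷ expand (λ y ys → g y (x ∷ ys)) cs))
        ≈⟨ solve 4 (λ p q r u → ((p :+ q) :+ (r :+ u)) := ((p :+ r) :+ (q :+ u))) refl (h x cs) (g x cs) _ _ ⟩
      _ ∎

    expand-*ˡ : ∀ k (h : C → List C → Carrier) cs → expand (λ x xs → k *ᴷ h x xs) cs ≈ k *ᴷ expand h cs
    expand-*ˡ k h []       = sym (zeroʳ k)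
    expand-*ˡ k h (x ∷ cs) = trans (+-congˡ (trans (-‿cong (expand-*ˡ k _ cs)) (-‿distribʳ-* _ _))) (sym (distribˡ _ _ _))

    expand-neg : ∀ (h : C → List C → Carrier) cs → expand (λ x xs → -ᴷ h x xs) cs ≈ -ᴷ expand h cs
    expand-neg h []       = 0≈-0
    expand-neg h (x ∷ cs) = trans (+-congˡ (-‿cong (expand-neg _ cs))) (-‿+-comm _ _)

    expand-sumL : ∀ {b} {S : Set b} (h : S → C → List C → Carrier) ss cs →
                  expand (λ x xs → sumL (λ s → h s x xs) ss) cs ≈ sumL (λ s → expand (h s) cs) ss
    expand-sumL h []       cs = expand-zero cs (λ _ _ _ → refl)
    expand-sumL h (s ∷ ss) cs = trans (expand-+ _ _ cs) (+-congˡ (expand-sumL h ss cs))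

    expand-++ : ∀ (h : C → List C → Carrier) cs ds → (∀ {x} xs → x ∈ ds → h x xs ≈ 0#) →
                expand h (cs ++ ds) ≈ expand (λ x xs → h x (xs ++ ds)) cs
    expand-++ h []       ds e = expand-zero ds (λ x xs p → e xs (↭ₚ.∈-resp-↭ p (here ≡.refl)))
    expand-++ h (x ∷ cs) ds e = +-congˡ (-‿cong (expand-++ _ cs ds (λ xs → e (x ∷ xs))))

    -- The terms that select `x` or `y` trade places, and neighbouring positions carry opposite
    -- signs; every other term keeps both entries and is exchanged by the hypothesis on `h`.
    expand-swap : ∀ (h : C → List C → Carrier) {x y} →
                  (∀ z ps qs → h z (ps ++ x ∷ y ∷ qs) ≈ -ᴷ h z (ps ++ y ∷ x ∷ qs)) →
                  ∀ ps qs → expand h (ps ++ x ∷ y ∷ qs) ≈ -ᴷ expand h (ps ++ y ∷ x ∷ qs)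
    expand-swap h {x} {y} e [] qs = begin
      h x (y ∷ qs) +ᴷ (-ᴷ (h y (x ∷ qs) +ᴷ (-ᴷ E x y)))
        ≈⟨ +-cong (sym (-‿involutive _)) (-‿cong (+-congˡ (-‿cong E-swap))) ⟩
      (-ᴷ (-ᴷ h x (y ∷ qs))) +ᴷ (-ᴷ (h y (x ∷ qs) +ᴷ (-ᴷ (-ᴷ E y x))))
        ≈⟨ -‿+-comm _ _ ⟩
      -ᴷ ((-ᴷ h x (y ∷ qs)) +ᴷ (h y (x ∷ qs) +ᴷ (-ᴷ (-ᴷ E y x))))
        ≈⟨ -‿cong (solve 3 (λ p q r → (p :+ (q :+ r)) := (q :+ (p :+ r))) refl _ _ _) ⟩
      -ᴷ (h y (x ∷ qs) +ᴷ ((-ᴷ h x (y ∷ qs)) +ᴷ (-ᴷ (-ᴷ E y x))))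
        ≈⟨ -‿cong (+-congˡ (-‿+-comm _ _)) ⟩
      -ᴷ (h y (x ∷ qs) +ᴷ (-ᴷ (h x (y ∷ qs) +ᴷ (-ᴷ E y x)))) ∎
      where
      E : C → C → Carrier
      E u v = expand (λ z zs → h z (u ∷ v ∷ zs)) qs
      E-swap : E x y ≈ -ᴷ E y x
      E-swap = trans (expand-cong qs (λ z zs _ → e z [] zs)) (expand-neg _ qs)
    expand-swap h {x} {y} e (p ∷ ps) qs =
      trans (+-cong (e p ps qs) (-‿cong (expand-swap _ (λ z us → e z (p ∷ us)) ps qs))) (-‿+-comm _ _)

    -- The two terms that select a copy of `x` cancel. Antisymmetry alone would only give that twice
    -- the value is 0, which says nothing in characteristic 2.
    expand-repeat : ∀ (h : C → List C → Carrier) {x} →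
                    (∀ z ps qs → h z (ps ++ x ∷ x ∷ qs) ≈ 0#) →
                    ∀ ps qs → expand h (ps ++ x ∷ x ∷ qs) ≈ 0#
    expand-repeat h {x} e [] qs = begin
      h x (x ∷ qs) +ᴷ (-ᴷ (h x (x ∷ qs) +ᴷ (-ᴷ expand (λ z zs → h z (x ∷ x ∷ zs)) qs)))
        ≈⟨ +-congˡ (-‿cong (trans (+-congˡ (trans (-‿cong (expand-zero qs (λ z zs _ → e z [] zs))) -0#≈0#)) (+-identityʳ _))) ⟩
      h x (x ∷ qs) +ᴷ (-ᴷ h x (x ∷ qs))
        ≈⟨ -‿inverseʳ _ ⟩
      0# ∎
    expand-repeat h {x} e (p ∷ ps) qs =
      trans (+-cong (e p ps qs) (trans (-‿cong (expand-repeat _ (λ z us → e z (p ∷ us)) ps qs)) -0#≈0#)) (+-identityˡ 0#)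

    expand-linear : ∀ {b} {S : Set b} (h : C → List C → Carrier) {x} (k : S → Carrier) (ι : S → C) ss →
                    (∀ qs → h x qs ≈ sumL (λ s → k s *ᴷ h (ι s) qs) ss) →
                    (∀ z ps qs → h z (ps ++ x ∷ qs) ≈ sumL (λ s → k s *ᴷ h z (ps ++ ι s ∷ qs)) ss) →
                    ∀ ps qs → expand h (ps ++ x ∷ qs) ≈ sumL (λ s → k s *ᴷ expand h (ps ++ ι s ∷ qs)) ss
    expand-linear h {x} k ι ss e₁ e₂ ps qs = go ps
      where
      collect : ∀ {u v : _ → Carrier} {p q} → p ≈ sumL (λ s → k s *ᴷ u s) ss → q ≈ sumL (λ s → k s *ᴷ v s) ss →
                p +ᴷ (-ᴷ q) ≈ sumL (λ s → k s *ᴷ (u s +ᴷ (-ᴷ v s))) ss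
      collect {u} {v} {p} {q} p≈ q≈ = begin
        p +ᴷ (-ᴷ q)
          ≈⟨ +-cong p≈ (trans (-‿cong q≈) (sym (sumL-neg _ ss))) ⟩
        sumL (λ s → k s *ᴷ u s) ss +ᴷ sumL (λ s → -ᴷ (k s *ᴷ v s)) ss
          ≈⟨ sym (sumL-+ _ _ ss) ⟩
        sumL (λ s → k s *ᴷ u s +ᴷ (-ᴷ (k s *ᴷ v s))) ss
          ≈⟨ sumL-cong ss (λ {s} _ → trans (+-congˡ (-‿distribʳ-* _ _)) (sym (distribˡ _ _ _))) ⟩
        sumL (λ s → k s *ᴷ (u s +ᴷ (-ᴷ v s))) ss ∎
      go : ∀ ps → expand h (ps ++ x ∷ qs) ≈ sumL (λ s → k s *ᴷ expand h (ps ++ ι s ∷ qs)) ss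
      go []       = collect (e₁ qs) (begin
        expand (λ y ys → h y (x ∷ ys)) qs
          ≈⟨ expand-cong qs (λ y ys _ → e₂ y [] ys) ⟩
        expand (λ y ys → sumL (λ s → k s *ᴷ h y (ι s ∷ ys)) ss) qs
          ≈⟨ expand-sumL _ ss qs ⟩
        sumL (λ s → expand (λ y ys → k s *ᴷ h y (ι s ∷ ys)) qs) ss
          ≈⟨ sumL-cong ss (λ {s} _ → expand-*ˡ (k s) _ qs) ⟩
        sumL (λ s → k s *ᴷ expand (λ y ys → h y (ι s ∷ ys)) qs) ss ∎)
      go (p ∷ ps) = collect (e₂ p ps qs)
        (expand-linear (λ y ys → h y (p ∷ ys)) k ι ss (λ rs → e₂′ rs) (λ z us → e₂ z (p ∷ us)) ps qs)
        where
        e₂′ : ∀ rs → h x (p ∷ rs) ≈ sumL (λ s → k s *ᴷ h (ι s) (p ∷ rs)) ss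
        e₂′ rs = e₁ (p ∷ rs)

    expand-map : ∀ {b} {B : Set b} (h : C → List C → Carrier) (g : B → C) bs →
                 expand h (map g bs) ≡ expand (λ x xs → h (g x) (map g xs)) bs
    expand-map h g []       = ≡.refl
    expand-map h g (b ∷ bs) = cong (λ z → h (g b) (map g bs) +ᴷ (-ᴷ z)) (expand-map (λ y ys → h y (g b ∷ ys)) g bs)

  record Antisymmetric {a} {A : Set a} (D : List A → Carrier) : Set (a ⊔ ℓ) where
    constructor antisymmetric
    field exchange : ∀ ps x y qs → D (ps ++ x ∷ y ∷ qs) ≈ -ᴷ D (ps ++ y ∷ x ∷ qs)
  open Antisymmetric public

  Alternating : ∀ {a} {A : Set a} → (List A → Carrier) → Set (a ⊔ ℓ)
  Alternating D = ∀ ps x qs → D (ps ++ x ∷ x ∷ qs) ≈ 0#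

  module _ {a b} {R : Set a} {C : Set b} where
    Det-cong : ∀ {M N : R → C → Carrier} rs cs → (∀ {r x} → r ∈ rs → x ∈ cs → M r x ≈ N r x) →
               Det M rs cs ≈ Det N rs cs
    Det-cong []       []      e = refl
    Det-cong []       (_ ∷ _) e = refl
    Det-cong (r ∷ rs) cs      e = expand-cong cs λ x xs p →
      *-cong (e (here ≡.refl) (↭ₚ.∈-resp-↭ p (here ≡.refl)))
             (Det-cong rs xs (λ r∈ x∈ → e (there r∈) (↭ₚ.∈-resp-↭ p (there x∈))))

    module _ (M : R → C → Carrier) where
      Det-exchange : ∀ rs ps x y qs → Det M rs (ps ++ x ∷ y ∷ qs) ≈ -ᴷ Det M rs (ps ++ y ∷ x ∷ qs)
      Det-exchange []       []       x y qs = 0≈-0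
      Det-exchange []       (p ∷ ps) x y qs = 0≈-0
      Det-exchange (r ∷ rs) ps       x y qs = expand-swap _
        (λ z us vs → trans (*-congˡ (Det-exchange rs us x y vs)) (sym (-‿distribʳ-* _ _))) ps qs

      Det-antisymmetric : ∀ rs → Antisymmetric (Det M rs)
      Det-antisymmetric rs = antisymmetric (Det-exchange rs)

      Det-alternating : ∀ rs → Alternating (Det M rs)
      Det-alternating []       []       x qs = refl
      Det-alternating []       (p ∷ ps) x qs = refl
      Det-alternating (r ∷ rs) ps       x qs = expand-repeat _
        (λ z us vs → trans (*-congˡ (Det-alternating rs us x vs)) (zeroʳ _)) ps qs

      Det-linear : ∀ {d} {S : Set d} rs {x} (k : S → Carrier) (ι : S → C) ss →
                   (∀ {r} → r ∈ rs → M r x ≈ sumL (λ s → k s *ᴷ M r (ι s)) ss) →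
                   ∀ ps qs → Det M rs (ps ++ x ∷ qs) ≈ sumL (λ s → k s *ᴷ Det M rs (ps ++ ι s ∷ qs)) ss
      Det-linear []       k ι ss e []      qs = sym (sumL-zero ss (λ _ → zeroʳ _))
      Det-linear []       k ι ss e (_ ∷ _) qs = sym (sumL-zero ss (λ _ → zeroʳ _))
      Det-linear (r ∷ rs) {x} k ι ss e ps  qs = expand-linear _ k ι ss first rest ps qs
        where
        first : ∀ qs → M r x *ᴷ Det M rs qs ≈ sumL (λ s → k s *ᴷ (M r (ι s) *ᴷ Det M rs qs)) ss
        first qs = begin
          M r x *ᴷ Det M rs qs
            ≈⟨ trans (*-congʳ (e (here ≡.refl))) (*-comm _ _) ⟩
          Det M rs qs *ᴷ sumL (λ s → k s *ᴷ M r (ι s)) ss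
            ≈⟨ sym (sumL-*ˡ _ _ ss) ⟩
          sumL (λ s → Det M rs qs *ᴷ (k s *ᴷ M r (ι s))) ss
            ≈⟨ sumL-cong ss (λ {s} _ → trans (*-comm _ _) (*-assoc _ _ _)) ⟩
          sumL (λ s → k s *ᴷ (M r (ι s) *ᴷ Det M rs qs)) ss ∎
        rest : ∀ z ps qs → M r z *ᴷ Det M rs (ps ++ x ∷ qs) ≈
               sumL (λ s → k s *ᴷ (M r z *ᴷ Det M rs (ps ++ ι s ∷ qs))) ss
        rest z ps qs = begin
          M r z *ᴷ Det M rs (ps ++ x ∷ qs)
            ≈⟨ *-congˡ (Det-linear rs k ι ss (λ r∈ → e (there r∈)) ps qs) ⟩
          M r z *ᴷ sumL (λ s → k s *ᴷ Det M rs (ps ++ ι s ∷ qs)) ss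
            ≈⟨ sym (sumL-*ˡ _ _ ss) ⟩
          sumL (λ s → M r z *ᴷ (k s *ᴷ Det M rs (ps ++ ι s ∷ qs))) ss
            ≈⟨ sumL-cong ss (λ _ → solve 3 (λ p q r → (p :* (q :* r)) := (q :* (p :* r))) refl _ _ _) ⟩
          sumL (λ s → k s *ᴷ (M r z *ᴷ Det M rs (ps ++ ι s ∷ qs))) ss ∎

  module _ {a} {A : Set a} where
    antisymmetric-prefix : ∀ {D : List A → Carrier} → Antisymmetric D → ∀ us → Antisymmetric (λ l → D (us ++ l))
    antisymmetric-prefix {D} anti us = antisymmetric λ ps x y qs → begin
      D (us ++ ps ++ x ∷ y ∷ qs)        ≡⟨ cong D (Listₚ.++-assoc us ps _) ⟨
      D ((us ++ ps) ++ x ∷ y ∷ qs)      ≈⟨ exchange anti (us ++ ps) x y qs ⟩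
      -ᴷ D ((us ++ ps) ++ y ∷ x ∷ qs)   ≡⟨ cong (λ z → -ᴷ D z) (Listₚ.++-assoc us ps _) ⟩
      -ᴷ D (us ++ ps ++ y ∷ x ∷ qs)     ∎

    antisymmetric-suffix : ∀ {D : List A → Carrier} → Antisymmetric D → ∀ vs → Antisymmetric (λ l → D (l ++ vs))
    antisymmetric-suffix {D} anti vs = antisymmetric λ ps x y qs → begin
      D ((ps ++ x ∷ y ∷ qs) ++ vs)      ≡⟨ cong D (Listₚ.++-assoc ps _ vs) ⟩
      D (ps ++ x ∷ y ∷ qs ++ vs)        ≈⟨ exchange anti ps x y (qs ++ vs) ⟩
      -ᴷ D (ps ++ y ∷ x ∷ qs ++ vs)     ≡⟨ cong (λ z → -ᴷ D z) (Listₚ.++-assoc ps _ vs) ⟨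
      -ᴷ D ((ps ++ y ∷ x ∷ qs) ++ vs)   ∎

    antisymmetric-map : ∀ {b} {B : Set b} {D : List A → Carrier} → Antisymmetric D → ∀ (f : B → A) →
                        Antisymmetric (λ l → D (map f l))
    antisymmetric-map {B = B} {D} anti f = antisymmetric go
      where
      go : ∀ ps x y qs → D (map f (ps ++ x ∷ y ∷ qs)) ≈ -ᴷ D (map f (ps ++ y ∷ x ∷ qs))
      go ps x y qs rewrite Listₚ.map-++ f ps (x ∷ y ∷ qs) | Listₚ.map-++ f ps (y ∷ x ∷ qs) =
        exchange anti (map f ps) (f x) (f y) (map f qs)

  -- If g s is, for each s in T, the term of s in the Laplace expansion up to the sign
  -- that E picks up when s is moved to the front, the signs cancel.
  expand-as-sum : ∀ {a} {S : Set a} (E : List S → Carrier) → Antisymmetric E → ∀ g (h : S → List S → Carrier) T →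
                  (∀ T₁ s T₂ → T ≡ T₁ ++ s ∷ T₂ → g s ≈ E (s ∷ T₁ ++ T₂) *ᴷ h s (T₁ ++ T₂)) →
                  sumL g T ≈ E T *ᴷ expand h T
  expand-as-sum E anti g h []       e = sym (zeroʳ _)
  expand-as-sum E anti g h (s ∷ T) e = begin
    g s +ᴷ sumL g T
      ≈⟨ +-cong (e [] s T ≡.refl)
                (expand-as-sum (λ l → -ᴷ E (s ∷ l)) (antisymmetric (λ ps x y qs → -‿cong (exchange anti (s ∷ ps) x y qs))) g (λ y ys → h y (s ∷ ys)) T step) ⟩
    E (s ∷ T) *ᴷ h s T +ᴷ (-ᴷ E (s ∷ T)) *ᴷ X
      ≈⟨ +-congˡ (trans (sym (-‿distribˡ-* _ _)) (-‿distribʳ-* _ _)) ⟩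
    E (s ∷ T) *ᴷ h s T +ᴷ E (s ∷ T) *ᴷ (-ᴷ X)
      ≈⟨ sym (distribˡ _ _ _) ⟩
    E (s ∷ T) *ᴷ (h s T +ᴷ (-ᴷ X)) ∎
    where
    X = expand (λ y ys → h y (s ∷ ys)) T
    step : ∀ T₁ u T₂ → T ≡ T₁ ++ u ∷ T₂ → g u ≈ (-ᴷ E (s ∷ u ∷ T₁ ++ T₂)) *ᴷ h u (s ∷ T₁ ++ T₂)
    step T₁ u T₂ eq = trans (e (s ∷ T₁) u T₂ (cong (s ∷_) eq)) (*-congʳ (exchange anti [] u s (T₁ ++ T₂)))

  module _ {a b} {S : Set a} {C : Set b} (F : S → C → Carrier) (ss : List S) where

    -- An alternating multilinear form is determined by its values on basis columns. The columns
    -- `inj₂ x` are expanded one at a time from the front; `used` records the basis columns already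
    -- placed, whose repetition kills the term, so that the surviving choices form the Laplace
    -- expansion of the coefficient determinant over `T`.
    alternating-extension :
      (D : List (S ⊎ C) → Carrier) → Antisymmetric D → Alternating D →
      (∀ ps x qs → D (ps ++ inj₂ x ∷ qs) ≈ sumL (λ s → F s x *ᴷ D (ps ++ inj₁ s ∷ qs)) ss) →
      ∀ used cs T → (∀ {s} l → s ∈ used → D (inj₁ s ∷ l) ≈ 0#) → ss ↭ used ++ T → length T ≡ length cs →
      D (map inj₂ cs) ≈ D (map inj₁ T) *ᴷ Det (flip F) cs T
    alternating-extension D anti alt lin used []       []      zero-used p eq = sym (*-identityʳ _)
    alternating-extension D anti alt lin used (x ∷ cs) T       zero-used p eq = begin
      D (inj₂ x ∷ map inj₂ cs)
        ≈⟨ lin [] x _ ⟩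
      sumL g ss
        ≈⟨ trans (sumL-↭ g p) (sumL-++ g used T) ⟩
      sumL g used +ᴷ sumL g T
        ≈⟨ +-congʳ (sumL-zero used (λ s∈ → trans (*-congˡ (zero-used _ s∈)) (zeroʳ _))) ⟩
      0# +ᴷ sumL g T
        ≈⟨ +-identityˡ _ ⟩
      sumL g T
        ≈⟨ expand-as-sum (λ l → D (map inj₁ l)) anti′ g (λ s T′ → F s x *ᴷ Det (flip F) cs T′) T step ⟩
      D (map inj₁ T) *ᴷ Det (flip F) (x ∷ cs) T ∎
      where
      g : S → Carrier
      g s = F s x *ᴷ D (inj₁ s ∷ map inj₂ cs)
      anti′ : Antisymmetric (λ l → D (map inj₁ l))
      anti′ = antisymmetric-map anti inj₁
      step : ∀ T₁ s T₂ → T ≡ T₁ ++ s ∷ T₂ →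
             g s ≈ D (map inj₁ (s ∷ T₁ ++ T₂)) *ᴷ (F s x *ᴷ Det (flip F) cs (T₁ ++ T₂))
      step T₁ s T₂ ≡.refl = trans (*-congˡ
        (alternating-extension (λ l → D (inj₁ s ∷ l)) (antisymmetric-prefix anti (inj₁ s ∷ [])) (λ ps → alt (inj₁ s ∷ ps))
          (λ ps → lin (inj₁ s ∷ ps)) (s ∷ used) cs (T₁ ++ T₂) zero′ p′ len′))
        (solve 3 (λ p q r → (p :* (q :* r)) := (q :* (p :* r))) refl _ _ _)
        where
        zero′ : ∀ {u} l → u ∈ s ∷ used → D (inj₁ s ∷ inj₁ u ∷ l) ≈ 0#
        zero′ l (here ≡.refl) = alt [] (inj₁ s) l
        zero′ {u} l (there u∈) =
          trans (exchange anti [] (inj₁ s) (inj₁ u) l) (trans (-‿cong (zero-used _ u∈)) -0#≈0#)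
        p′ : ss ↭ s ∷ used ++ (T₁ ++ T₂)
        p′ = ↭-trans p (↭-trans (↭ₚ.++⁺ˡ used (↭ₚ.shift s T₁ T₂)) (↭ₚ.shift s used (T₁ ++ T₂)))
        len′ : length (T₁ ++ T₂) ≡ length cs
        len′ = suc-injective (≡.trans (↭ₚ.↭-length (↭-sym (↭ₚ.shift s T₁ T₂))) eq)

  -- The columns of `G` and of `M` are put into one matrix `H` over `S ⊎ C`. Its determinant is an
  -- alternating form in the columns, and those of `M` are combinations of those of `G` with
  -- coefficients `F`. The second factor comes out transposed, which `Det-transpose-unique`
  -- exploits.
  Det-product : ∀ {a b d} {R : Set a} {S : Set b} {C : Set d}
                (M : R → C → Carrier) (G : R → S → Carrier) (F : S → C → Carrier) rs ss cs →
                (∀ {r} → r ∈ rs → ∀ x → M r x ≈ sumL (λ s → F s x *ᴷ G r s) ss) → length ss ≡ length cs →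
                Det M rs cs ≈ Det G rs ss *ᴷ Det (flip F) cs ss
  Det-product {R = R} {S} {C} M G F rs ss cs e len = begin
    Det M rs cs
      ≈⟨ Det-via inj₂ rs cs ⟩
    Det H rs (map inj₂ cs)
      ≈⟨ alternating-extension F ss (Det H rs) (Det-antisymmetric H rs) (Det-alternating H rs)
           (λ ps x qs → Det-linear H rs (λ s → F s x) inj₁ ss (λ r∈ → e r∈ x) ps qs)
           [] cs ss (λ l ()) ↭-refl len ⟩
    Det H rs (map inj₁ ss) *ᴷ Det (flip F) cs ss
      ≈⟨ *-congʳ (sym (Det-via inj₁ rs ss)) ⟩
    Det G rs ss *ᴷ Det (flip F) cs ss ∎
    where
    H : R → S ⊎ C → Carrier
    H r = [ G r , M r ]′
    Det-via : ∀ {e} {B : Set e} (ι : B → S ⊎ C) rs bs → Det (λ r y → H r (ι y)) rs bs ≈ Det H rs (map ι bs)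
    Det-via ι []       []      = refl
    Det-via ι []       (_ ∷ _) = refl
    Det-via ι (r ∷ rs) bs      = sym (trans (reflexive (expand-map _ ι bs))
      (expand-cong bs (λ y ys _ → *-congˡ (sym (Det-via ι rs ys)))))

  module _ {a b} {R : Set a} {C : Set b} where
    Det-map : ∀ {d e} {R′ : Set d} {C′ : Set e} (M : R → C → Carrier) (f : R′ → R) (g : C′ → C) rs cs →
              Det M (map f rs) (map g cs) ≈ Det (λ r x → M (f r) (g x)) rs cs
    Det-map M f g []       []      = refl
    Det-map M f g []       (_ ∷ _) = refl
    Det-map M f g (r ∷ rs) cs      = trans (reflexive (expand-map _ g cs))
      (expand-cong cs (λ x xs _ → *-congˡ (Det-map M f g rs xs)))

    Det-length : ∀ (M : R → C → Carrier) rs cs → ¬ (length rs ≡ length cs) → Det M rs cs ≈ 0#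
    Det-length M []       []      ne = contradiction ≡.refl ne
    Det-length M []       (_ ∷ _) ne = refl
    Det-length M (r ∷ rs) cs      ne = expand-zero cs λ x xs p →
      trans (*-congˡ (Det-length M rs xs (λ eq → ne (≡.trans (cong suc eq) (↭ₚ.↭-length p))))) (zeroʳ _)

    Det-zero-column : ∀ (M : R → C → Carrier) rs {x} cs → x ∈ cs → (∀ {r} → r ∈ rs → M r x ≈ 0#) → Det M rs cs ≈ 0#
    Det-zero-column M rs cs x∈ e with ∈ₚ.∈-∃++ x∈
    -- A zero column is a linear combination over the empty index set.
    ... | ps , qs , ≡.refl = Det-linear M {S = ⊥} rs (λ ()) (λ ()) [] e ps qs

    -- No condition on the sizes: both sides vanish when the diagonal blocks are not square.
    Det-block-diagonal : ∀ (M : R → C → Carrier) rs₁ rs₂ cs₁ cs₂ →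
      (∀ {r x} → r ∈ rs₁ → x ∈ cs₂ → M r x ≈ 0#) → (∀ {r x} → r ∈ rs₂ → x ∈ cs₁ → M r x ≈ 0#) →
      Det M (rs₁ ++ rs₂) (cs₁ ++ cs₂) ≈ Det M rs₁ cs₁ *ᴷ Det M rs₂ cs₂
    Det-block-diagonal M []        rs₂ []        cs₂ z₁ z₂ = sym (*-identityˡ _)
    Det-block-diagonal M []        rs₂ (x ∷ cs₁) cs₂ z₁ z₂ =
      trans (Det-zero-column M rs₂ (x ∷ cs₁ ++ cs₂) (here ≡.refl) (λ r∈ → z₂ r∈ (here ≡.refl))) (sym (zeroˡ _))
    Det-block-diagonal M (r ∷ rs₁) rs₂ cs₁       cs₂ z₁ z₂ = begin
      expand (λ x xs → M r x *ᴷ Det M (rs₁ ++ rs₂) xs) (cs₁ ++ cs₂)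
        ≈⟨ expand-++ _ cs₁ cs₂ (λ xs x∈ → trans (*-congʳ (z₁ (here ≡.refl) x∈)) (zeroˡ _)) ⟩
      expand (λ x xs → M r x *ᴷ Det M (rs₁ ++ rs₂) (xs ++ cs₂)) cs₁
        ≈⟨ expand-cong cs₁ (λ x xs p → trans (*-congˡ (Det-block-diagonal M rs₁ rs₂ xs cs₂ (λ r∈ → z₁ (there r∈))
              (λ r∈ x∈ → z₂ r∈ (↭ₚ.∈-resp-↭ p (there x∈)))))
              (solve 3 (λ p q r → (p :* (q :* r)) := (r :* (p :* q))) refl _ _ _)) ⟩
      expand (λ x xs → Det M rs₂ cs₂ *ᴷ (M r x *ᴷ Det M rs₁ xs)) cs₁
        ≈⟨ trans (expand-*ˡ _ _ cs₁) (*-comm _ _) ⟩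
      Det M (r ∷ rs₁) cs₁ *ᴷ Det M rs₂ cs₂ ∎

    Det-scale-rows : ∀ (M : R → C → Carrier) (k : R → Carrier) rs cs →
                     Det (λ r x → k r *ᴷ M r x) rs cs ≈ prodOver k rs *ᴷ Det M rs cs
    Det-scale-rows M k []       cs = trans (det-[] cs) (sym (*-identityˡ _))
      where
      det-[] : ∀ cs → Det (λ r x → k r *ᴷ M r x) [] cs ≈ Det M [] cs
      det-[] []      = refl
      det-[] (_ ∷ _) = refl
    Det-scale-rows M k (r ∷ rs) cs = trans
      (expand-cong cs (λ x xs _ → trans (*-congˡ (Det-scale-rows M k rs xs))
        (solve 4 (λ p q r u → ((p :* q) :* (r :* u)) := ((p :* r) :* (q :* u))) refl _ _ _ _)))
      (expand-*ˡ _ _ cs)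

  module _ {a} {R : Set a} (_≟_ : DecidableEquality R) where
    δ : R → R → Carrier
    δ r s with r ≟ s
    ... | yes _ = 1#
    ... | no  _ = 0#

    δ-refl : ∀ r → δ r r ≈ 1#
    δ-refl r with r ≟ r
    ... | yes _  = refl
    ... | no  ne = contradiction ≡.refl ne

    δ-≢ : ∀ {r s} → ¬ (r ≡ s) → δ r s ≈ 0#
    δ-≢ {r} {s} ne with r ≟ s
    ... | yes eq = contradiction eq ne
    ... | no  _  = refl

    Unique-head : ∀ {r : R} {rs s} → Unique (r ∷ rs) → s ∈ rs → ¬ (r ≡ s)
    Unique-head (al ∷ _) s∈ = All.lookup al s∈

    sumL-δ : ∀ {rs} → Unique rs → ∀ {r} → r ∈ rs → ∀ (f : R → Carrier) → sumL (λ s → f s *ᴷ δ r s) rs ≈ f r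
    sumL-δ {r ∷ rs} u (here ≡.refl) f = trans
      (+-cong (trans (*-congˡ (δ-refl r)) (*-identityʳ _))
              (sumL-zero rs (λ s∈ → trans (*-congˡ (δ-≢ (Unique-head u s∈))) (zeroʳ _))))
      (+-identityʳ _)
    sumL-δ {r ∷ rs} u@(_ ∷ u′) (there r∈) f = trans
      (+-cong (trans (*-congˡ (δ-≢ (λ eq → Unique-head u r∈ (≡.sym eq)))) (zeroʳ _)) (sumL-δ u′ r∈ f))
      (+-identityˡ _)

    Det-δ : ∀ {rs} → Unique rs → Det δ rs rs ≈ 1#
    Det-δ {[]}     u          = refl
    Det-δ {r ∷ rs} u@(_ ∷ u′) = begin
      δ r r *ᴷ Det δ rs rs +ᴷ (-ᴷ expand (λ x xs → δ r x *ᴷ Det δ rs (r ∷ xs)) rs)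
        ≈⟨ +-cong (*-cong (δ-refl r) (Det-δ u′)) (-‿cong (expand-zero rs (λ x xs p →
             trans (*-congʳ (δ-≢ (Unique-head u (↭ₚ.∈-resp-↭ p (here ≡.refl))))) (zeroˡ _)))) ⟩
      1# *ᴷ 1# +ᴷ (-ᴷ 0#)
        ≈⟨ +-cong (*-identityˡ 1#) -0#≈0# ⟩
      1# +ᴷ 0#
        ≈⟨ +-identityʳ _ ⟩
      1# ∎

    -- Multiplicativity applied to the identity matrix times `M`: the first factor is 1 and the
    -- second is returned transposed.
    Det-transpose-unique : ∀ {b} {C : Set b} (M : R → C → Carrier) rs cs → Unique rs → length rs ≡ length cs →
                           Det M rs cs ≈ Det (flip M) cs rs
    Det-transpose-unique M rs cs u len = begin
      Det M rs cs
        ≈⟨ Det-product M δ M rs rs cs (λ r∈ x → sym (sumL-δ u r∈ (λ s → M s x))) len ⟩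
      Det δ rs rs *ᴷ Det (flip M) cs rs
        ≈⟨ trans (*-congʳ (Det-δ u)) (*-identityˡ _) ⟩
      Det (flip M) cs rs ∎

  module _ {a b} {R : Set a} {C : Set b} where
    -- Row labels may repeat, which would spoil the identity matrix `δ`; their positions in the list
    -- are distinct and replace them.
    Det-transpose : ∀ (M : R → C → Carrier) rs cs → length rs ≡ length cs → Det M rs cs ≈ Det (flip M) cs rs
    Det-transpose M rs cs len = begin
      Det M rs cs
        ≡⟨ cong₂ (Det M) rs≡ (≡.sym (Listₚ.map-id cs)) ⟩
      Det M (map (lookup rs) is) (map id cs)
        ≈⟨ Det-map M (lookup rs) id is cs ⟩
      Det (λ i x → M (lookup rs i) x) is cs
        ≈⟨ Det-transpose-unique Fin._≟_ _ is cs (Uniqueₚ.allFin⁺ _) (≡.trans (Listₚ.length-tabulate id) len) ⟩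
      Det (λ x i → M (lookup rs i) x) cs is
        ≈⟨ sym (Det-map (flip M) id (lookup rs) cs is) ⟩
      Det (flip M) (map id cs) (map (lookup rs) is)
        ≡⟨ cong₂ (Det (flip M)) (Listₚ.map-id cs) (≡.sym rs≡) ⟩
      Det (flip M) cs rs ∎
      where
      is = allFin (length rs)
      rs≡ : rs ≡ map (lookup rs) is
      rs≡ = ≡.sym (≡.trans (Listₚ.map-tabulate id (lookup rs)) (Listₚ.tabulate-lookup rs))

  module _ {a b} {R : Set a} {C : Set b} where
    Det-scale-columns : ∀ (M : R → C → Carrier) (k : C → Carrier) rs cs → length rs ≡ length cs →
                        Det (λ r x → k x *ᴷ M r x) rs cs ≈ prodOver k cs *ᴷ Det M rs cs
    Det-scale-columns M k rs cs len = begin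
      Det (λ r x → k x *ᴷ M r x) rs cs
        ≈⟨ Det-transpose _ rs cs len ⟩
      Det (λ x r → k x *ᴷ M r x) cs rs
        ≈⟨ Det-scale-rows (flip M) k cs rs ⟩
      prodOver k cs *ᴷ Det (flip M) cs rs
        ≈⟨ *-congˡ (Det-transpose (flip M) cs rs (≡.sym len)) ⟩
      prodOver k cs *ᴷ Det M rs cs ∎

  sumF-cong : ∀ {N} (f g : Fin N → Carrier) → (∀ j → f j ≈ g j) → sumF f ≈ sumF g
  sumF-cong {zero}  f g e = refl
  sumF-cong {suc N} f g e = +-cong (e Fin.zero) (sumF-cong _ _ (λ j → e (Fin.suc j)))

  sumF-neg : ∀ {N} (f : Fin N → Carrier) → sumF (λ j → -ᴷ f j) ≈ -ᴷ sumF f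
  sumF-neg {zero}  f = 0≈-0
  sumF-neg {suc N} f = trans (+-congˡ (sumF-neg (λ j → f (Fin.suc j)))) (-‿+-comm _ _)

  expand-tabulate : ∀ {a} {C : Set a} N (h : C → List C → Carrier) (g : Fin (suc N) → C) →
                    sumF (λ j → signR (toℕ j) *ᴷ h (g j) (tabulate (λ i → g (punchIn j i)))) ≈ expand h (tabulate g)
  expand-tabulate zero    h g = +-cong (*-identityˡ _) 0≈-0
  expand-tabulate (suc N) h g = +-cong (*-identityˡ _) (begin
    sumF (λ j → (-ᴷ signR (toℕ j)) *ᴷ minor j)
      ≈⟨ sumF-cong (λ j → (-ᴷ signR (toℕ j)) *ᴷ minor j) (λ j → -ᴷ term j) (λ j → sym (-‿distribˡ-* _ _)) ⟩
    sumF (λ j → -ᴷ term j)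
      ≈⟨ sumF-neg term ⟩
    -ᴷ sumF term
      ≈⟨ -‿cong (expand-tabulate N (λ y ys → h y (g Fin.zero ∷ ys)) (λ i → g (Fin.suc i))) ⟩
    -ᴷ expand (λ y ys → h y (g Fin.zero ∷ ys)) (tabulate (λ i → g (Fin.suc i))) ∎)
    where
    minor term : Fin (suc N) → Carrier
    minor j = h (g (Fin.suc j)) (g Fin.zero ∷ tabulate (λ i → g (Fin.suc (punchIn j i))))
    term j = signR (toℕ j) *ᴷ minor j

  det-tabulate : ∀ {a b} {R : Set a} {C : Set b} N (M : R → C → Carrier) (f : Fin N → R) (g : Fin N → C) →
                 det N (λ i j → M (f i) (g j)) ≈ Det M (tabulate f) (tabulate g)
  det-tabulate zero    M f g = refl
  det-tabulate (suc N) M f g = trans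
    (sumF-cong (λ j → signR (toℕ j) *ᴷ (M (f Fin.zero) (g j) *ᴷ det N (λ i k → M (f (Fin.suc i)) (g (punchIn j k)))))
               (λ j → signR (toℕ j) *ᴷ (M (f Fin.zero) (g j) *ᴷ Det M rows (tabulate (λ k → g (punchIn j k)))))
               (λ j → *-congˡ (*-congˡ (det-tabulate N M (λ i → f (Fin.suc i)) (λ i → g (punchIn j i))))))
    (expand-tabulate N (λ x xs → M (f Fin.zero) x *ᴷ Det M rows xs) g)
    where rows = tabulate (λ i → f (Fin.suc i))

  det-cong : ∀ N {M M′ : Fin N → Fin N → Carrier} → (∀ i j → M i j ≈ M′ i j) → det N M ≈ det N M′
  det-cong zero    e = refl
  det-cong (suc N) {M} {M′} e = sumF-cong
    (λ j → signR (toℕ j) *ᴷ (M Fin.zero j *ᴷ det N (λ i k → M (Fin.suc i) (punchIn j k))))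
    (λ j → signR (toℕ j) *ᴷ (M′ Fin.zero j *ᴷ det N (λ i k → M′ (Fin.suc i) (punchIn j k))))
    (λ j → *-congˡ (*-cong (e Fin.zero j) (det-cong N (λ i k → e (Fin.suc i) (punchIn j k)))))

-- Antisymmetric functionals on lists

-- The binomial coefficient n over 2, the number of exchanges that reverse a block of length `n`.
triangle : ℕ → ℕ
triangle zero    = 0
triangle (suc n) = triangle n + n

-- The modulus is t = 1 + width e h = 1 + e + 2h: h counts the pairs {i, t − i}, and e = 1
-- when t is even, so that the residue t/2 remains.
width : ℕ → ℕ → ℕ
width e zero    = e
width e (suc h) = suc (suc (width e h))

cat : ∀ {a} {A : Set a} → (ℕ → List A) → ℕ → ℕ → List A
cat b lo zero    = []
cat b lo (suc k) = b lo ++ cat b (suc lo) k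

cat-snoc : ∀ {a} {A : Set a} (b : ℕ → List A) lo k → cat b lo (suc k) ≡ cat b lo k ++ b (lo + k)
cat-snoc b lo zero    = ≡.trans (Listₚ.++-identityʳ _) (cong b (≡.sym (ℕₚ.+-identityʳ lo)))
cat-snoc b lo (suc k) = begin
  b lo ++ cat b (suc lo) (suc k)             ≡⟨ cong (b lo ++_) (cat-snoc b (suc lo) k) ⟩
  b lo ++ (cat b (suc lo) k ++ b (suc lo + k)) ≡⟨ Listₚ.++-assoc (b lo) _ _ ⟨
  cat b lo (suc k) ++ b (suc lo + k)         ≡⟨ cong (λ z → cat b lo (suc k) ++ b z) (+-suc lo k) ⟨
  cat b lo (suc k) ++ b (lo + suc k)         ∎
  where open ≡-Reasoning

length-cat-uniform : ∀ {a} {A : Set a} (b : ℕ → List A) {n} → (∀ i → length (b i) ≡ n) →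
                     ∀ lo k → length (cat b lo k) ≡ k * n
length-cat-uniform b len lo zero    = ≡.refl
length-cat-uniform b len lo (suc k) =
  ≡.trans (Listₚ.length-++ (b lo)) (cong₂ _+_ (len lo) (length-cat-uniform b len (suc lo) k))

concatMap-upTo : ∀ {a} {A : Set a} (b : ℕ → List A) k → concatMap b (upTo k) ≡ cat b 0 k
concatMap-upTo b k = go id 0 k (λ _ → ≡.refl)
  where
  go : ∀ (f : ℕ → ℕ) lo k → (∀ i → f i ≡ lo + i) → concatMap b (applyUpTo f k) ≡ cat b lo k
  go f lo zero    e = ≡.refl
  go f lo (suc k) e = cong₂ _++_ (cong b (≡.trans (e 0) (ℕₚ.+-identityʳ lo)))
    (go (f ∘ suc) (suc lo) k (λ i → ≡.trans (e (suc i)) (+-suc lo i)))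

module _ {a} {A : Set a} (b : ℕ → List A) (t : ℕ) where
  -- the blocks lo, t−lo, lo+1, t−lo−1, …, with f applied to every second one, ending
  -- with the unpaired block t/2 when e = 1
  paired : (List A → List A) → ℕ → ℕ → ℕ → List A
  paired f e lo zero    = cat b lo e
  paired f e lo (suc h) = (b lo ++ f (b (t ∸ lo))) ++ paired f e (suc lo) h

  -- The first summand counts the exchanges that carry the block of `t ∸ lo` to the left across the
  -- `width e h` blocks between, which have `n * width e h` entries in all when the lengths are
  -- balanced; the second reverses that block.
  pairingSign : ℕ → ℕ → ℕ → ℕ → ℕ
  pairingSign n e lo zero    = 0
  pairingSign n e lo (suc h) =
    (n * width e h) * length (b (t ∸ lo)) + (triangle (length (b (t ∸ lo))) + pairingSign n e (suc lo) h)

  -- For even `t` the index t/2 is its own partner, and the condition then says that this block has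
  -- length `n`.
  Balanced : ℕ → Set
  Balanced n = ∀ i → 1 ≤ i → i < t → length (b i) + length (b (t ∸ i)) ≡ n + n

  -- In every recursion over pairs, `lo + lo + width e h ≡ suc t` is the invariant: the blocks that
  -- remain are those from `lo` to `t ∸ lo`, and there are `width e h` of them.
  upper-index : ∀ lo w → lo + lo + suc (suc w) ≡ suc t → suc lo + w ≡ t ∸ lo × lo < t
  upper-index lo w eq = ≡.trans (≡.sym (m+n∸m≡n lo (suc lo + w))) (cong (_∸ lo) t≡) ,
                        subst (lo <_) t≡ (m<m+n lo (s≤s z≤n))
    where
    t≡ : lo + (suc lo + w) ≡ t
    t≡ = suc-injective (≡.trans (lemma lo w) eq)
      where
      lemma : ∀ lo w → suc (lo + (suc lo + w)) ≡ lo + lo + suc (suc w)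
      lemma = solve-∀

  next : ∀ e lo h → lo + lo + width e (suc h) ≡ suc t → suc lo + suc lo + width e h ≡ suc t
  next e lo h eq = ≡.trans (lemma lo (width e h)) eq
    where
    lemma : ∀ lo w → suc lo + suc lo + w ≡ lo + lo + suc (suc w)
    lemma = solve-∀

  paired-↭ : ∀ f → (∀ xs → f xs ↭ xs) → ∀ e lo h → lo + lo + width e h ≡ suc t → paired f e lo h ↭ cat b lo (width e h)
  paired-↭ f f↭ e lo zero    eq = ↭-refl
  paired-↭ f f↭ e lo (suc h) eq =
    ↭-trans (↭-reflexive (Listₚ.++-assoc (b lo) (f (b (t ∸ lo))) _)) (↭ₚ.++⁺ˡ (b lo)
      (↭-trans (↭ₚ.++⁺ (f↭ (b (t ∸ lo))) (paired-↭ f f↭ e (suc lo) h (next e lo h eq)))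
        (↭-trans (↭ₚ.++-comm (b (t ∸ lo)) _)
          (↭-reflexive (≡.sym (≡.trans (cat-snoc b (suc lo) (width e h))
            (cong (λ z → cat b (suc lo) (width e h) ++ b z) (proj₁ (upper-index lo (width e h) eq)))))))))

  length-cat : ∀ e n → Balanced n → e ≤ 1 → ∀ lo h → 1 ≤ lo → lo + lo + width e h ≡ suc t →
               length (cat b lo (width e h)) ≡ n * width e h
  length-cat zero n bal e≤1 lo zero 1≤lo eq = ≡.sym (*-zeroʳ n)
  length-cat (suc zero) n bal e≤1 lo zero 1≤lo eq = begin
    length (b lo ++ [])  ≡⟨ cong length (Listₚ.++-identityʳ (b lo)) ⟩
    length (b lo)        ≡⟨ double-injective (≡.trans (cong (λ z → length (b lo) + length (b z)) lo≡) (bal lo 1≤lo lo<t)) ⟩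
    n                    ≡⟨ ℕₚ.*-identityʳ n ⟨
    n * 1                ∎
    where
    open ≡-Reasoning
    t≡ : lo + lo ≡ t
    t≡ = suc-injective (≡.trans (ℕₚ.+-comm 1 (lo + lo)) eq)
    lo≡ : lo ≡ t ∸ lo
    lo≡ = ≡.trans (≡.sym (m+n∸m≡n lo lo)) (cong (_∸ lo) t≡)
    lo<t : lo < t
    lo<t = subst (lo <_) t≡ (m<m+n lo 1≤lo)
    double-injective : ∀ {x y} → x + x ≡ y + y → x ≡ y
    double-injective {x} {y} p = *-cancelˡ-≡ x y 2 (≡.trans (dbl x) (≡.trans p (≡.sym (dbl y))))
      where
      dbl : ∀ x → 2 * x ≡ x + x
      dbl = solve-∀
  length-cat (suc (suc _)) n bal (s≤s ()) lo zero 1≤lo eq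
  length-cat e n bal e≤1 lo (suc h) 1≤lo eq = begin
    length (b lo ++ cat b (suc lo) (suc w))
      ≡⟨ cong (λ z → length (b lo ++ z)) (cat-snoc b (suc lo) w) ⟩
    length (b lo ++ (cat b (suc lo) w ++ b (suc lo + w)))
      ≡⟨ ≡.trans (Listₚ.length-++ (b lo)) (cong (length (b lo) +_) (Listₚ.length-++ (cat b (suc lo) w))) ⟩
    length (b lo) + (length (cat b (suc lo) w) + length (b (suc lo + w)))
      ≡⟨ cong₂ (λ p q → length (b lo) + (p + length (b q)))
           (length-cat e n bal e≤1 (suc lo) h (s≤s z≤n) (next e lo h eq)) (proj₁ up) ⟩
    length (b lo) + (n * w + length (b (t ∸ lo)))
      ≡⟨ lemma₁ (length (b lo)) (n * w) (length (b (t ∸ lo))) ⟩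
    length (b lo) + length (b (t ∸ lo)) + n * w
      ≡⟨ cong (_+ n * w) (bal lo 1≤lo (proj₂ up)) ⟩
    n + n + n * w
      ≡⟨ lemma₂ n w ⟩
    n * suc (suc w) ∎
    where
    open ≡-Reasoning
    w = width e h
    up = upper-index lo w eq
    lemma₁ : ∀ p q r → p + (q + r) ≡ p + r + q
    lemma₁ = solve-∀
    lemma₂ : ∀ n w → n + n + n * w ≡ n * suc (suc w)
    lemma₂ = solve-∀

inversions-increasing : ∀ (f : ℕ → ℕ) → (∀ {i j} → i < j → f i < f j) → ∀ m → inversions (applyUpTo f m) ≡ 0
inversions-increasing f mono zero    = ≡.refl
inversions-increasing f mono (suc m) = cong₂ _+_
  (cong length (Listₚ.filter-none (λ z → T? (z <ᵇ f 0))
    (Allₚ.applyUpTo⁺₂ (f ∘ suc) m (λ i lt → <-asym (mono {0} {suc i} (s≤s z≤n)) (<ᵇ⇒< (f (suc i)) (f 0) lt)))))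
  (inversions-increasing (f ∘ suc) (λ lt → mono (s≤s lt)) m)

length-filterᵇ-↭ : ∀ {a} {A : Set a} (p : A → Bool) {xs ys} → xs ↭ ys → length (filterᵇ p xs) ≡ length (filterᵇ p ys)
length-filterᵇ-↭ p xs↭ys = ↭ₚ.↭-length (↭ₚ.filter-↭ (T? ∘ p) xs↭ys)

T⇒true : ∀ {x} → T x → x ≡ true
T⇒true {true} _ = ≡.refl

¬T⇒false : ∀ {x} → ¬ T x → x ≡ false
¬T⇒false {false} _ = ≡.refl
¬T⇒false {true}  f = contradiction tt f

<⇒<ᵇ≡true : ∀ {m n} → m < n → (m <ᵇ n) ≡ true
<⇒<ᵇ≡true lt = T⇒true (<⇒<ᵇ lt)

≮⇒<ᵇ≡false : ∀ {m n} → ¬ (m < n) → (m <ᵇ n) ≡ false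
≮⇒<ᵇ≡false {m} {n} nlt = ¬T⇒false (λ lt → nlt (<ᵇ⇒< m n lt))

module AntisymmetricFunctionals {c ℓ} (K : Field c ℓ) where
  open ListDeterminant K public

  signR-+ : ∀ m n → signR (m + n) ≈ signR m *ᴷ signR n
  signR-+ zero    n = sym (*-identityˡ _)
  signR-+ (suc m) n = trans (-‿cong (signR-+ m n)) (-‿distribˡ-* _ _)

  signR-square : ∀ m → signR m *ᴷ signR m ≈ 1#
  signR-square zero    = *-identityˡ 1#
  signR-square (suc m) = begin
    (-ᴷ signR m) *ᴷ (-ᴷ signR m)  ≈⟨ sym (-‿distribˡ-* _ _) ⟩
    -ᴷ (signR m *ᴷ (-ᴷ signR m))  ≈⟨ -‿cong (sym (-‿distribʳ-* _ _)) ⟩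
    -ᴷ (-ᴷ (signR m *ᴷ signR m))  ≈⟨ -‿involutive _ ⟩
    signR m *ᴷ signR m            ≈⟨ signR-square m ⟩
    1#                            ∎

  signR-double : ∀ m → signR (m + m) ≈ 1#
  signR-double m = trans (signR-+ m m) (signR-square m)

  signR-parity : ∀ m n k l → m + (k + k) ≡ n + (l + l) → signR m ≈ signR n
  signR-parity m n k l eq = begin
    signR m                     ≈⟨ sym (trans (*-congˡ (signR-double k)) (*-identityʳ _)) ⟩
    signR m *ᴷ signR (k + k)    ≈⟨ sym (signR-+ m (k + k)) ⟩
    signR (m + (k + k))         ≡⟨ cong signR eq ⟩
    signR (n + (l + l))         ≈⟨ signR-+ n (l + l) ⟩
    signR n *ᴷ signR (l + l)    ≈⟨ trans (*-congˡ (signR-double l)) (*-identityʳ _) ⟩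
    signR n                     ∎

  module _ {a} {A : Set a} where
    move-right : ∀ {D : List A → Carrier} → Antisymmetric D → ∀ x ys qs →
                 D (x ∷ ys ++ qs) ≈ signR (length ys) *ᴷ D (ys ++ x ∷ qs)
    move-right anti x []       qs = sym (*-identityˡ _)
    move-right {D} anti x (y ∷ ys) qs = begin
      D (x ∷ y ∷ ys ++ qs)                             ≈⟨ exchange anti [] x y (ys ++ qs) ⟩
      -ᴷ D (y ∷ x ∷ ys ++ qs)                          ≈⟨ -‿cong (move-right (antisymmetric-prefix anti (y ∷ [])) x ys qs) ⟩
      -ᴷ (signR (length ys) *ᴷ D (y ∷ ys ++ x ∷ qs))   ≈⟨ -‿distribˡ-* _ _ ⟩
      (-ᴷ signR (length ys)) *ᴷ D (y ∷ ys ++ x ∷ qs)   ∎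

    swap-blocks : ∀ {D : List A → Carrier} → Antisymmetric D → ∀ xs ys qs →
                  D (xs ++ ys ++ qs) ≈ signR (length xs * length ys) *ᴷ D (ys ++ xs ++ qs)
    swap-blocks anti []       ys qs = sym (*-identityˡ _)
    swap-blocks {D} anti (x ∷ xs) ys qs = begin
      D (x ∷ xs ++ ys ++ qs)
        ≈⟨ swap-blocks (antisymmetric-prefix anti (x ∷ [])) xs ys qs ⟩
      signR (length xs * length ys) *ᴷ D (x ∷ ys ++ xs ++ qs)
        ≈⟨ *-congˡ (move-right anti x ys (xs ++ qs)) ⟩
      signR (length xs * length ys) *ᴷ (signR (length ys) *ᴷ D (ys ++ x ∷ xs ++ qs))
        ≈⟨ solve 3 (λ p q r → (p :* (q :* r)) := ((q :* p) :* r)) refl _ _ _ ⟩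
      (signR (length ys) *ᴷ signR (length xs * length ys)) *ᴷ D (ys ++ x ∷ xs ++ qs)
        ≈⟨ *-congʳ (sym (signR-+ (length ys) _)) ⟩
      signR (length ys + length xs * length ys) *ᴷ D (ys ++ x ∷ xs ++ qs) ∎

    reverse-block : ∀ {D : List A → Carrier} → Antisymmetric D → ∀ xs qs →
                    D (xs ++ qs) ≈ signR (triangle (length xs)) *ᴷ D (reverse xs ++ qs)
    reverse-block anti []       qs = sym (*-identityˡ _)
    reverse-block {D} anti (x ∷ xs) qs = begin
      D (x ∷ xs ++ qs)
        ≈⟨ move-right anti x xs qs ⟩
      signR (length xs) *ᴷ D (xs ++ x ∷ qs)
        ≈⟨ *-congˡ (reverse-block anti xs (x ∷ qs)) ⟩
      signR (length xs) *ᴷ (signR (triangle (length xs)) *ᴷ D (reverse xs ++ x ∷ qs))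
        ≈⟨ solve 3 (λ p q r → (p :* (q :* r)) := ((q :* p) :* r)) refl _ _ _ ⟩
      (signR (triangle (length xs)) *ᴷ signR (length xs)) *ᴷ D (reverse xs ++ x ∷ qs)
        ≈⟨ *-cong (sym (signR-+ (triangle (length xs)) _)) (reflexive (cong D eq)) ⟩
      signR (triangle (length xs) + length xs) *ᴷ D (reverse (x ∷ xs) ++ qs) ∎
      where
      eq : reverse xs ++ x ∷ qs ≡ reverse (x ∷ xs) ++ qs
      eq = ≡.trans (≡.sym (Listₚ.++-assoc (reverse xs) (x ∷ []) qs)) (cong (_++ qs) (≡.sym (Listₚ.unfold-reverse x xs)))

    pair-blocks : ∀ {D : List A → Carrier} → Antisymmetric D → ∀ (b : ℕ → List A) t n e → Balanced b t n → e ≤ 1 →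
                  ∀ lo h → 1 ≤ lo → lo + lo + width e h ≡ suc t →
                  D (cat b lo (width e h)) ≈ signR (pairingSign b t n e lo h) *ᴷ D (paired b t reverse e lo h)
    pair-blocks anti b t n e bal e≤1 lo zero 1≤lo eq = sym (*-identityˡ _)
    pair-blocks {D} anti b t n e bal e≤1 lo (suc h) 1≤lo eq = begin
      D (L ++ cat b (suc lo) (suc w))
        ≡⟨ cong (λ z → D (L ++ z)) (≡.trans (cat-snoc b (suc lo) w) (cong (λ z → M ++ b z) (proj₁ (upper-index b t lo w eq)))) ⟩
      D (L ++ (M ++ H))
        ≡⟨ cong (λ z → D (L ++ (M ++ z))) (≡.sym (Listₚ.++-identityʳ H)) ⟩
      D (L ++ (M ++ H ++ []))
        ≈⟨ swap-blocks (antisymmetric-prefix anti L) M H [] ⟩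
      signR (length M * length H) *ᴷ D (L ++ (H ++ M ++ []))
        ≡⟨ cong₂ (λ p q → signR (p * length H) *ᴷ D (L ++ (H ++ q)))
             (length-cat b t e n bal e≤1 (suc lo) h (s≤s z≤n) (next b t e lo h eq)) (Listₚ.++-identityʳ M) ⟩
      signR ((n * w) * length H) *ᴷ D (L ++ (H ++ M))
        ≈⟨ *-congˡ (reverse-block (antisymmetric-prefix anti L) H M) ⟩
      signR ((n * w) * length H) *ᴷ (signR (triangle (length H)) *ᴷ D (L ++ (reverse H ++ M)))
        ≡⟨ cong (λ z → signR ((n * w) * length H) *ᴷ (signR (triangle (length H)) *ᴷ D z)) (≡.sym (Listₚ.++-assoc L (reverse H) M)) ⟩
      signR ((n * w) * length H) *ᴷ (signR (triangle (length H)) *ᴷ D ((L ++ reverse H) ++ M))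
        ≈⟨ *-congˡ (*-congˡ (pair-blocks (antisymmetric-prefix anti (L ++ reverse H)) b t n e bal e≤1 (suc lo) h (s≤s z≤n) (next b t e lo h eq))) ⟩
      signR ((n * w) * length H) *ᴷ (signR (triangle (length H)) *ᴷ (signR (pairingSign b t n e (suc lo) h) *ᴷ D′))
        ≈⟨ solve 4 (λ p q r u → (p :* (q :* (r :* u))) := ((p :* (q :* r)) :* u)) refl _ _ _ _ ⟩
      (signR ((n * w) * length H) *ᴷ (signR (triangle (length H)) *ᴷ signR (pairingSign b t n e (suc lo) h))) *ᴷ D′
        ≈⟨ *-congʳ (sym (trans (signR-+ ((n * w) * length H) _) (*-congˡ (signR-+ (triangle (length H)) _)))) ⟩
      signR (pairingSign b t n e lo (suc h)) *ᴷ D′ ∎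
      where
      w = width e h
      L = b lo
      H = b (t ∸ lo)
      M = cat b (suc lo) w
      D′ = D (paired b t reverse e lo (suc h))

    -- The entry `f t` is moved first, across the other `t` entries `f i` and the `t` blocks before
    -- its own. This costs t(n + 1) exchanges, and the sum of these costs is the exponent.
    merge-blocks : ∀ {D : List A → Carrier} → Antisymmetric D → ∀ (f : ℕ → A) (b : ℕ → List A) n → (∀ i → length (b i) ≡ n) →
                   ∀ t → D (map f (downFrom t) ++ cat b 0 t) ≈ signR (triangle t * suc n) *ᴷ D (cat (λ i → f i ∷ b i) 0 t)
    merge-blocks anti f b n len zero    = sym (*-identityˡ _)
    merge-blocks {D} anti f b n len (suc t) = begin
      D (f t ∷ map f (downFrom t) ++ cat b 0 (suc t))
        ≡⟨ cong (λ z → D (f t ∷ z)) eq₁ ⟩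
      D (f t ∷ front ++ b t)
        ≈⟨ move-right anti (f t) front (b t) ⟩
      signR (length front) *ᴷ D (front ++ f t ∷ b t)
        ≈⟨ *-cong (reflexive (cong signR len-front)) (merge-blocks (antisymmetric-suffix anti (f t ∷ b t)) f b n len t) ⟩
      signR (t * suc n) *ᴷ (signR (triangle t * suc n) *ᴷ D (cat (λ i → f i ∷ b i) 0 t ++ f t ∷ b t))
        ≈⟨ solve 3 (λ p q r → (p :* (q :* r)) := ((q :* p) :* r)) refl _ _ _ ⟩
      (signR (triangle t * suc n) *ᴷ signR (t * suc n)) *ᴷ D (cat (λ i → f i ∷ b i) 0 t ++ f t ∷ b t)
        ≈⟨ *-cong (trans (sym (signR-+ (triangle t * suc n) _)) (reflexive (cong signR (≡.sym (*-distribʳ-+ (suc n) (triangle t) t)))))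
                  (reflexive (cong D (≡.sym (cat-snoc (λ i → f i ∷ b i) 0 t)))) ⟩
      signR (triangle (suc t) * suc n) *ᴷ D (cat (λ i → f i ∷ b i) 0 (suc t)) ∎
      where
      front = map f (downFrom t) ++ cat b 0 t
      eq₁ : map f (downFrom t) ++ cat b 0 (suc t) ≡ front ++ b t
      eq₁ = ≡.trans (cong (map f (downFrom t) ++_) (cat-snoc b 0 t)) (≡.sym (Listₚ.++-assoc (map f (downFrom t)) _ _))
      len-front : length front ≡ t * suc n
      len-front = ≡.trans (Listₚ.length-++ (map f (downFrom t)))
        (≡.trans (cong₂ _+_ (≡.trans (Listₚ.length-map f (downFrom t)) (Listₚ.length-downFrom t)) (length-cat-uniform b len 0 t)) (≡.sym (*-suc t n)))

    -- The list n t - 1, ..., 0 is the beta set of the empty partition, so this is the sign of its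
    -- sorting permutation. Its first `t` entries hold the largest member of each class and are
    -- merged in after the rest is sorted.
    sort-residues : ∀ {D : List A → Carrier} → Antisymmetric D → ∀ (f : ℕ → A) t n →
                    D (map f (downFrom (n * t))) ≈
                    signR (triangle t * triangle (suc n)) *ᴷ D (cat (λ i → map (λ k → f (i + k * t)) (downFrom n)) 0 t)
    sort-residues {D} anti f t zero = sym (trans
      (*-cong (reflexive (cong signR (*-zeroʳ (triangle t)))) (reflexive (cong D (nil 0 t)))) (*-identityˡ _))
      where
      nil : ∀ lo k → cat {A = A} (λ i → []) lo k ≡ []
      nil lo zero    = ≡.refl
      nil lo (suc k) = nil (suc lo) k
    sort-residues {D} anti f t (suc n) = begin
      D (map f (downFrom (t + n * t)))
        ≡⟨ cong D (split t (n * t)) ⟩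
      D (top ++ map f (downFrom (n * t)))
        ≈⟨ sort-residues (antisymmetric-prefix anti top) f t n ⟩
      signR (triangle t * triangle (suc n)) *ᴷ D (top ++ cat (λ i → map (λ k → f (i + k * t)) (downFrom n)) 0 t)
        ≈⟨ *-congˡ (merge-blocks anti (λ i → f (i + n * t)) (λ i → map (λ k → f (i + k * t)) (downFrom n)) n
             (λ i → ≡.trans (Listₚ.length-map (λ k → f (i + k * t)) (downFrom n)) (Listₚ.length-downFrom n)) t) ⟩
      signR (triangle t * triangle (suc n)) *ᴷ (signR (triangle t * suc n) *ᴷ D′)
        ≈⟨ sym (*-assoc _ _ _) ⟩
      (signR (triangle t * triangle (suc n)) *ᴷ signR (triangle t * suc n)) *ᴷ D′
        ≈⟨ *-congʳ (trans (sym (signR-+ (triangle t * triangle (suc n)) _))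
             (reflexive (cong signR (≡.sym (*-distribˡ-+ (triangle t) (triangle (suc n)) (suc n)))))) ⟩
      signR (triangle t * triangle (suc (suc n))) *ᴷ D′ ∎
      where
      top = map (λ i → f (i + n * t)) (downFrom t)
      D′ = D (cat (λ i → map (λ k → f (i + k * t)) (downFrom (suc n))) 0 t)
      split : ∀ t s → map f (downFrom (t + s)) ≡ map (λ i → f (i + s)) (downFrom t) ++ map f (downFrom s)
      split zero    s = ≡.refl
      split (suc t) s = cong (f (t + s) ∷_) (split t s)

  antisymmetric-↭ : ∀ {a} {A : Set a} {D : List A → Carrier} → Antisymmetric D → ∀ {xs ys} → xs ↭ ys →
                    ∃ λ k → D xs ≈ signR k *ᴷ D ys
  antisymmetric-↭ anti ↭.refl       = 0 , sym (*-identityˡ _)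
  antisymmetric-↭ anti (↭.prep x p) = antisymmetric-↭ (antisymmetric-prefix anti (x ∷ [])) p
  antisymmetric-↭ anti (↭.swap x y p) with antisymmetric-↭ (antisymmetric-prefix anti (x ∷ y ∷ [])) p
  ... | k , e = suc k , trans e (trans (*-congˡ (exchange anti [] x y _))
                          (trans (sym (-‿distribʳ-* _ _)) (-‿distribˡ-* _ _)))
  antisymmetric-↭ anti (↭.trans p q) with antisymmetric-↭ anti p | antisymmetric-↭ anti q
  ... | k , e | l , e′ = k + l , trans e (trans (*-congˡ e′) (trans (sym (*-assoc _ _ _)) (*-congʳ (sym (signR-+ k l)))))

  sort-sign-∷ : ∀ {D : List ℕ → Carrier} x {xs ys} → xs ↭ ys →
                signR (inversions xs) *ᴷ D (x ∷ xs) ≈ signR (inversions ys) *ᴷ D (x ∷ ys) →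
                signR (inversions (x ∷ xs)) *ᴷ D (x ∷ xs) ≈ signR (inversions (x ∷ ys)) *ᴷ D (x ∷ ys)
  sort-sign-∷ {D} x {xs} {ys} p e = begin
    signR (less xs + inversions xs) *ᴷ D (x ∷ xs)
      ≈⟨ trans (*-congʳ (signR-+ (less xs) _)) (*-assoc _ _ _) ⟩
    signR (less xs) *ᴷ (signR (inversions xs) *ᴷ D (x ∷ xs))
      ≈⟨ *-cong (reflexive (cong signR (length-filterᵇ-↭ (_<ᵇ x) p))) e ⟩
    signR (less ys) *ᴷ (signR (inversions ys) *ᴷ D (x ∷ ys))
      ≈⟨ sym (trans (*-congʳ (signR-+ (less ys) _)) (*-assoc _ _ _)) ⟩
    signR (less ys + inversions ys) *ᴷ D (x ∷ ys) ∎
    where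
    less : List ℕ → ℕ
    less zs = length (filterᵇ (_<ᵇ x) zs)

  -- Exchanging two distinct neighbours changes the parity of the inversions and the sign of `D`, so
  -- the product is invariant. With `τ` increasing, this identifies the inversion sign of `σ` with
  -- the sign that `D` picks up.
  sort-sign : ∀ {D : List ℕ → Carrier} → Antisymmetric D → ∀ {σ τ} → σ ↭ τ →
              signR (inversions σ) *ᴷ D σ ≈ signR (inversions τ) *ᴷ D τ
  sort-sign anti ↭.refl        = refl
  sort-sign anti (↭.trans p q) = trans (sort-sign anti p) (sort-sign anti q)
  sort-sign {D} anti (↭.prep x p) = sort-sign-∷ {D} x p (sort-sign (antisymmetric-prefix anti (x ∷ [])) p)
  sort-sign {D} anti (↭.swap {xs} {ys} x y p) = begin
    signR (inversions (x ∷ y ∷ xs)) *ᴷ D (x ∷ y ∷ xs)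
      ≈⟨ sort-sign-∷ {D} x (↭-prep y p) (sort-sign-∷ {λ l → D (x ∷ l)} y p
           (sort-sign (antisymmetric-prefix anti (x ∷ y ∷ [])) p)) ⟩
    signR (inversions (x ∷ y ∷ ys)) *ᴷ D (x ∷ y ∷ ys)
      ≈⟨ step (<-cmp x y) ⟩
    signR (inversions (y ∷ x ∷ ys)) *ᴷ D (y ∷ x ∷ ys) ∎
    where
    less : ℕ → List ℕ → ℕ
    less u zs = length (filterᵇ (_<ᵇ u) zs)
    smaller : ∀ {u v} → u < v → less v (u ∷ ys) ≡ suc (less v ys)
    smaller {u} {v} u<v rewrite <⇒<ᵇ≡true u<v = ≡.refl
    larger : ∀ {u v} → u < v → less u (v ∷ ys) ≡ less u ys
    larger {u} {v} u<v rewrite ≮⇒<ᵇ≡false (<-asym u<v) = ≡.refl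
    flip-sign : ∀ {u v} → u < v → signR (inversions (v ∷ u ∷ ys)) ≈ -ᴷ signR (inversions (u ∷ v ∷ ys))
    flip-sign {u} {v} u<v = reflexive (cong signR (≡.trans
      (cong (_+ (less u ys + inversions ys)) (smaller u<v)) (≡.trans
      (cong suc (lemma (less v ys) (less u ys) (inversions ys)))
      (cong (λ z → suc (z + (less v ys + inversions ys))) (≡.sym (larger u<v))))))
      where
      lemma : ∀ p q r → p + (q + r) ≡ q + (p + r)
      lemma = solve-∀
    step : Tri (x < y) (x ≡ y) (y < x) →
           signR (inversions (x ∷ y ∷ ys)) *ᴷ D (x ∷ y ∷ ys) ≈ signR (inversions (y ∷ x ∷ ys)) *ᴷ D (y ∷ x ∷ ys)
    step (tri≈ _ ≡.refl _) = refl
    step (tri< x<y _ _) = begin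
      signR (inversions (x ∷ y ∷ ys)) *ᴷ D (x ∷ y ∷ ys)
        ≈⟨ *-congˡ (exchange anti [] x y ys) ⟩
      signR (inversions (x ∷ y ∷ ys)) *ᴷ (-ᴷ D (y ∷ x ∷ ys))
        ≈⟨ trans (sym (-‿distribʳ-* _ _)) (-‿distribˡ-* _ _) ⟩
      (-ᴷ signR (inversions (x ∷ y ∷ ys))) *ᴷ D (y ∷ x ∷ ys)
        ≈⟨ *-congʳ (sym (flip-sign x<y)) ⟩
      signR (inversions (y ∷ x ∷ ys)) *ᴷ D (y ∷ x ∷ ys) ∎
    step (tri> _ _ y<x) = begin
      signR (inversions (x ∷ y ∷ ys)) *ᴷ D (x ∷ y ∷ ys)
        ≈⟨ *-cong (flip-sign y<x) (exchange anti [] x y ys) ⟩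
      (-ᴷ signR (inversions (y ∷ x ∷ ys))) *ᴷ (-ᴷ D (y ∷ x ∷ ys))
        ≈⟨ trans (sym (-‿distribˡ-* _ _)) (-‿cong (sym (-‿distribʳ-* _ _))) ⟩
      -ᴷ (-ᴷ (signR (inversions (y ∷ x ∷ ys)) *ᴷ D (y ∷ x ∷ ys)))
        ≈⟨ -‿involutive _ ⟩
      signR (inversions (y ∷ x ∷ ys)) *ᴷ D (y ∷ x ∷ ys) ∎

-- Beta sets and quotients

≡ᵇ-refl : ∀ n → (n ≡ᵇ n) ≡ true
≡ᵇ-refl n = T⇒true (≡⇒≡ᵇ n n ≡.refl)

≢⇒≡ᵇ≡false : ∀ {m n} → m ≢ n → (m ≡ᵇ n) ≡ false
≢⇒≡ᵇ≡false {m} {n} ne = ¬T⇒false (λ eq → ne (≡ᵇ⇒≡ m n eq))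

module _ {a} {A : Set a} (f : A → ℕ) where
  filterᵇ-<-suc : ∀ t xs → filterᵇ (λ x → f x <ᵇ t) xs ++ filterᵇ (λ x → f x ≡ᵇ t) xs ↭ filterᵇ (λ x → f x <ᵇ suc t) xs
  filterᵇ-<-suc t []       = ↭-refl
  filterᵇ-<-suc t (x ∷ xs) with <-cmp (f x) t
  ... | tri< lt ne _ rewrite <⇒<ᵇ≡true lt | ≢⇒≡ᵇ≡false ne | <⇒<ᵇ≡true (m<n⇒m<1+n lt) = ↭-prep x (filterᵇ-<-suc t xs)
  ... | tri≈ nlt eq _ rewrite ≮⇒<ᵇ≡false nlt | eq | ≡ᵇ-refl t | <⇒<ᵇ≡true (n<1+n t) =
    ↭-trans (↭ₚ.shift x (filterᵇ (λ x → f x <ᵇ t) xs) (filterᵇ (λ x → f x ≡ᵇ t) xs)) (↭-prep x (filterᵇ-<-suc t xs))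
  ... | tri> nlt ne gt rewrite ≮⇒<ᵇ≡false nlt | ≢⇒≡ᵇ≡false ne | ≮⇒<ᵇ≡false {f x} {suc t} (λ lt → <⇒≱ gt (≤-pred lt)) = filterᵇ-<-suc t xs

  classes : List A → ℕ → List A
  classes xs i = filterᵇ (λ x → f x ≡ᵇ i) xs

  cat-classes-< : ∀ xs t → cat (classes xs) 0 t ↭ filterᵇ (λ x → f x <ᵇ t) xs
  cat-classes-< xs zero    = ↭-reflexive (≡.sym (Listₚ.filter-none (λ x → T? (f x <ᵇ 0)) (All.universal (λ x lt → n≮0 (<ᵇ⇒< (f x) 0 lt)) xs)))
  cat-classes-< xs (suc t) = ↭-trans (↭-reflexive (cat-snoc (classes xs) 0 t))
    (↭-trans (↭ₚ.++⁺ʳ (classes xs t) (cat-classes-< xs t)) (filterᵇ-<-suc t xs))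

  cat-classes : ∀ xs t → All (λ x → f x < t) xs → cat (classes xs) 0 t ↭ xs
  cat-classes xs t lt = ↭-trans (cat-classes-< xs t)
    (↭-reflexive (Listₚ.filter-all (λ x → T? (f x <ᵇ t)) (All.map <⇒<ᵇ lt)))

map-filterᵇ : ∀ {a b} {A : Set a} {B : Set b} (p : B → Bool) (w : A → B) xs →
              map w (filterᵇ (p ∘ w) xs) ≡ filterᵇ p (map w xs)
map-filterᵇ p w []       = ≡.refl
map-filterᵇ p w (x ∷ xs) with p (w x)
... | true  = cong (w x ∷_) (map-filterᵇ p w xs)
... | false = map-filterᵇ p w xs

map-upTo-cong : ∀ {a} {A : Set a} {f g : ℕ → A} n → (∀ j → j < n → f j ≡ g j) → map f (upTo n) ≡ map g (upTo n)
map-upTo-cong n e = Listₚ.map-cong-local (All.map (λ {j} → e j) (Allₚ.all-upTo n))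

map-upTo-+ : ∀ {a} {A : Set a} (f : ℕ → A) m n → map f (upTo (m + n)) ≡ map f (upTo m) ++ map (λ j → f (m + j)) (upTo n)
map-upTo-+ f m n rewrite Listₚ.map-upTo f (m + n) | Listₚ.map-upTo f m | Listₚ.map-upTo (λ j → f (m + j)) n = go f m
  where
  go : ∀ f m → applyUpTo f (m + n) ≡ applyUpTo f m ++ applyUpTo (λ j → f (m + j)) n
  go f zero    = ≡.refl
  go f (suc m) = cong (f 0 ∷_) (go (f ∘ suc) m)

tabulate-toℕ : ∀ {a} {A : Set a} N (f : ℕ → A) → tabulate {n = N} (λ j → f (toℕ j)) ≡ map f (upTo N)
tabulate-toℕ N f rewrite Listₚ.map-upTo f N = go N f
  where
  go : ∀ N f → tabulate {n = N} (λ j → f (toℕ j)) ≡ applyUpTo f N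
  go zero    f = ≡.refl
  go (suc N) f = cong (f 0 ∷_) (go N (f ∘ suc))

map-part : ∀ xs → map (part xs) (upTo (length xs)) ≡ xs
map-part xs rewrite Listₚ.map-upTo (part xs) (length xs) = go xs
  where
  go : ∀ xs → applyUpTo (part xs) (length xs) ≡ xs
  go []       = ≡.refl
  go (x ∷ xs) = cong (x ∷_) (go xs)

part-∈ : ∀ xs {j} → j < length xs → part xs j ∈ xs
part-∈ (x ∷ xs) {zero}  lt       = here ≡.refl
part-∈ (x ∷ xs) {suc j} (s≤s lt) = there (part-∈ xs lt)

part-beyond : ∀ xs {j} → length xs ≤ j → part xs j ≡ 0
part-beyond []       le       = ≡.refl
part-beyond (x ∷ xs) (s≤s le) = part-beyond xs le

reverse-part : ∀ xs → reverse xs ≡ map (λ j → part xs (length xs ∸ suc j)) (upTo (length xs))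
reverse-part xs = begin
  reverse xs
    ≡⟨ cong reverse (≡.trans (≡.sym (map-part xs)) (Listₚ.map-upTo (part xs) N)) ⟩
  reverse (applyUpTo (part xs) N)
    ≡⟨ Listₚ.reverse-applyUpTo (part xs) N ⟩
  Data.List.applyDownFrom (part xs) N
    ≡⟨ go (part xs) N ⟩
  applyUpTo (λ j → part xs (N ∸ suc j)) N
    ≡⟨ Listₚ.map-upTo _ N ⟨
  map (λ j → part xs (N ∸ suc j)) (upTo N) ∎
  where
  open ≡-Reasoning
  N = length xs
  go : ∀ (f : ℕ → ℕ) N → Data.List.applyDownFrom f N ≡ applyUpTo (λ j → f (N ∸ suc j)) N
  go f zero    = ≡.refl
  go f (suc N) = cong (f N ∷_) (go f N)

Decreasing : List ℕ → Set
Decreasing = AllPairs _>_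

decreasing-head : ∀ {x xs} → Decreasing (x ∷ xs) → length xs ≤ x
decreasing-head {xs = []}     d = z≤n
decreasing-head {xs = y ∷ xs} ((gt ∷ _) ∷ d) = ≤-trans (s≤s (decreasing-head d)) gt

-- The entry at index `j` is followed by `length xs ∸ suc j` smaller natural numbers. This makes the
-- truncated subtraction in `quot` exact.
decreasing-part : ∀ {xs} → Decreasing xs → ∀ {j} → j < length xs → length xs ≤ part xs j + suc j
decreasing-part {x ∷ xs} d       {zero}  lt       = ≤-trans (s≤s (decreasing-head d)) (≤-reflexive (ℕₚ.+-comm 1 x))
decreasing-part {x ∷ xs} (_ ∷ d) {suc j} (s≤s lt) = ≤-trans (s≤s (decreasing-part d lt)) (≤-reflexive (≡.sym (+-suc (part xs j) (suc j))))

Sorted : List ℕ → Set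
Sorted = Linked (λ x y → y ≤ x)

part-antitone : ∀ {ρ} → Sorted ρ → ∀ {i j} → i ≤ j → part ρ j ≤ part ρ i
part-antitone {ρ} l {i} {j} i≤j = go (≤⇒≤′ i≤j)
  where
  step : ∀ {ρ} → Sorted ρ → ∀ i → part ρ (suc i) ≤ part ρ i
  step []       i       = z≤n
  step [-]      i       = z≤n
  step (le ∷ l) zero    = le
  step (le ∷ l) (suc i) = step l i
  go : ∀ {j} → i ℕ.≤′ j → part ρ j ≤ part ρ i
  go ℕ.≤′-refl        = ≤-refl
  go (ℕ.≤′-step i≤′j) = ≤-trans (step l _) (go i≤′j)

module BetaSets (m : ℕ) (ρ : List ℕ) where
  beta : ℕ → ℕ
  beta j = part ρ j + (m ∸ suc j)

  beta-decreasing : Sorted ρ → ∀ {i j} → i < j → j < m → beta j < beta i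
  beta-decreasing l i<j j<m = +-mono-≤-< (part-antitone l (<⇒≤ i<j)) (∸-monoʳ-< (s≤s i<j) j<m)

  betaSet-decreasing : Sorted ρ → Decreasing (betaSet m ρ)
  betaSet-decreasing l rewrite Listₚ.map-upTo beta m = AllPairsₚ.applyUpTo⁺₁ beta m (beta-decreasing l)

  length-betaSet : length (betaSet m ρ) ≡ m
  length-betaSet = ≡.trans (Listₚ.length-map beta (upTo m)) (Listₚ.length-upTo m)

  upTo-betaSet : map (part (betaSet m ρ)) (upTo m) ≡ betaSet m ρ
  upTo-betaSet = ≡.trans (cong (map (part (betaSet m ρ)) ∘ upTo) (≡.sym length-betaSet)) (map-part (betaSet m ρ))

  ∈-betaSet⁻ : ∀ {x} → x ∈ betaSet m ρ → ∃ λ j → j < m × x ≡ beta j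
  ∈-betaSet⁻ x∈ with ∈ₚ.∈-map⁻ beta x∈
  ... | j , j∈ , eq = j , ∈ₚ.∈-upTo⁻ j∈ , eq

  ∈-betaSet⁺ : ∀ {j} → j < m → beta j ∈ betaSet m ρ
  ∈-betaSet⁺ j<m = ∈ₚ.∈-map⁺ beta (∈ₚ.∈-upTo⁺ j<m)

  module Residues (w : ℕ) where
    t = suc w

    class : ℕ → List ℕ
    class = betaRes m t ρ

    class-decreasing : Sorted ρ → ∀ i → Decreasing (class i)
    class-decreasing l i = AllPairsₚ.filter⁺ (λ x → T? (x % t ≡ᵇ i)) (betaSet-decreasing l)

    ∈-class⁻ : ∀ {x i} → x ∈ class i → x ∈ betaSet m ρ × x % t ≡ i
    ∈-class⁻ {x} {i} x∈ with ∈ₚ.∈-filter⁻ (λ x → T? (x % t ≡ᵇ i)) {xs = betaSet m ρ} x∈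
    ... | x∈′ , eq = x∈′ , ≡ᵇ⇒≡ _ _ eq

    ∈-class⁺ : ∀ {x i} → x ∈ betaSet m ρ → x % t ≡ i → x ∈ class i
    ∈-class⁺ x∈ eq = ∈ₚ.∈-filter⁺ (λ x → T? (x % t ≡ᵇ _)) x∈ (≡⇒≡ᵇ _ _ eq)

    betaSet-classes : cat class 0 t ↭ betaSet m ρ
    betaSet-classes = cat-classes (_% t) (betaSet m ρ) t (All.universal (λ x → DivMod.m%n<n x t) _)

    sigma-permutation : sigmaList m t ρ ↭ upTo m
    sigma-permutation = ↭-trans (↭-reflexive (concatMap-upTo _ t))
      (cat-classes (λ p → part (betaSet m ρ) p % t) (upTo m) t (All.universal (λ p → DivMod.m%n<n (part (betaSet m ρ) p) t) _))

    map-sigma : map (part (betaSet m ρ)) (sigmaList m t ρ) ≡ cat class 0 t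
    map-sigma = ≡.trans (cong (map w′) (concatMap-upTo _ t)) (go 0 t)
      where
      w′ = part (betaSet m ρ)
      go : ∀ lo k → map w′ (cat (λ i → filterᵇ (λ p → w′ p % t ≡ᵇ i) (upTo m)) lo k) ≡ cat class lo k
      go lo zero    = ≡.refl
      go lo (suc k) = ≡.trans (Listₚ.map-++ w′ (filterᵇ (λ p → w′ p % t ≡ᵇ lo) (upTo m)) _)
        (cong₂ _++_ (≡.trans (map-filterᵇ (λ x → x % t ≡ᵇ lo) w′ (upTo m)) (cong (filterᵇ (λ x → x % t ≡ᵇ lo)) upTo-betaSet))
                    (go (suc lo) k))

    module _ (l : Sorted ρ) (i : ℕ) where
      quotients-decreasing : Decreasing (map (_/ t) (class i))
      quotients-decreasing = go (class-decreasing l i) (All.tabulate (λ x∈ → proj₂ (∈-class⁻ x∈)))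
        where
        div-< : ∀ {x y} → x % t ≡ i → y % t ≡ i → x > y → x / t > y / t
        div-< {x} {y} ex ey x>y = ≰⇒> λ le → <⇒≱ x>y (subst₂ _≤_ (≡.sym (DivMod.m≡m%n+[m/n]*n x t)) (≡.sym (DivMod.m≡m%n+[m/n]*n y t))
          (+-mono-≤ (≤-reflexive (≡.trans ex (≡.sym ey))) (*-monoˡ-≤ t le)))
        go : ∀ {xs} → Decreasing xs → All (λ x → x % t ≡ i) xs → Decreasing (map (_/ t) xs)
        go []       []       = []
        go (gt ∷ d) (e ∷ es) = Allₚ.map⁺ (All.zipWith (λ (g , e′) → div-< e e′ g) (gt , es)) ∷ go d es

      -- This undoes the definition of `quot`: the exponents λ^(i)_j + n_i - j that enter the
      -- characters of the quotient are the entries of the class divided by `t`. The determinants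
      -- meet the quotient in this form.
      part-quot : ∀ {j} → j < nRes m t ρ i → part (quot m t ρ i) j + (nRes m t ρ i ∸ suc j) ≡ part (class i) j / t
      part-quot {j} j<N = begin
        part (quot m t ρ i) j + (N ∸ suc j)
          ≡⟨ cong (_+ (N ∸ suc j)) (go id (class i) j<N) ⟩
        ((b / t + suc j) ∸ N) + (N ∸ suc j)
          ≡⟨ +-∸-assoc (b / t + suc j ∸ N) j<N ⟨
        ((b / t + suc j) ∸ N + N) ∸ suc j
          ≡⟨ cong (_∸ suc j) (m∸n+n≡m big) ⟩
        (b / t + suc j) ∸ suc j
          ≡⟨ m+n∸n≡m (b / t) (suc j) ⟩
        b / t ∎
        where
        open ≡-Reasoning
        N = nRes m t ρ i
        b = part (class i) j
        F : ℕ × ℕ → ℕ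
        F p = (proj₂ p / t + suc (proj₁ p)) ∸ N
        go : ∀ f xs {j} → j < length xs → part (map F (zip (applyUpTo f (length xs)) xs)) j ≡ F (f j , part xs j)
        go f (x ∷ xs) {zero}  lt       = ≡.refl
        go f (x ∷ xs) {suc j} (s≤s lt) = go (f ∘ suc) xs lt
        part-map : ∀ xs {j} → j < length xs → part (map (_/ t) xs) j ≡ part xs j / t
        part-map (x ∷ xs) {zero}  lt       = ≡.refl
        part-map (x ∷ xs) {suc j} (s≤s lt) = part-map xs lt
        big : N ≤ b / t + suc j
        big = subst₂ (λ p q → p ≤ q + suc j) (Listₚ.length-map (_/ t) (class i)) (part-map (class i) j<N)
          (decreasing-part quotients-decreasing (subst (j <_) (≡.sym (Listₚ.length-map (_/ t) (class i))) j<N))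

      length-quot : length (quot m t ρ i) ≡ nRes m t ρ i
      length-quot = ≡.trans (Listₚ.length-map _ (zip (upTo (nRes m t ρ i)) (class i)))
        (≡.trans (Listₚ.length-zipWith _,_ (upTo (nRes m t ρ i)) (class i))
          (≡.trans (cong (ℕ._⊓ length (class i)) (Listₚ.length-upTo (nRes m t ρ i))) (⊓-idem _)))

-- Fourier transform of the numerator

module Powers {c ℓ} (K : Field c ℓ) where
  open AntisymmetricFunctionals K public

  pow-cong : ∀ {x y} k → x ≈ y → pow x k ≈ pow y k
  pow-cong zero    e = refl
  pow-cong (suc k) e = *-cong e (pow-cong k e)

  pow-+ : ∀ x k l → pow x (k + l) ≈ pow x k *ᴷ pow x l
  pow-+ x zero    l = sym (*-identityˡ _)
  pow-+ x (suc k) l = trans (*-congˡ (pow-+ x k l)) (sym (*-assoc _ _ _))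

  pow-* : ∀ x k l → pow (pow x k) l ≈ pow x (l * k)
  pow-* x k zero    = refl
  pow-* x k (suc l) = trans (*-congˡ (pow-* x k l)) (sym (pow-+ x k (l * k)))

  pow-distrib-* : ∀ x y k → pow (x *ᴷ y) k ≈ pow x k *ᴷ pow y k
  pow-distrib-* x y zero    = sym (*-identityˡ 1#)
  pow-distrib-* x y (suc k) = trans (*-congˡ (pow-distrib-* x y k))
    (solve 4 (λ p q r u → ((p :* q) :* (r :* u)) := ((p :* r) :* (q :* u))) refl _ _ _ _)

  pow-1# : ∀ k → pow 1# k ≈ 1#
  pow-1# zero    = refl
  pow-1# (suc k) = trans (*-identityˡ _) (pow-1# k)

  pow-neg : ∀ x k → pow (-ᴷ x) k ≈ signR k *ᴷ pow x k
  pow-neg x zero    = sym (*-identityˡ 1#)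
  pow-neg x (suc k) = begin
    (-ᴷ x) *ᴷ pow (-ᴷ x) k          ≈⟨ *-congˡ (pow-neg x k) ⟩
    (-ᴷ x) *ᴷ (signR k *ᴷ pow x k)  ≈⟨ sym (-‿distribˡ-* _ _) ⟩
    -ᴷ (x *ᴷ (signR k *ᴷ pow x k))  ≈⟨ -‿cong (solve 3 (λ p q r → (p :* (q :* r)) := (q :* (p :* r))) refl _ _ _) ⟩
    -ᴷ (signR k *ᴷ (x *ᴷ pow x k))  ≈⟨ -‿distribˡ-* _ _ ⟩
    (-ᴷ signR k) *ᴷ (x *ᴷ pow x k)  ∎

  module _ {u v : Carrier} (uv : u *ᴷ v ≈ 1#) where
    vu : v *ᴷ u ≈ 1#
    vu = trans (*-comm v u) uv

    pow-inverse : ∀ k → pow u k *ᴷ pow v k ≈ 1#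
    pow-inverse k = trans (sym (pow-distrib-* u v k)) (trans (pow-cong k uv) (pow-1# k))

    unit-nonzero : ¬ (u ≈ 0#)
    unit-nonzero u≈0 = 1≉0 (trans (sym uv) (trans (*-congʳ u≈0) (zeroˡ v)))

    inv-unique : inv u ≈ v
    inv-unique = begin
      inv u               ≈⟨ sym (*-identityʳ _) ⟩
      inv u *ᴷ 1#         ≈⟨ *-congˡ (sym uv) ⟩
      inv u *ᴷ (u *ᴷ v)   ≈⟨ solve 3 (λ p q r → (p :* (q :* r)) := ((q :* p) :* r)) refl _ _ _ ⟩
      (u *ᴷ inv u) *ᴷ v   ≈⟨ *-congʳ (inv-correct u unit-nonzero) ⟩
      1# *ᴷ v             ≈⟨ *-identityˡ v ⟩
      v                   ∎

    zpow-neg : ∀ k → zpow u (ℤ.- (pos k)) ≈ pow v k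
    zpow-neg zero    = refl
    zpow-neg (suc k) = pow-cong (suc k) inv-unique

    pow-cancel : ∀ k l → pow v k *ᴷ pow u (k + l) ≈ pow u l
    pow-cancel k l = begin
      pow v k *ᴷ pow u (k + l)          ≈⟨ *-congˡ (pow-+ u k l) ⟩
      pow v k *ᴷ (pow u k *ᴷ pow u l)   ≈⟨ solve 3 (λ p q r → (p :* (q :* r)) := ((q :* p) :* r)) refl _ _ _ ⟩
      (pow u k *ᴷ pow v k) *ᴷ pow u l   ≈⟨ trans (*-congʳ (pow-inverse k)) (*-identityˡ _) ⟩
      pow u l                           ∎

    zpow-⊖ : ∀ k l → zpow u (k ℤ.⊖ l) ≈ pow u k *ᴷ pow v l
    zpow-⊖ zero    zero    = sym (*-identityˡ 1#)
    zpow-⊖ (suc k) zero    = sym (*-identityʳ _)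
    zpow-⊖ zero    (suc l) = trans (zpow-neg (suc l)) (sym (*-identityˡ _))
    zpow-⊖ (suc k) (suc l) = begin
      zpow u (suc k ℤ.⊖ suc l)                  ≡⟨ cong (zpow u) (ℤₚ.[1+m]⊖[1+n]≡m⊖n k l) ⟩
      zpow u (k ℤ.⊖ l)                          ≈⟨ zpow-⊖ k l ⟩
      pow u k *ᴷ pow v l                        ≈⟨ sym (*-identityˡ _) ⟩
      1# *ᴷ (pow u k *ᴷ pow v l)                ≈⟨ *-congʳ (sym uv) ⟩
      (u *ᴷ v) *ᴷ (pow u k *ᴷ pow v l)
        ≈⟨ solve 4 (λ p q r u → ((p :* q) :* (r :* u)) := ((p :* r) :* (q :* u))) refl _ _ _ _ ⟩
      (u *ᴷ pow u k) *ᴷ (v *ᴷ pow v l)          ∎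

  sumL-single : ∀ {a} {S : Set a} (f : S → Carrier) {ss s₀} → Unique ss → s₀ ∈ ss →
                (∀ {s} → s ∈ ss → s ≢ s₀ → f s ≈ 0#) → sumL f ss ≈ f s₀
  sumL-single f {s ∷ ss} (ne ∷ u) (here ≡.refl) z =
    trans (+-congˡ (sumL-zero ss (λ s∈ → z (there s∈) (λ eq → All.lookup ne s∈ (≡.sym eq))))) (+-identityʳ _)
  sumL-single f {s ∷ ss} (ne ∷ u) (there s₀∈) z =
    trans (+-cong (z (here ≡.refl) (All.lookup ne s₀∈)) (sumL-single f u s₀∈ (λ s∈ → z (there s∈)))) (+-identityˡ _)

  when : Bool → Carrier → Carrier
  when true  x = x
  when false x = 0#

  when-yes : ∀ {m n x} → m ≡ n → when (m ≡ᵇ n) x ≈ x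
  when-yes {m} ≡.refl rewrite ≡ᵇ-refl m = refl

  when-no : ∀ {m n x} → m ≢ n → when (m ≡ᵇ n) x ≈ 0#
  when-no ne rewrite ≢⇒≡ᵇ≡false ne = refl

-- `w` is -1 modulo `suc w`, so `(w * β) % suc w` is the residue of -β, written without subtraction.
opposite-residue : ∀ w β → (β + (w * β) % suc w) % suc w ≡ 0
opposite-residue w β = begin
  (β + (w * β) % t) % t              ≡⟨ DivMod.%-distribˡ-+ β _ t ⟩
  (β % t + (w * β) % t % t) % t      ≡⟨ cong (λ z → (β % t + z) % t) (DivMod.m%n%n≡m%n (w * β) t) ⟩
  (β % t + (w * β) % t) % t          ≡⟨ DivMod.%-distribˡ-+ β (w * β) t ⟨
  (t * β) % t                        ≡⟨ cong (_% t) (ℕₚ.*-comm t β) ⟩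
  (β * t) % t                        ≡⟨ DivMod.m*n%n≡0 β t ⟩
  0                                  ∎
  where
  open ≡-Reasoning
  t = suc w

opposite-residue-unique : ∀ w β k → k < suc w → (β + k) % suc w ≡ 0 → k ≡ (w * β) % suc w
opposite-residue-unique w β k k<t eq = begin
  k                                      ≡⟨ DivMod.m<n⇒m%n≡m k<t ⟨
  k % t                                  ≡⟨ DivMod.[m+kn]%n≡m%n k β t ⟨
  (k + β * t) % t                        ≡⟨ cong (_% t) (lemma w β k) ⟩
  (w * β + (β + k)) % t                  ≡⟨ DivMod.%-distribˡ-+ (w * β) (β + k) t ⟩
  ((w * β) % t + (β + k) % t) % t        ≡⟨ cong (λ z → ((w * β) % t + z) % t) eq ⟩
  ((w * β) % t + 0) % t                  ≡⟨ cong (_% t) (ℕₚ.+-identityʳ ((w * β) % t)) ⟩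
  (w * β) % t % t                        ≡⟨ DivMod.m%n%n≡m%n (w * β) t ⟩
  (w * β) % t                            ∎
  where
  open ≡-Reasoning
  t = suc w
  lemma : ∀ w β k → k + β * suc w ≡ w * β + (β + k)
  lemma = solve-∀

module Specialization {c ℓ} (K : Field c ℓ) (e h n : ℕ) (ω : Field.Carrier K)
  (ω-root : Field._≈_ K (FieldDefs.pow K ω (suc (width e h))) (Field.1# K))
  (X : Fin n → Field.Carrier K) (X≉0 : ∀ b → ¬ (Field._≈_ K (X b) (Field.0# K))) where
  open Powers K public

  w = width e h
  t = suc w

  xi : Fin n → Carrier
  xi b = inv (X b)

  x-xi : ∀ b → X b *ᴷ xi b ≈ 1#
  x-xi b = inv-correct (X b) (X≉0 b)

  -- The matrix of y^β + y^−β, y = ω^a x_b, after a discrete Fourier transform a ↦ k of its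
  -- rows: the column of β is supported on the blocks k ≡ ±β mod t.
  plus minus B : ℕ × Fin n → ℕ → Carrier
  plus  (k , b) β = when (β % t ≡ᵇ k) (pow (X b) β)
  minus (k , b) β = when ((β + k) % t ≡ᵇ 0) (pow (xi b) β)
  B s β = plus s β +ᴷ minus s β

  rowBlock : ℕ → List (ℕ × Fin n)
  rowBlock k = map (k ,_) (allFin n)

  rows : List (ℕ × Fin n)
  rows = rowBlock 0 ++ paired rowBlock t id e 1 h

  grid : List (ℕ × Fin n)
  grid = Data.List.cartesianProduct (upTo t) (allFin n)

  rows-↭-cat : rows ↭ cat rowBlock 0 t
  rows-↭-cat = ↭ₚ.++⁺ˡ (rowBlock 0) (paired-↭ rowBlock t id (λ _ → ↭-refl) e 1 h ≡.refl)

  rows-↭ : rows ↭ grid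
  rows-↭ = ↭-trans rows-↭-cat (↭-reflexive (≡.sym (go id 0 t (λ _ → ≡.refl))))
    where
    go : ∀ (f : ℕ → ℕ) lo k → (∀ i → f i ≡ lo + i) →
         Data.List.cartesianProduct (applyUpTo f k) (allFin n) ≡ cat rowBlock lo k
    go f lo zero    eq = ≡.refl
    go f lo (suc k) eq = cong₂ _++_ (cong rowBlock (≡.trans (eq 0) (ℕₚ.+-identityʳ lo)))
      (go (f ∘ suc) (suc lo) k (λ i → ≡.trans (eq (suc i)) (+-suc lo i)))

  length-rowBlock : ∀ k → length (rowBlock k) ≡ n
  length-rowBlock k = ≡.trans (Listₚ.length-map (k ,_) (allFin n)) (Listₚ.length-tabulate {n = n} id)

  length-rows : length rows ≡ t * n
  length-rows = ≡.trans (↭ₚ.↭-length rows-↭-cat) (length-cat-uniform rowBlock length-rowBlock 0 t)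

  root : Fin (t * n) → Carrier
  root r = pow ω (toℕ (proj₁ (Fin.remQuot {t} n r)))

  column : Fin (t * n) → Fin n
  column r = proj₂ (Fin.remQuot {t} n r)

  -- The Kronecker product of the matrix (ω^(ak)) with the identity. The numerator matrix is this
  -- one times `B`, so the transform is never inverted and nothing is divided by t.
  fourier : Fin (t * n) → ℕ × Fin n → Carrier
  fourier r (k , b) = pow (root r) k *ᴷ δ Fin._≟_ (column r) b

  A : Fin (t * n) → ℕ → Carrier
  A r β = zpow (rootVars t n ω X r) (pos β) +ᴷ zpow (rootVars t n ω X r) (ℤ.- (pos β))

  root-t : ∀ r → pow (root r) t ≈ 1#
  root-t r = begin
    pow (pow ω a) t   ≈⟨ pow-* ω a t ⟩
    pow ω (t * a)     ≡⟨ cong (pow ω) (ℕₚ.*-comm t a) ⟩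
    pow ω (a * t)     ≈⟨ sym (pow-* ω t a) ⟩
    pow (pow ω t) a   ≈⟨ trans (pow-cong a ω-root) (pow-1# a) ⟩
    1#                ∎
    where a = toℕ (proj₁ (Fin.remQuot {t} n r))

  module _ {z : Carrier} (z-root : pow z t ≈ 1#) where
    pow-multiple : ∀ k → pow z (k * t) ≈ 1#
    pow-multiple k = trans (sym (pow-* z t k)) (trans (pow-cong k z-root) (pow-1# k))

    pow-residue : ∀ β → pow z (β % t) ≈ pow z β
    pow-residue β = sym (begin
      pow z β                                    ≡⟨ cong (pow z) (DivMod.m≡m%n+[m/n]*n β t) ⟩
      pow z (β % t + (β / t) * t)                ≈⟨ pow-+ z (β % t) _ ⟩
      pow z (β % t) *ᴷ pow z ((β / t) * t)       ≈⟨ *-congˡ (pow-multiple (β / t)) ⟩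
      pow z (β % t) *ᴷ 1#                        ≈⟨ *-identityʳ _ ⟩
      pow z (β % t)                              ∎)

    -- `pow z w` is the inverse of `z`, as z^t = 1.
    pow-opposite : ∀ β k → (β + k) % t ≡ 0 → pow z k ≈ pow (pow z w) β
    pow-opposite β k eq = begin
      pow z k                              ≈⟨ sym (pow-cancel {u = z} {v = pow z w} z-root β k) ⟩
      pow (pow z w) β *ᴷ pow z (β + k)     ≈⟨ *-congˡ (sym (pow-residue (β + k))) ⟩
      pow (pow z w) β *ᴷ pow z ((β + k) % t) ≡⟨ cong (λ i → pow (pow z w) β *ᴷ pow z i) eq ⟩
      pow (pow z w) β *ᴷ 1#                ≈⟨ *-identityʳ _ ⟩
      pow (pow z w) β                      ∎

  -- Only the rows with the right variable and with residue ±β contribute. The two powers are summed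
  -- separately because the residues of β and -β may coincide, and then a single row carries both.
  A-factor : ∀ r β → A r β ≈ sumL (λ s → B s β *ᴷ fourier r s) rows
  A-factor r β = sym (begin
    sumL (λ s → B s β *ᴷ fourier r s) rows
      ≈⟨ sumL-↭ _ rows-↭ ⟩
    sumL (λ s → B s β *ᴷ fourier r s) grid
      ≈⟨ sumL-cong grid (λ {s} _ → distribʳ (fourier r s) (plus s β) (minus s β)) ⟩
    sumL (λ s → plus s β *ᴷ fourier r s +ᴷ minus s β *ᴷ fourier r s) grid
      ≈⟨ sumL-+ (λ s → plus s β *ᴷ fourier r s) (λ s → minus s β *ᴷ fourier r s) grid ⟩
    sumL (λ s → plus s β *ᴷ fourier r s) grid +ᴷ sumL (λ s → minus s β *ᴷ fourier r s) grid
      ≈⟨ +-cong plus-sum minus-sum ⟩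
    pow y β +ᴷ pow (pow z w *ᴷ xi b) β
      ≈⟨ +-congˡ (sym (zpow-neg y-inverse β)) ⟩
    A r β ∎)
    where
    z = root r
    b = column r
    y = rootVars t n ω X r
    z-root = root-t r
    y-inverse : y *ᴷ (pow z w *ᴷ xi b) ≈ 1#
    y-inverse = trans (solve 4 (λ p q r u → ((p :* q) :* (r :* u)) := ((p :* r) :* (q :* u))) refl z (X b) (pow z w) (xi b))
      (trans (*-cong z-root (x-xi b)) (*-identityˡ 1#))
    k₀ = (w * β) % t
    unique-grid : Unique grid
    unique-grid = Uniqueₚ.cartesianProduct⁺ (Uniqueₚ.upTo⁺ t) (Uniqueₚ.allFin⁺ n)
    in-grid : ∀ {k} → k < t → (k , b) ∈ grid
    in-grid k<t = ∈ₚ.∈-cartesianProduct⁺ (∈ₚ.∈-upTo⁺ k<t) (∈ₚ.∈-allFin b)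
    off-column : ∀ k {b′ v} → b ≢ b′ → v *ᴷ fourier r (k , b′) ≈ 0#
    off-column k ne = trans (*-congˡ (trans (*-congˡ (δ-≢ Fin._≟_ ne)) (zeroʳ _))) (zeroʳ _)
    plus-sum : sumL (λ s → plus s β *ᴷ fourier r s) grid ≈ pow y β
    plus-sum = begin
      sumL (λ s → plus s β *ᴷ fourier r s) grid
        ≈⟨ sumL-single (λ s → plus s β *ᴷ fourier r s) unique-grid (in-grid (DivMod.m%n<n β t)) off ⟩
      plus (β % t , b) β *ᴷ (pow z (β % t) *ᴷ δ Fin._≟_ b b)
        ≈⟨ *-cong (when-yes {β % t} {β % t} ≡.refl) (trans (*-cong (pow-residue z-root β) (δ-refl Fin._≟_ b)) (*-identityʳ _)) ⟩
      pow (X b) β *ᴷ pow z β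
        ≈⟨ trans (*-comm _ _) (sym (pow-distrib-* z (X b) β)) ⟩
      pow y β ∎
      where
      off : ∀ {s} → s ∈ grid → s ≢ (β % t , b) → plus s β *ᴷ fourier r s ≈ 0#
      off {k , b′} s∈ ne = cases (k ℕₚ.≟ β % t) (b Fin.≟ b′)
        where
        cases : Dec (k ≡ β % t) → Dec (b ≡ b′) → plus (k , b′) β *ᴷ fourier r (k , b′) ≈ 0#
        cases _            (no b≢)      = off-column k b≢
        cases (no k≢)      _            = trans (*-congʳ (when-no (λ eq → k≢ (≡.sym eq)))) (zeroˡ _)
        cases (yes ≡.refl) (yes ≡.refl) = contradiction ≡.refl ne
    minus-sum : sumL (λ s → minus s β *ᴷ fourier r s) grid ≈ pow (pow z w *ᴷ xi b) β
    minus-sum = begin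
      sumL (λ s → minus s β *ᴷ fourier r s) grid
        ≈⟨ sumL-single (λ s → minus s β *ᴷ fourier r s) unique-grid (in-grid (DivMod.m%n<n (w * β) t)) off ⟩
      minus (k₀ , b) β *ᴷ (pow z k₀ *ᴷ δ Fin._≟_ b b)
        ≈⟨ *-cong (when-yes (opposite-residue w β))
             (trans (*-cong (pow-opposite z-root β k₀ (opposite-residue w β)) (δ-refl Fin._≟_ b)) (*-identityʳ _)) ⟩
      pow (xi b) β *ᴷ pow (pow z w) β
        ≈⟨ trans (*-comm _ _) (sym (pow-distrib-* (pow z w) (xi b) β)) ⟩
      pow (pow z w *ᴷ xi b) β ∎
      where
      off : ∀ {s} → s ∈ grid → s ≢ (k₀ , b) → minus s β *ᴷ fourier r s ≈ 0#
      off {k , b′} s∈ ne = cases (k ℕₚ.≟ k₀) (b Fin.≟ b′)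
        where
        cases : Dec (k ≡ k₀) → Dec (b ≡ b′) → minus (k , b′) β *ᴷ fourier r (k , b′) ≈ 0#
        cases _            (no b≢)      = off-column k b≢
        cases (yes ≡.refl) (yes ≡.refl) = contradiction ≡.refl ne
        cases (no k≢)      _            = trans (*-congʳ (when-no (λ eq → k≢ (opposite-residue-unique w β k
          (∈ₚ.∈-upTo⁻ (proj₁ (∈ₚ.∈-cartesianProduct⁻ (upTo t) (allFin n) s∈))) eq)))) (zeroˡ _)

  fourierDet : Carrier
  fourierDet = Det fourier (allFin (t * n)) rows

  D : List ℕ → Carrier
  D = Det B rows

  D-antisymmetric : Antisymmetric D
  D-antisymmetric = Det-antisymmetric B rows

  oNum-factor : ∀ ρ → oNum (t * n) (seqOf (t * n) ρ) (rootVars t n ω X) ≈ fourierDet *ᴷ D (betaSet (t * n) ρ)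
  oNum-factor ρ = begin
    oNum (t * n) (seqOf (t * n) ρ) (rootVars t n ω X)
      ≈⟨ det-tabulate (t * n) A id (λ j → beta (toℕ j)) ⟩
    Det A (allFin (t * n)) (tabulate {n = t * n} (λ j → beta (toℕ j)))
      ≡⟨ cong (Det A (allFin (t * n))) (tabulate-toℕ (t * n) beta) ⟩
    Det A (allFin (t * n)) (betaSet (t * n) ρ)
      ≈⟨ Det-product A fourier B (allFin (t * n)) rows (betaSet (t * n) ρ) (λ _ → A-factor _) len ⟩
    fourierDet *ᴷ Det (flip B) (betaSet (t * n) ρ) rows
      ≈⟨ *-congˡ (sym (Det-transpose B rows (betaSet (t * n) ρ) len)) ⟩
    fourierDet *ᴷ D (betaSet (t * n) ρ) ∎
    where
    open BetaSets (t * n) ρ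
    len : length rows ≡ length (betaSet (t * n) ρ)
    len = ≡.trans length-rows (≡.sym length-betaSet)

-- Block factorization over the pairs of residues

cat-∈ : ∀ {a} {A : Set a} (b : ℕ → List A) lo k {x} → x ∈ cat b lo k → ∃ λ i → lo ≤ i × i < lo + k × x ∈ b i
cat-∈ b lo (suc k) x∈ with ∈ₚ.∈-++⁻ (b lo) x∈
... | inj₁ x∈lo = lo , ≤-refl , m<m+n lo (s≤s z≤n) , x∈lo
... | inj₂ x∈′ with cat-∈ b (suc lo) k x∈′
...   | i , lo<i , i< , x∈i = i , <⇒≤ lo<i , subst (i <_) (≡.sym (+-suc lo k)) i< , x∈i

paired-∈ : ∀ {a} {A : Set a} (b : ℕ → List A) t f → (∀ xs → f xs ↭ xs) → ∀ e lo h → lo + lo + width e h ≡ suc t →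
           ∀ {x} → x ∈ paired b t f e lo h → ∃ λ i → lo ≤ i × i + lo ≤ t × x ∈ b i
paired-∈ b t f f↭ e lo h eq x∈ with cat-∈ b lo (width e h) (↭ₚ.∈-resp-↭ (paired-↭ b t f f↭ e lo h eq) x∈)
... | i , lo≤i , i< , x∈i = i , lo≤i , ≤-pred (≤-trans (+-monoˡ-< lo i<) (≤-reflexive (≡.trans (lemma lo (width e h)) eq))) , x∈i
  where
  lemma : ∀ lo w → lo + w + lo ≡ lo + lo + w
  lemma = solve-∀

-- The condition q ≢ ±p modulo `t` for residues below `t`: their sum is divisible by `t` only if it
-- is 0 or `t`. It makes the entries of `B` in rows of residue `p` and columns of residue `q`
-- vanish.
record Apart (t p q : ℕ) : Set where
  constructor apart
  field
    ≢-residue : q ≢ p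
    ≢-zero    : q + p ≢ 0
    ≢-modulus : q + p ≢ t

apart-sym : ∀ {t p q} → Apart t p q → Apart t q p
apart-sym {t} {p} {q} (apart ne z m) = apart (λ eq → ne (≡.sym eq)) (λ eq → z (≡.trans (ℕₚ.+-comm q p) eq)) (λ eq → m (≡.trans (ℕₚ.+-comm q p) eq))

-- The pairs {lo, t - lo} are nested, so a residue strictly between the two members of a pair is
-- congruent to neither of them, nor to their negatives.
apart-inside : ∀ {t lo p q} → p ≡ lo ⊎ p + lo ≡ t → suc lo ≤ q → q + suc lo ≤ t → Apart t p q
apart-inside {t} {lo} {.lo} {q} (inj₁ ≡.refl) lo<q q≤ = apart (λ eq → <⇒≢ lo<q (≡.sym eq))
  (λ eq → n≮0 (≤-trans lo<q (≤-reflexive (m+n≡0⇒m≡0 q eq))))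
  (λ eq → <⇒≢ (subst (_≤ t) (+-suc q lo) q≤) eq)
apart-inside {t} {lo} {p} {q} (inj₂ eqt) lo<q q≤ = apart
  (λ eq → <⇒≢ (subst (_≤ t) (+-suc q lo) q≤) (≡.trans (cong (_+ lo) eq) eqt))
  (λ eq → n≮0 (≤-trans lo<q (≤-reflexive (m+n≡0⇒m≡0 q eq))))
  (λ eq → <⇒≢ lo<q (≡.sym (+-cancelˡ-≡ p q lo (≡.trans (ℕₚ.+-comm p q) (≡.trans eq (≡.sym eqt))))))

residue-sum : ∀ w β k → k < suc w → (β + k) % suc w ≡ 0 → β % suc w + k ≡ 0 ⊎ β % suc w + k ≡ suc w
residue-sum w β k k<t eq = go (s ℕₚ.<? t)
  where
  t = suc w
  s = β % t + k
  s%t : s % t ≡ 0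
  s%t = ≡.trans (≡.trans (DivMod.%-distribˡ-+ (β % t) k t)
    (≡.trans (cong (λ z → (z + k % t) % t) (DivMod.m%n%n≡m%n β t)) (≡.sym (DivMod.%-distribˡ-+ β k t)))) eq
  go : Dec (s < t) → s ≡ 0 ⊎ s ≡ t
  go (yes s<t) = inj₁ (≡.trans (≡.sym (DivMod.m<n⇒m%n≡m s<t)) s%t)
  go (no s≮t) = inj₂ (≤-antisym (m∸n≡0⇒m≤n (≡.trans (≡.sym (DivMod.m<n⇒m%n≡m rest<t)) (≡.trans (DivMod.m≤n⇒[n∸m]%m≡n%m t≤s) s%t))) t≤s)
    where
    t≤s = ≮⇒≥ s≮t
    rest<t : s ∸ t < t
    rest<t = +-cancelʳ-< t (s ∸ t) t (subst (_< t + t) (≡.sym (m∸n+n≡m t≤s)) (+-mono-< (DivMod.m%n<n β t) k<t))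

residue-complement : ∀ w β k → β % suc w + k ≡ suc w → (β + k) % suc w ≡ 0
residue-complement w β k eq = begin
  (β + k) % t                        ≡⟨ cong (λ z → (z + k) % t) (DivMod.m≡m%n+[m/n]*n β t) ⟩
  (β % t + (β / t) * t + k) % t      ≡⟨ cong (_% t) (lemma (β % t) ((β / t) * t) k) ⟩
  (β % t + k + (β / t) * t) % t      ≡⟨ DivMod.[m+kn]%n≡m%n (β % t + k) (β / t) t ⟩
  (β % t + k) % t                    ≡⟨ cong (_% t) eq ⟩
  t % t                              ≡⟨ DivMod.n%n≡0 t ⟩
  0                                  ∎
  where
  open ≡-Reasoning
  t = suc w
  lemma : ∀ p q r → p + q + r ≡ p + r + q
  lemma = solve-∀

tabulate-splitAt : ∀ {a} {A : Set a} m n (f : Fin m → A) (g : Fin n → A) →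
                   tabulate (λ r → [ f , g ]′ (Fin.splitAt m r)) ≡ tabulate f ++ tabulate g
tabulate-splitAt zero    n f g = ≡.refl
tabulate-splitAt (suc m) n f g = cong (f Fin.zero ∷_) (≡.trans
  (Listₚ.tabulate-cong (λ r → split r))
  (tabulate-splitAt m n (f ∘ Fin.suc) g))
  where
  split : ∀ r → [ f , g ]′ (Fin.splitAt (suc m) (Fin.suc r)) ≡ [ f ∘ Fin.suc , g ]′ (Fin.splitAt m r)
  split r with Fin.splitAt m r
  ... | inj₁ _ = ≡.refl
  ... | inj₂ _ = ≡.refl

sum-map-+ : ∀ {a} {A : Set a} (f g : A → ℕ) xs → sum (map (λ x → f x + g x) xs) ≡ sum (map f xs) + sum (map g xs)
sum-map-+ f g []       = ≡.refl
sum-map-+ f g (x ∷ xs) = ≡.trans (cong (f x + g x +_) (sum-map-+ f g xs)) (lemma (f x) (g x) (sum (map f xs)) (sum (map g xs)))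
  where
  lemma : ∀ p q r u → p + q + (r + u) ≡ p + r + (q + u)
  lemma = solve-∀

-- parity of the sign relating the middle block to soNum for the empty partition
kappa : ℕ → ℕ
kappa n = sum (map (λ j → suc (n ∸ suc j)) (upTo n))

module BlockFactorization {c ℓ} (K : Field c ℓ) (e h n : ℕ) (ω : Field.Carrier K)
  (ω-root : Field._≈_ K (FieldDefs.pow K ω (suc (width e h))) (Field.1# K))
  (X : Fin n → Field.Carrier K) (X≉0 : ∀ b → ¬ (Field._≈_ K (X b) (Field.0# K)))
  (e≤1 : e ≤ 1) (ρ : List ℕ) (ρ-sorted : Sorted ρ) where
  open Specialization K e h n ω ω-root X X≉0 public
  open BetaSets (t * n) ρ public
  open Residues w hiding (t) public

  B-apart : ∀ {k} b β → k < t → Apart t k (β % t) → B (k , b) β ≈ 0#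
  B-apart {k} b β k<t (apart ne z m) = trans (+-cong (when-no ne) (when-no no-minus)) (+-identityˡ 0#)
    where
    no-minus : (β + k) % t ≢ 0
    no-minus eq with residue-sum w β k k<t eq
    ... | inj₁ eq₀ = z eq₀
    ... | inj₂ eqₜ = m eqₜ

  rowBlock-∈ : ∀ {k s} → s ∈ rowBlock k → proj₁ s ≡ k
  rowBlock-∈ s∈ with ∈ₚ.∈-map⁻ _ s∈
  ... | _ , _ , ≡.refl = ≡.refl

  pairRows : ℕ → List (ℕ × Fin n)
  pairRows lo = rowBlock lo ++ rowBlock (t ∸ lo)

  pairColumns : ℕ → List ℕ
  pairColumns lo = class lo ++ reverse (class (t ∸ lo))

  pairRows-∈ : ∀ {lo s} → lo < t → s ∈ pairRows lo → proj₁ s ≡ lo ⊎ proj₁ s + lo ≡ t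
  pairRows-∈ {lo} lo<t s∈ with ∈ₚ.∈-++⁻ (rowBlock lo) s∈
  ... | inj₁ s∈₁ = inj₁ (rowBlock-∈ s∈₁)
  ... | inj₂ s∈₂ = inj₂ (≡.trans (cong (_+ lo) (rowBlock-∈ s∈₂)) (m∸n+n≡m (<⇒≤ lo<t)))

  pairColumns-∈ : ∀ {lo β} → lo < t → β ∈ pairColumns lo → β % t ≡ lo ⊎ β % t + lo ≡ t
  pairColumns-∈ {lo} lo<t β∈ with ∈ₚ.∈-++⁻ (class lo) β∈
  ... | inj₁ β∈₁ = inj₁ (proj₂ (∈-class⁻ β∈₁))
  ... | inj₂ β∈₂ = inj₂ (≡.trans (cong (_+ lo) (proj₂ (∈-class⁻ (↭ₚ.∈-resp-↭ (↭ₚ.↭-reverse (class (t ∸ lo))) β∈₂)))) (m∸n+n≡m (<⇒≤ lo<t)))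

  innerRows-∈ : ∀ {lo k s} → lo + lo + width e k ≡ suc t → s ∈ paired rowBlock t id e lo k → lo ≤ proj₁ s × proj₁ s + lo ≤ t
  innerRows-∈ eq s∈ with paired-∈ rowBlock t id (λ _ → ↭-refl) e _ _ eq s∈
  ... | i , lo≤i , i≤ , s∈i rewrite rowBlock-∈ s∈i = lo≤i , i≤

  innerColumns-∈ : ∀ {lo k β} → lo + lo + width e k ≡ suc t → β ∈ paired class t reverse e lo k → lo ≤ β % t × β % t + lo ≤ t
  innerColumns-∈ {β = β} eq β∈ with paired-∈ class t reverse ↭ₚ.↭-reverse e _ _ eq β∈
  ... | i , lo≤i , i≤ , β∈i = subst (λ z → _ ≤ z × z + _ ≤ t) (≡.sym (proj₂ (∈-class⁻ β∈i))) (lo≤i , i≤)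

  blockProduct : ℕ → ℕ → Carrier
  blockProduct lo zero    = Det B (cat rowBlock lo e) (cat class lo e)
  blockProduct lo (suc k) = Det B (pairRows lo) (pairColumns lo) *ᴷ blockProduct (suc lo) k

  below-modulus : ∀ {p lo} → 1 ≤ lo → p + lo ≤ t → p < t
  below-modulus {p} 1≤lo le = ≤-trans (m<m+n p 1≤lo) le

  blocks-factor : ∀ lo k → 1 ≤ lo → lo + lo + width e k ≡ suc t →
                  Det B (paired rowBlock t id e lo k) (paired class t reverse e lo k) ≈ blockProduct lo k
  blocks-factor lo zero    1≤lo eq = refl
  blocks-factor lo (suc k) 1≤lo eq = trans
    (Det-block-diagonal B (pairRows lo) (paired rowBlock t id e (suc lo) k) (pairColumns lo) (paired class t reverse e (suc lo) k) off₁ off₂)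
    (*-congˡ (blocks-factor (suc lo) k (s≤s z≤n) eq′))
    where
    eq′ = next class t e lo k eq
    lo<t = proj₂ (upper-index class t lo (width e k) eq)
    off₁ : ∀ {s β} → s ∈ pairRows lo → β ∈ paired class t reverse e (suc lo) k → B s β ≈ 0#
    off₁ {i , b} {β} s∈ β∈ with pairRows-∈ lo<t s∈ | innerColumns-∈ {suc lo} {k} eq′ β∈
    ... | s-pos | lo<β , β≤ = B-apart b β (i<t s-pos) (apart-inside s-pos lo<β β≤)
      where
      i<t : i ≡ lo ⊎ i + lo ≡ t → i < t
      i<t (inj₁ ≡.refl) = lo<t
      i<t (inj₂ i+lo)   = below-modulus 1≤lo (≤-reflexive i+lo)
    off₂ : ∀ {s β} → s ∈ paired rowBlock t id e (suc lo) k → β ∈ pairColumns lo → B s β ≈ 0#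
    off₂ {i , b} {β} s∈ β∈ with innerRows-∈ {suc lo} {k} eq′ s∈
    ... | lo<i , i≤ = B-apart b β (below-modulus (s≤s z≤n) i≤) (apart-sym (apart-inside (pairColumns-∈ lo<t β∈) lo<i i≤))

  D-factor : D (class 0 ++ paired class t reverse e 1 h) ≈ Det B (rowBlock 0) (class 0) *ᴷ blockProduct 1 h
  D-factor = trans
    (Det-block-diagonal B (rowBlock 0) (paired rowBlock t id e 1 h) (class 0) (paired class t reverse e 1 h) off₁ off₂)
    (*-congˡ (blocks-factor 1 h (s≤s z≤n) ≡.refl))
    where
    off₁ : ∀ {s β} → s ∈ rowBlock 0 → β ∈ paired class t reverse e 1 h → B s β ≈ 0#
    off₁ {i , b} {β} s∈ β∈ with rowBlock-∈ s∈ | innerColumns-∈ {1} {h} ≡.refl β∈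
    ... | ≡.refl | 1≤β , β≤ = B-apart b β (s≤s z≤n) (apart-inside (inj₁ ≡.refl) 1≤β β≤)
    off₂ : ∀ {s β} → s ∈ paired rowBlock t id e 1 h → β ∈ class 0 → B s β ≈ 0#
    off₂ {i , b} {β} s∈ β∈ with innerRows-∈ {1} {h} ≡.refl s∈
    ... | 1≤i , i≤ = B-apart b β (below-modulus (s≤s z≤n) i≤) (apart-sym (apart-inside (inj₁ (proj₂ (∈-class⁻ β∈))) 1≤i i≤))

  BalancedAbove : ℕ → Set
  BalancedAbove lo = ∀ i → lo ≤ i → i + lo ≤ t → length (class i) + length (class (t ∸ i)) ≡ n + n

  -- Every residue contributes `n` rows, so the block of the pair {lo, t - lo} has 2n rows and n_lo
  -- + n_(t-lo) columns; if these numbers differ, its determinant is 0.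
  balanced-or-zero : ∀ lo k → 1 ≤ lo → lo + lo + width e k ≡ suc t → BalancedAbove lo ⊎ blockProduct lo k ≈ 0#
  balanced-or-zero lo zero 1≤lo eq = base e≤1 eq
    where
    base : ∀ {e} → e ≤ 1 → lo + lo + e ≡ suc t → BalancedAbove lo ⊎ Det B (cat rowBlock lo e) (cat class lo e) ≈ 0#
    -- For odd `t` no residue is left: 2 lo = t + 1 admits no `i` with lo ≤ i ≤ t - lo.
    base z≤n eq = inj₁ λ i lo≤i i≤ → contradiction
      (≤-trans (+-monoˡ-≤ lo lo≤i) i≤) (<⇒≱ (≤-reflexive (≡.trans (≡.sym eq) (ℕₚ.+-identityʳ _))))
    base (s≤s z≤n) eq with n ℕₚ.≟ length (class lo)
    ... | no ne = inj₂ (Det-length B (rowBlock lo ++ []) (class lo ++ []) (λ len → ne (≡.trans (≡.sym (≡.trans (cong length (Listₚ.++-identityʳ (rowBlock lo))) (length-rowBlock lo)))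
                    (≡.trans len (cong length (Listₚ.++-identityʳ (class lo)))))))
    ... | yes len = inj₁ λ i lo≤i i≤ → at i (≤-antisym (+-cancelʳ-≤ lo i lo (subst (i + lo ≤_) (≡.sym 2lo) i≤)) lo≤i)
      where
      2lo : lo + lo ≡ t
      2lo = suc-injective (≡.trans (ℕₚ.+-comm 1 (lo + lo)) eq)
      at : ∀ i → i ≡ lo → length (class i) + length (class (t ∸ i)) ≡ n + n
      at .lo ≡.refl = cong₂ _+_ (≡.sym len) (≡.trans (cong (length ∘ class) (≡.trans (cong (_∸ lo) (≡.sym 2lo)) (m+n∸m≡n lo lo))) (≡.sym len))
  balanced-or-zero lo (suc k) 1≤lo eq with n + n ℕₚ.≟ length (class lo) + length (class (t ∸ lo)) | balanced-or-zero (suc lo) k (s≤s z≤n) (next class t e lo k eq)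
  ... | no ne | _ = inj₂ (trans (*-congʳ (Det-length B (pairRows lo) (pairColumns lo) (λ len → ne (≡.trans (≡.sym len₁) (≡.trans len len₂))))) (zeroˡ _))
    where
    len₁ : length (pairRows lo) ≡ n + n
    len₁ = ≡.trans (Listₚ.length-++ (rowBlock lo)) (cong₂ _+_ (length-rowBlock lo) (length-rowBlock (t ∸ lo)))
    len₂ : length (pairColumns lo) ≡ length (class lo) + length (class (t ∸ lo))
    len₂ = ≡.trans (Listₚ.length-++ (class lo)) (cong (λ z → length (class lo) + z) (Listₚ.length-reverse (class (t ∸ lo))))
  ... | yes _ | inj₂ z = inj₂ (trans (*-congˡ z) (zeroʳ _))
  ... | yes len | inj₁ bal = inj₁ go
    where
    lo≤t = <⇒≤ (proj₂ (upper-index class t lo (width e k) eq))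
    go : BalancedAbove lo
    go i lo≤i i≤ with m≤n⇒m<n∨m≡n lo≤i | m≤n⇒m<n∨m≡n i≤
    ... | inj₂ ≡.refl | _         = ≡.sym len
    ... | inj₁ lo<i   | inj₁ i<   = bal i lo<i (subst (_≤ t) (≡.sym (+-suc i lo)) i<)
    ... | inj₁ lo<i   | inj₂ i+lo = subst₂ (λ p q → length (class p) + length (class q) ≡ n + n) (≡.sym i≡) (≡.sym t∸i≡)
            (≡.trans (ℕₚ.+-comm (length (class (t ∸ lo))) (length (class lo))) (≡.sym len))
      where
      i≡ : i ≡ t ∸ lo
      i≡ = ≡.trans (≡.sym (m+n∸n≡m i lo)) (cong (_∸ lo) i+lo)
      t∸i≡ : t ∸ i ≡ lo
      t∸i≡ = ≡.trans (cong (t ∸_) i≡) (m∸[m∸n]≡n lo≤t)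

  vanish : Det B (rowBlock 0) (class 0) *ᴷ blockProduct 1 h ≈ 0# → D (betaSet (t * n) ρ) ≈ 0#
  vanish z with antisymmetric-↭ D-antisymmetric (↭-trans (↭-sym betaSet-classes)
                  (↭ₚ.++⁺ˡ (class 0) (↭-sym (paired-↭ class t reverse ↭ₚ.↭-reverse e 1 h ≡.refl))))
  ... | k , eq = trans eq (trans (*-congˡ (trans D-factor z)) (zeroʳ _))

  balanced-or-vanishing : (nRes (t * n) t ρ 0 ≡ n × Balanced class t n) ⊎ D (betaSet (t * n) ρ) ≈ 0#
  balanced-or-vanishing with n ℕₚ.≟ nRes (t * n) t ρ 0 | balanced-or-zero 1 h (s≤s z≤n) ≡.refl
  ... | yes len₀ | inj₁ bal = inj₁ (≡.sym len₀ , λ i 1≤i i<t → bal i 1≤i (subst (_≤ t) (ℕₚ.+-comm 1 i) i<t))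
  ... | no ne    | _        = inj₂ (vanish (trans (*-congʳ (Det-length B (rowBlock 0) (class 0) (λ len → ne (≡.trans (≡.sym (length-rowBlock 0)) len)))) (zeroˡ _)))
  ... | yes _    | inj₂ z₁  = inj₂ (vanish (trans (*-congˡ z₁) (zeroʳ _)))

  N : ℕ → ℕ
  N i = nRes (t * n) t ρ i

  quotient : ℕ → List ℕ
  quotient i = quot (t * n) t ρ i

  class-parts : ∀ {a} {A : Set a} (f : ℕ → A) i → map f (class i) ≡ map (λ j → f (part (class i) j)) (upTo (N i))
  class-parts f i = ≡.trans (cong (map f) (≡.sym (map-part (class i)))) (≡.sym (Listₚ.map-∘ (upTo (N i))))

  quotient-exponents : ∀ i → N i ≡ n → map (λ j → part (quotient i) j + (n ∸ suc j)) (upTo n) ≡ map (_/ t) (class i)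
  quotient-exponents i Nᵢ = ≡.trans
    (≡.trans (cong (λ z → map (λ j → part (quotient i) j + (z ∸ suc j)) (upTo z)) (≡.sym Nᵢ))
             (map-upTo-cong (N i) (λ j lt → part-quot ρ-sorted i lt)))
    (≡.sym (class-parts (_/ t) i))

  module _ {u v : Carrier} (uv : u *ᴷ v ≈ 1#) where
    pow-class : ∀ β {i} → β % t ≡ i → pow u β ≈ pow u i *ᴷ pow (pow u t) (β / t)
    pow-class β {i} eq = begin
      pow u β                               ≡⟨ cong (pow u) (DivMod.m≡m%n+[m/n]*n β t) ⟩
      pow u (β % t + (β / t) * t)           ≈⟨ pow-+ u (β % t) _ ⟩
      pow u (β % t) *ᴷ pow u ((β / t) * t)  ≈⟨ *-cong (reflexive (cong (pow u) eq)) (sym (pow-* u t (β / t))) ⟩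
      pow u i *ᴷ pow (pow u t) (β / t)      ∎

    -- The residue t - i is read as -i with one more power of u^t. In this way all entries of a row
    -- of a block carry the same factor, which `Det-scale-rows` extracts.
    pow-class-complement : ∀ β {i j} → β % t ≡ j → i + j ≡ t → pow u β ≈ pow v i *ᴷ pow (pow u t) (suc (β / t))
    pow-class-complement β {i} {j} eq i+j = begin
      pow u β                                                ≈⟨ pow-class β eq ⟩
      pow u j *ᴷ pow (pow u t) (β / t)                       ≈⟨ *-congʳ (sym (pow-cancel uv i j)) ⟩
      (pow v i *ᴷ pow u (i + j)) *ᴷ pow (pow u t) (β / t)    ≡⟨ cong (λ z → (pow v i *ᴷ pow u z) *ᴷ pow (pow u t) (β / t)) i+j ⟩
      (pow v i *ᴷ pow u t) *ᴷ pow (pow u t) (β / t)          ≈⟨ *-assoc _ _ _ ⟩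
      pow v i *ᴷ pow (pow u t) (suc (β / t))                 ∎

  Det-rowBlock : ∀ k cs → Det B (rowBlock k) cs ≈ Det (λ b β → B (k , b) β) (allFin n) cs
  Det-rowBlock k cs = trans (reflexive (cong (Det B (rowBlock k)) (≡.sym (Listₚ.map-id cs)))) (Det-map B (k ,_) id (allFin n) cs)

  Det-quotients : ∀ (M : Fin n → ℕ → Carrier) cs →
                  Det (λ b β → M b (β / t)) (allFin n) cs ≈ Det M (allFin n) (map (_/ t) cs)
  Det-quotients M cs = sym (trans (reflexive (cong (λ z → Det M z (map (_/ t) cs)) (≡.sym (Listₚ.map-id (allFin n)))))
    (Det-map M id (_/ t) (allFin n) cs))

  det-exponents : ∀ (M : Fin n → ℕ → Carrier) i → N i ≡ n →
                  det n (λ b j → M b (part (quotient i) (toℕ j) + (n ∸ suc (toℕ j)))) ≈ Det M (allFin n) (map (_/ t) (class i))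
  det-exponents M i Nᵢ = begin
    det n (λ b j → M b (part (quotient i) (toℕ j) + (n ∸ suc (toℕ j))))
      ≈⟨ det-tabulate n M id (λ j → part (quotient i) (toℕ j) + (n ∸ suc (toℕ j))) ⟩
    Det M (allFin n) (tabulate {n = n} (λ j → part (quotient i) (toℕ j) + (n ∸ suc (toℕ j))))
      ≡⟨ cong (Det M (allFin n)) (≡.trans (tabulate-toℕ n _) (quotient-exponents i Nᵢ)) ⟩
    Det M (allFin n) (map (_/ t) (class i)) ∎

  -- In class 0 the residues of β and -β coincide, so both powers survive and form y^g + y^(-g) with
  -- y = x^t.
  zero-block : N 0 ≡ n → Det B (rowBlock 0) (class 0) ≈ oNum n (seqOf n (quotient 0)) (powVars n t X)
  zero-block N₀ = begin
    Det B (rowBlock 0) (class 0)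
      ≈⟨ Det-rowBlock 0 (class 0) ⟩
    Det (λ b β → B (0 , b) β) (allFin n) (class 0)
      ≈⟨ Det-cong (allFin n) (class 0) (λ {b} {β} _ β∈ → entry b β (proj₂ (∈-class⁻ β∈))) ⟩
    Det (λ b β → O b (β / t)) (allFin n) (class 0)
      ≈⟨ Det-quotients O (class 0) ⟩
    Det O (allFin n) (map (_/ t) (class 0))
      ≈⟨ sym (det-exponents O 0 N₀) ⟩
    oNum n (seqOf n (quotient 0)) (powVars n t X) ∎
    where
    O : Fin n → ℕ → Carrier
    O b g = zpow (pow (X b) t) (pos g) +ᴷ zpow (pow (X b) t) (ℤ.- (pos g))
    entry : ∀ b β → β % t ≡ 0 → B (0 , b) β ≈ O b (β / t)
    entry b β eq = +-cong
      (trans (when-yes eq) (trans (pow-class (x-xi b) β eq) (*-identityˡ _)))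
      (trans (when-yes (≡.trans (cong (_% t) (ℕₚ.+-identityʳ β)) eq))
        (trans (pow-class (vu (x-xi b)) β eq) (trans (*-identityˡ _) (sym (zpow-neg (pow-inverse (x-xi b) t) (β / t))))))

  module MiddleBlock (q : ℕ) (2q : q + q ≡ t) (N-q : N q ≡ n) where
    -- For β = q + g t with 2q = t, the entry x^β + x^(-β) is x^(-q) times this one. The odd
    -- orthogonal entry of exponent g at the variable -x^t agrees with it up to the sign (-1)^(g+1),
    -- which depends on the column only.
    entries : Fin n → ℕ → Carrier
    entries b g = pow (pow (X b) t) (suc g) +ᴷ pow (pow (xi b) t) g

    exponents : List ℕ
    exponents = map (_/ t) (class q)

    middleScale : Carrier
    middleScale = prodOver (λ b → pow (xi b) q) (allFin n)

    B-middle : Det B (rowBlock q) (class q) ≈ middleScale *ᴷ Det entries (allFin n) exponents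
    B-middle = begin
      Det B (rowBlock q) (class q)
        ≈⟨ Det-rowBlock q (class q) ⟩
      Det (λ b β → B (q , b) β) (allFin n) (class q)
        ≈⟨ Det-cong (allFin n) (class q) (λ {b} {β} _ β∈ → entry b β (proj₂ (∈-class⁻ β∈))) ⟩
      Det (λ b β → pow (xi b) q *ᴷ entries b (β / t)) (allFin n) (class q)
        ≈⟨ Det-scale-rows (λ b β → entries b (β / t)) (λ b → pow (xi b) q) (allFin n) (class q) ⟩
      middleScale *ᴷ Det (λ b β → entries b (β / t)) (allFin n) (class q)
        ≈⟨ *-congˡ (Det-quotients entries (class q)) ⟩
      middleScale *ᴷ Det entries (allFin n) exponents ∎
      where
      entry : ∀ b β → β % t ≡ q → B (q , b) β ≈ pow (xi b) q *ᴷ entries b (β / t)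
      entry b β eq = trans (+-cong
        (trans (when-yes eq) (pow-class-complement (x-xi b) β eq 2q))
        (trans (when-yes (residue-complement w β q (≡.trans (cong (_+ q) eq) 2q))) (pow-class (vu (x-xi b)) β eq)))
        (sym (distribˡ _ _ _))

    signs : Carrier
    signs = prodOver (λ g → signR (suc g)) exponents

    -- Each exponent is a part of λ^(q) plus a staircase term. The parts give the sign in front of
    -- the `so` factor; `kappa n` also occurs for the empty partition and cancels.
    signs-sum : signs ≈ signR (sum (quotient q) + kappa n)
    signs-sum = trans (go exponents) (reflexive (cong signR total))
      where
      go : ∀ gs → prodOver (λ g → signR (suc g)) gs ≈ signR (sum (map suc gs))
      go []       = refl
      go (g ∷ gs) = trans (*-congˡ (go gs)) (sym (signR-+ (suc g) (sum (map suc gs))))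
      lq : quotient q ≡ map (part (quotient q)) (upTo n)
      lq = ≡.trans (≡.sym (map-part (quotient q))) (cong (map (part (quotient q)) ∘ upTo) (≡.trans (length-quot ρ-sorted q) N-q))
      total : sum (map suc exponents) ≡ sum (quotient q) + kappa n
      total = ≡.trans (cong (sum ∘ map suc) (≡.sym (quotient-exponents q N-q)))
        (≡.trans (cong sum (≡.trans (≡.sym (Listₚ.map-∘ (upTo n)))
                                    (Listₚ.map-cong (λ j → ≡.sym (+-suc (part (quotient q) j) (n ∸ suc j))) (upTo n))))
          (≡.trans (sum-map-+ (part (quotient q)) (λ j → suc (n ∸ suc j)) (upTo n))
            (cong (λ z → sum z + kappa n) (≡.sym lq))))

    soNum-middle : soNum n (seqOf n (quotient q)) (negPowVars n t X) ≈ signs *ᴷ Det entries (allFin n) exponents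
    soNum-middle = begin
      soNum n (seqOf n (quotient q)) (negPowVars n t X)
        ≈⟨ det-exponents S q N-q ⟩
      Det S (allFin n) exponents
        ≈⟨ Det-cong (allFin n) exponents (λ {b} {g} _ _ → entry b g) ⟩
      Det (λ b g → signR (suc g) *ᴷ entries b g) (allFin n) exponents
        ≈⟨ Det-scale-columns entries (λ g → signR (suc g)) (allFin n) exponents
             (≡.trans (Listₚ.length-tabulate {n = n} id) (≡.sym (≡.trans (Listₚ.length-map (_/ t) (class q)) N-q))) ⟩
      signs *ᴷ Det entries (allFin n) exponents ∎
      where
      S : Fin n → ℕ → Carrier
      S b g = zpow (negPowVars n t X b) (pos g ℤ.+ pos 1) -ᴷ zpow (negPowVars n t X b) (ℤ.- (pos g))
      entry : ∀ b g → S b g ≈ signR (suc g) *ᴷ entries b g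
      entry b g = begin
        pow (-ᴷ y) (g + 1) +ᴷ (-ᴷ zpow (-ᴷ y) (ℤ.- (pos g)))
          ≈⟨ +-cong (trans (reflexive (cong (pow (-ᴷ y)) (ℕₚ.+-comm g 1))) (pow-neg y (suc g)))
                    (-‿cong (trans (zpow-neg neg-inverse g) (pow-neg y⁻¹ g))) ⟩
        signR (suc g) *ᴷ pow y (suc g) +ᴷ (-ᴷ (signR g *ᴷ pow y⁻¹ g))
          ≈⟨ +-congˡ (-‿distribˡ-* _ _) ⟩
        signR (suc g) *ᴷ pow y (suc g) +ᴷ signR (suc g) *ᴷ pow y⁻¹ g
          ≈⟨ sym (distribˡ _ _ _) ⟩
        signR (suc g) *ᴷ entries b g ∎
        where
        y = pow (X b) t
        y⁻¹ = pow (xi b) t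
        neg-inverse : (-ᴷ y) *ᴷ (-ᴷ y⁻¹) ≈ 1#
        neg-inverse = trans (sym (-‿distribˡ-* _ _)) (trans (-‿cong (sym (-‿distribʳ-* _ _)))
          (trans (-‿involutive _) (pow-inverse (x-xi b) t)))

    middle-block : Det B (rowBlock q) (class q) ≈
                   middleScale *ᴷ (signR (sum (quotient q) + kappa n) *ᴷ soNum n (seqOf n (quotient q)) (negPowVars n t X))
    middle-block = trans B-middle (*-congˡ (begin
      E                                    ≈⟨ sym (*-identityˡ _) ⟩
      1# *ᴷ E                              ≈⟨ *-congʳ (sym (signR-square total)) ⟩
      (signR total *ᴷ signR total) *ᴷ E    ≈⟨ *-assoc _ _ _ ⟩
      signR total *ᴷ (signR total *ᴷ E)    ≈⟨ *-congˡ (*-congʳ (sym signs-sum)) ⟩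
      signR total *ᴷ (signs *ᴷ E)          ≈⟨ *-congˡ (sym soNum-middle) ⟩
      signR total *ᴷ soNum n (seqOf n (quotient q)) (negPowVars n t X) ∎))
      where
      E = Det entries (allFin n) exponents
      total = sum (quotient q) + kappa n

  module PairBlock (i : ℕ) (1≤i : 1 ≤ i) (2i<t : i + i < t) (bal : N i + N (t ∸ i) ≡ n + n) where
    j = t ∸ i

    i<t : i < t
    i<t = ≤-<-trans (m≤m+n i i) 2i<t

    i+j : i + j ≡ t
    i+j = m+[n∸m]≡n (<⇒≤ i<t)

    i<j : i < j
    i<j = +-cancelˡ-< i i j (subst (i + i <_) (≡.sym i+j) 2i<t)

    j<t : j < t
    j<t = subst (j <_) i+j (m<n+m j 1≤i)

    -- the variables of the rows (i, b) and (t − i, b), before taking t-th powers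
    u v : ℕ × Fin n → Carrier
    u (k , b) = if k ≡ᵇ i then X b else xi b
    v (k , b) = if k ≡ᵇ i then xi b else X b

    uv : ∀ s → u s *ᴷ v s ≈ 1#
    uv (k , b) with k ≡ᵇ i
    ... | true  = x-xi b
    ... | false = vu (x-xi b)

    -- Scaling row `s` by the power `shift * t` of `u s` turns the exponents of `entries` into those
    -- of `mu2`: `part (quotient j) 0` is the constant that `mu2` adds, and `N j` is the difference
    -- between the staircases of lengths 2n and `N i`. By `units-cancel` the scalings multiply to 1
    -- over the block.
    shift : ℕ
    shift = part (quotient j) 0 + N j

    entries : ℕ × Fin n → ℕ → Carrier
    entries s β = if β % t ≡ᵇ i then pow (pow (u s) t) (β / t) else pow (pow (v s) t) (suc (β / t))

    exponent : ℕ → ℤ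
    exponent β = if β % t ≡ᵇ i then pos (shift + β / t) else shift ℤ.⊖ suc (β / t)

    j≢ᵇi : (j ≡ᵇ i) ≡ false
    j≢ᵇi = ≢⇒≡ᵇ≡false (λ eq → <⇒≢ i<j (≡.sym eq))

    residue-cases : ∀ {p} → p ≡ i ⊎ p + i ≡ t → p ≡ i ⊎ p ≡ j
    residue-cases (inj₁ eq) = inj₁ eq
    residue-cases {p} (inj₂ eq) = inj₂ (≡.trans (≡.sym (m+n∸n≡m p i)) (cong (_∸ i) eq))

    opposed : ∀ β k {r} → β % t ≡ r → r + k ≡ t → (β + k) % t ≡ 0
    opposed β k ≡.refl eq = residue-complement w β k eq

    not-opposed : ∀ β k {r} → β % t ≡ r → k < t → r + k ≢ 0 → r + k ≢ t → (β + k) % t ≢ 0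
    not-opposed β k ≡.refl k<t z m eq with residue-sum w β k k<t eq
    ... | inj₁ eq₀ = z eq₀
    ... | inj₂ eqₜ = m eqₜ

    j+i = ≡.trans (ℕₚ.+-comm j i) i+j

    -- The residues `i` and `j` are distinct and neither is its own opposite, so exactly one of
    -- `plus` and `minus` contributes in each of the four cases. Columns of residue `j` go through
    -- `pow-class-complement`, so that all of row `s` has the factor (u s)^i.
    B-entry : ∀ {s β} → proj₁ s ≡ i ⊎ proj₁ s ≡ j → β % t ≡ i ⊎ β % t ≡ j → B s β ≈ pow (u s) i *ᴷ entries s β
    B-entry {k , b} {β} (inj₁ ≡.refl) (inj₁ r≡) rewrite r≡ | ≡ᵇ-refl i =
      trans (trans (+-congˡ (when-no (not-opposed β i r≡ i<t (λ z → <⇒≢ 1≤i (≡.sym (m+n≡0⇒m≡0 i z))) (<⇒≢ 2i<t)))) (+-identityʳ _))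
        (pow-class (x-xi b) β r≡)
    B-entry {k , b} {β} (inj₁ ≡.refl) (inj₂ r≡) rewrite r≡ | ≡ᵇ-refl i | j≢ᵇi =
      trans (trans (+-congˡ (when-yes (opposed β i r≡ j+i))) (+-identityˡ _))
        (pow-class-complement (vu (x-xi b)) β r≡ i+j)
    B-entry {k , b} {β} (inj₂ ≡.refl) (inj₁ r≡) rewrite r≡ | ≡ᵇ-refl i | j≢ᵇi =
      trans (trans (+-cong (when-no (<⇒≢ i<j)) (when-yes (opposed β j r≡ i+j))) (+-identityˡ _))
        (pow-class (vu (x-xi b)) β r≡)
    B-entry {k , b} {β} (inj₂ ≡.refl) (inj₂ r≡) rewrite r≡ | ≡ᵇ-refl j | j≢ᵇi =
      trans (trans (+-congˡ (when-no (not-opposed β j r≡ j<t (λ z → <⇒≢ (≤-<-trans z≤n i<j) (≡.sym (m+n≡0⇒m≡0 j z)))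
               (λ eq → <⇒≢ i<j (+-cancelʳ-≡ j i j (≡.trans i+j (≡.sym eq))))))) (+-identityʳ _))
        (pow-class-complement (x-xi b) β r≡ i+j)

    -- The rows (i, b) and (j, b) carry mutually inverse variables.
    units-cancel : ∀ m → prodOver (λ s → pow (u s) m) (pairRows i) ≈ 1#
    units-cancel m = begin
      prodOver (λ s → pow (u s) m) (rowBlock i ++ rowBlock j)
        ≈⟨ prodOver-++ (λ s → pow (u s) m) (rowBlock i) (rowBlock j) ⟩
      prodOver (λ s → pow (u s) m) (rowBlock i) *ᴷ prodOver (λ s → pow (u s) m) (rowBlock j)
        ≈⟨ *-cong (prodOver-map (allFin n)) (prodOver-map (allFin n)) ⟩
      prodOver (λ b → pow (u (i , b)) m) (allFin n) *ᴷ prodOver (λ b → pow (u (j , b)) m) (allFin n)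
        ≈⟨ sym (prodOver-* (λ b → pow (u (i , b)) m) (λ b → pow (u (j , b)) m) (allFin n)) ⟩
      prodOver (λ b → pow (u (i , b)) m *ᴷ pow (u (j , b)) m) (allFin n)
        ≈⟨ prodOver-1 (allFin n) (λ {b} _ → cancel b) ⟩
      1# ∎
      where
      prodOver-map : ∀ {k} bs → prodOver (λ s → pow (u s) m) (map (k ,_) bs) ≈ prodOver (λ b → pow (u (k , b)) m) bs
      prodOver-map []       = refl
      prodOver-map (b ∷ bs) = *-congˡ (prodOver-map bs)
      cancel : ∀ b → pow (u (i , b)) m *ᴷ pow (u (j , b)) m ≈ 1#
      cancel b rewrite ≡ᵇ-refl i | j≢ᵇi = pow-inverse (x-xi b) m

    B-pair : Det B (pairRows i) (pairColumns i) ≈ Det entries (pairRows i) (pairColumns i)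
    B-pair = begin
      Det B (pairRows i) (pairColumns i)
        ≈⟨ Det-cong (pairRows i) (pairColumns i) (λ {s} {β} s∈ β∈ → B-entry {s} {β} (residue-cases (pairRows-∈ i<t s∈)) (residue-cases (pairColumns-∈ i<t β∈))) ⟩
      Det (λ s β → pow (u s) i *ᴷ entries s β) (pairRows i) (pairColumns i)
        ≈⟨ Det-scale-rows entries (λ s → pow (u s) i) (pairRows i) (pairColumns i) ⟩
      prodOver (λ s → pow (u s) i) (pairRows i) *ᴷ Det entries (pairRows i) (pairColumns i)
        ≈⟨ trans (*-congʳ (units-cancel i)) (*-identityˡ _) ⟩
      Det entries (pairRows i) (pairColumns i) ∎

    muExponent : ℕ → ℤ
    muExponent l =
      (if l <ᵇ N i
       then pos (part (quotient j) 0) ℤ.+ pos (part (quotient i) l)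
       else pos (part (quotient j) 0) ℤ.- pos (part (quotient j) ((n + n) ∸ suc l)))
      ℤ.+ pos ((n + n) ∸ suc l)

    -- The second half of `mu2` is λ^(j) negated and read backwards, so its exponents run through
    -- the class of `j` from the smallest entry upwards. This is why `pairColumns` reverses that
    -- class.
    exponents-list : map muExponent (upTo (n + n)) ≡ map exponent (pairColumns i)
    exponents-list = ≡.trans (cong (map muExponent ∘ upTo) (≡.sym bal)) (≡.trans (map-upTo-+ muExponent (N i) (N j))
      (≡.trans (cong₂ _++_ (≡.trans (map-upTo-cong (N i) first) (≡.sym (class-parts exponent i)))
                           (≡.trans (map-upTo-cong (N j) second) reversed))
               (≡.sym (Listₚ.map-++ exponent (class i) (reverse (class j))))))
      where
      reversed : map (λ l → exponent (part (class j) (N j ∸ suc l))) (upTo (N j)) ≡ map exponent (reverse (class j))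
      reversed = ≡.trans (Listₚ.map-∘ (upTo (N j))) (cong (map exponent) (≡.sym (reverse-part (class j))))
      first : ∀ l → l < N i → muExponent l ≡ exponent (part (class i) l)
      first l lt rewrite <⇒<ᵇ≡true lt | proj₂ (∈-class⁻ {part (class i) l} {i} (part-∈ (class i) lt)) | ≡ᵇ-refl i =
        cong pos (≡.trans (cong (part (quotient j) 0 + part (quotient i) l +_) (≡.trans (cong (_∸ suc l) (≡.sym bal)) (+-∸-comm (N j) lt)))
          (≡.trans (lemma (part (quotient j) 0) (part (quotient i) l) (N i ∸ suc l) (N j))
            (cong (shift +_) (part-quot ρ-sorted i lt))))
        where
        lemma : ∀ a q d m → a + q + (d + m) ≡ a + m + (q + d)
        lemma = solve-∀
      l′< : ∀ {l} → l < N j → N j ∸ suc l < N j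
      l′< lt = ∸-monoʳ-< {N j} (s≤s z≤n) lt
      l′≡ : ∀ l → (n + n) ∸ suc (N i + l) ≡ N j ∸ suc l
      l′≡ l = ≡.trans (cong (_∸ suc (N i + l)) (≡.sym bal)) (≡.trans (cong (N i + N j ∸_) (≡.sym (+-suc (N i) l)))
        ([m+n]∸[m+o]≡n∸o (N i) (N j) (suc l)))
      second : ∀ l → l < N j → muExponent (N i + l) ≡ exponent (part (class j) (N j ∸ suc l))
      second l lt rewrite ≮⇒<ᵇ≡false (≤⇒≯ (m≤m+n (N i) l)) | l′≡ l
        | proj₂ (∈-class⁻ {part (class j) (N j ∸ suc l)} {j} (part-∈ (class j) (l′< lt))) | j≢ᵇi
        | ≡.sym (part-quot ρ-sorted j (l′< lt)) =
          integers (part (quotient j) 0) (part (quotient j) (N j ∸ suc l)) (N j ∸ suc l) (N j ∸ suc (N j ∸ suc l)) (N j) (m+[n∸m]≡n (l′< lt))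
        where
        integers : ∀ a q l d m → suc l + d ≡ m → (pos a ℤ.- pos q) ℤ.+ pos l ≡ (a + m) ℤ.⊖ suc (q + d)
        integers a q l d m ≡.refl = ≡.trans (cong (ℤ._+ pos l) (ℤₚ.m-n≡m⊖n a q)) (≡.trans (ℤₚ.distribˡ-⊖-+-pos l a q)
          (≡.trans (≡.sym (ℤₚ.+-cancelˡ-⊖ (suc d) (a + l) q)) (cong₂ ℤ._⊖_ (lemma₁ a l d) (lemma₂ q d))))
          where
          lemma₁ : ∀ a l d → suc d + (a + l) ≡ a + (suc l + d)
          lemma₁ = solve-∀
          lemma₂ : ∀ q d → suc d + q ≡ suc (q + d)
          lemma₂ = solve-∀

    variable-row : Fin (n + n) → ℕ × Fin n
    variable-row r = [ (i ,_) , (j ,_) ]′ (Fin.splitAt n r)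

    variables : ∀ r → powInvVars n t X r ≡ pow (u (variable-row r)) t
    variables r with Fin.splitAt n r
    ... | inj₁ b rewrite ≡ᵇ-refl i = ≡.refl
    ... | inj₂ b rewrite j≢ᵇi      = ≡.refl

    pair-block : Det B (pairRows i) (pairColumns i) ≈ sNum (n + n) (mu2 t n ρ i) (powInvVars n t X)
    pair-block = sym (begin
      sNum (n + n) (mu2 t n ρ i) (powInvVars n t X)
        ≈⟨ det-cong (n + n) (λ r l → reflexive (cong (λ z → zpow z (muExponent (toℕ l))) (variables r))) ⟩
      det (n + n) (λ r l → Z (variable-row r) (muExponent (toℕ l)))
        ≈⟨ det-tabulate (n + n) Z variable-row (λ l → muExponent (toℕ l)) ⟩
      Det Z (tabulate variable-row) (tabulate {n = n + n} (λ l → muExponent (toℕ l)))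
        ≡⟨ cong₂ (Det Z) rows≡ (≡.trans (tabulate-toℕ (n + n) muExponent) exponents-list) ⟩
      Det Z (pairRows i) (map exponent (pairColumns i))
        ≡⟨ cong (λ z → Det Z z (map exponent (pairColumns i))) (≡.sym (Listₚ.map-id (pairRows i))) ⟩
      Det Z (map id (pairRows i)) (map exponent (pairColumns i))
        ≈⟨ Det-map Z id exponent (pairRows i) (pairColumns i) ⟩
      Det (λ s β → Z s (exponent β)) (pairRows i) (pairColumns i)
        ≈⟨ Det-cong (pairRows i) (pairColumns i) (λ {s} {β} _ _ → entry s β) ⟩
      Det (λ s β → pow (u s) (shift * t) *ᴷ entries s β) (pairRows i) (pairColumns i)
        ≈⟨ Det-scale-rows entries (λ s → pow (u s) (shift * t)) (pairRows i) (pairColumns i) ⟩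
      prodOver (λ s → pow (u s) (shift * t)) (pairRows i) *ᴷ Det entries (pairRows i) (pairColumns i)
        ≈⟨ trans (*-congʳ (units-cancel (shift * t))) (*-identityˡ _) ⟩
      Det entries (pairRows i) (pairColumns i)
        ≈⟨ sym B-pair ⟩
      Det B (pairRows i) (pairColumns i) ∎)
      where
      Z : ℕ × Fin n → ℤ → Carrier
      Z s z = zpow (pow (u s) t) z
      rows≡ : tabulate variable-row ≡ pairRows i
      rows≡ = ≡.trans (tabulate-splitAt n n (i ,_) (j ,_))
        (≡.sym (cong₂ _++_ (Listₚ.map-tabulate id (i ,_)) (Listₚ.map-tabulate id (j ,_))))
      entry : ∀ s β → Z s (exponent β) ≈ pow (u s) (shift * t) *ᴷ entries s β
      entry s β with β % t ≡ᵇ i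
      ... | true  = trans (pow-+ (pow (u s) t) shift (β / t)) (*-congʳ (pow-* (u s) t shift))
      ... | false = trans (zpow-⊖ (pow-inverse (uv s) t) shift (suc (β / t))) (*-congʳ (pow-* (u s) t shift))

-- Border strips and cores

sumTo : (ℕ → ℕ) → ℕ → ℕ
sumTo f zero    = 0
sumTo f (suc m) = sumTo f m + f m

sumTo-cong : ∀ {f g : ℕ → ℕ} m → (∀ i → i < m → f i ≡ g i) → sumTo f m ≡ sumTo g m
sumTo-cong zero    e = ≡.refl
sumTo-cong (suc m) e = cong₂ _+_ (sumTo-cong m (λ i lt → e i (m<n⇒m<1+n lt))) (e m (n<1+n m))

sumTo-mono : ∀ {f g : ℕ → ℕ} m → (∀ i → i < m → f i ≤ g i) → sumTo f m ≤ sumTo g m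
sumTo-mono zero    e = z≤n
sumTo-mono (suc m) e = +-mono-≤ (sumTo-mono m (λ i lt → e i (m<n⇒m<1+n lt))) (e m (n<1+n m))

sumTo-+ : ∀ (f g : ℕ → ℕ) m → sumTo (λ i → f i + g i) m ≡ sumTo f m + sumTo g m
sumTo-+ f g zero    = ≡.refl
sumTo-+ f g (suc m) = ≡.trans (cong (_+ (f m + g m)) (sumTo-+ f g m)) (lemma (sumTo f m) (sumTo g m) (f m) (g m))
  where
  lemma : ∀ p q r u → p + q + (r + u) ≡ p + r + (q + u)
  lemma = solve-∀

sumTo-suc : ∀ (f : ℕ → ℕ) m → sumTo f (suc m) ≡ f 0 + sumTo (f ∘ suc) m
sumTo-suc f zero    = ℕₚ.+-comm 0 (f 0)
sumTo-suc f (suc m) = ≡.trans (cong (_+ f (suc m)) (sumTo-suc f m)) (ℕₚ.+-assoc (f 0) (sumTo (f ∘ suc) m) (f (suc m)))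

sum-part : ∀ ρ m → length ρ ≤ m → sum ρ ≡ sumTo (part ρ) m
sum-part []      zero    le       = ≡.refl
sum-part []      (suc m) le       = ≡.trans (sum-part [] m z≤n) (≡.sym (ℕₚ.+-identityʳ _))
sum-part (a ∷ ρ) (suc m) (s≤s le) = ≡.trans (cong (a +_) (sum-part ρ m le)) (≡.sym (sumTo-suc (part (a ∷ ρ)) m))

count-sumTo : ∀ (p : ℕ → Bool) (f : ℕ → ℕ) m →
              length (filterᵇ p (map f (upTo m))) ≡ sumTo (λ i → if p (f i) then 1 else 0) m
count-sumTo p f m rewrite Listₚ.map-upTo f m = go f m
  where
  go : ∀ f m → length (filterᵇ p (applyUpTo f m)) ≡ sumTo (λ i → if p (f i) then 1 else 0) m
  go f zero    = ≡.refl
  go f (suc m) = ≡.trans (head (p (f 0)) ≡.refl) (≡.sym (sumTo-suc (λ i → if p (f i) then 1 else 0) m))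
    where
    head : ∀ b → p (f 0) ≡ b → length (filterᵇ p (f 0 ∷ applyUpTo (f ∘ suc) m)) ≡
           (if p (f 0) then 1 else 0) + sumTo (λ i → if p (f (suc i)) then 1 else 0) m
    head true  eq rewrite eq = cong suc (go (f ∘ suc) m)
    head false eq rewrite eq = go (f ∘ suc) m

-- g′ arises from g by deleting the entry p and inserting g′ q after the entry q.
record Shifted (m : ℕ) (g g′ : ℕ → ℕ) (p q : ℕ) : Set where
  field
    p≤q    : p ≤ q
    q<m    : q < m
    before : ∀ {i} → i < p → g′ i ≡ g i
    within : ∀ {i} → p ≤ i → i < q → g′ i ≡ g (suc i)
    after  : ∀ {i} → q < i → i < m → g′ i ≡ g i

shifted-map : ∀ {m g g′ p q} (f : ℕ → ℕ) → Shifted m g g′ p q → Shifted m (f ∘ g) (f ∘ g′) p q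
shifted-map f s = record { p≤q = p≤q ; q<m = q<m ; before = λ lt → cong f (before lt)
  ; within = λ le lt → cong f (within le lt) ; after = λ gt lt → cong f (after gt lt) }
  where open Shifted s

-- Between `p` and `q` the partial sums telescope. The functions are arbitrary, so that the lemma
-- serves both for the bead positions, where it measures the size of the strip, and for the
-- indicator of a residue, where it counts n_i.
shifted-sum : ∀ {m g g′ p q} → Shifted m g g′ p q → sumTo g′ m + g p ≡ sumTo g m + g′ q
shifted-sum {m} {g} {g′} {p} {q} s = tail (≤⇒≤′ q<m) ≤-refl
  where
  open Shifted s
  swap₂ : ∀ x y z → x + y + z ≡ x + z + y
  swap₂ = solve-∀
  middle : ∀ {k} → p ℕ.≤′ k → k ≤ q → sumTo g′ k + g p ≡ sumTo g k + g k
  middle ℕ.≤′-refl k≤q = cong (_+ g p) (sumTo-cong p (λ i → before))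
  middle {suc k} (ℕ.≤′-step p≤k) k<q = begin
    sumTo g′ k + g′ k + g p      ≡⟨ swap₂ (sumTo g′ k) (g′ k) (g p) ⟩
    sumTo g′ k + g p + g′ k      ≡⟨ cong₂ _+_ (middle p≤k (<⇒≤ k<q)) (within (≤′⇒≤ p≤k) k<q) ⟩
    sumTo g k + g k + g (suc k)  ∎
    where open ≡-Reasoning
  tail : ∀ {k} → suc q ℕ.≤′ k → k ≤ m → sumTo g′ k + g p ≡ sumTo g k + g′ q
  tail ℕ.≤′-refl _ = begin
    sumTo g′ q + g′ q + g p  ≡⟨ swap₂ (sumTo g′ q) (g′ q) (g p) ⟩
    sumTo g′ q + g p + g′ q  ≡⟨ cong (_+ g′ q) (middle (≤⇒≤′ p≤q) ≤-refl) ⟩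
    sumTo g q + g q + g′ q   ∎
    where open ≡-Reasoning
  tail {suc k} (ℕ.≤′-step q<k) k<m = begin
    sumTo g′ k + g′ k + g p  ≡⟨ swap₂ (sumTo g′ k) (g′ k) (g p) ⟩
    sumTo g′ k + g p + g′ k  ≡⟨ cong₂ _+_ (tail q<k (<⇒≤ k<m)) (after (≤′⇒≤ q<k) k<m) ⟩
    sumTo g k + g′ q + g k   ≡⟨ swap₂ (sumTo g k) (g′ q) (g k) ⟩
    sumTo g k + g k + g′ q   ∎
    where open ≡-Reasoning

module _ {P : ℕ → Set} (P? : Decidable P) where
  first-below : ∀ m → (∃ λ p → p < m × P p × (∀ {i} → i < p → ¬ P i)) ⊎ (∀ {i} → i < m → ¬ P i)
  first-below zero = inj₂ (λ ())
  first-below (suc m) with first-below m | P? m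
  ... | inj₁ (p , p<m , Pp , min) | _      = inj₁ (p , m<n⇒m<1+n p<m , Pp , min)
  ... | inj₂ none                 | yes Pm = inj₁ (m , n<1+n m , Pm , none)
  ... | inj₂ none                 | no ¬Pm = inj₂ λ i<1+m → [ none , (λ { ≡.refl → ¬Pm }) ]′ (m≤n⇒m<n∨m≡n (≤-pred i<1+m))

  last-below : ∀ m → (∃ λ q → q < m × P q × (∀ {i} → q < i → i < m → ¬ P i)) ⊎ (∀ {i} → i < m → ¬ P i)
  last-below zero = inj₂ (λ ())
  last-below (suc m) with last-below m | P? m
  ... | _                         | yes Pm = inj₁ (m , n<1+n m , Pm , λ m<i i<1+m → contradiction (≤-pred i<1+m) (<⇒≱ m<i))
  ... | inj₁ (q , q<m , Pq , max) | no ¬Pm = inj₁ (q , m<n⇒m<1+n q<m , Pq ,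
    λ q<i i<1+m → [ max q<i , (λ { ≡.refl → ¬Pm }) ]′ (m≤n⇒m<n∨m≡n (≤-pred i<1+m)))
  ... | inj₂ none                 | no ¬Pm = inj₂ λ i<1+m → [ none , (λ { ≡.refl → ¬Pm }) ]′ (m≤n⇒m<n∨m≡n (≤-pred i<1+m))

positive-part : ∀ {ν} → All (0 <_) ν → ∀ {i} → i < length ν → 0 < part ν i
positive-part (x>0 ∷ _)  {zero}  lt       = x>0
positive-part (_ ∷ ν>0)  {suc i} (s≤s lt) = positive-part ν>0 lt

contained-length : ∀ ρ {ν} → All (0 <_) ν → (∀ i → part ν i ≤ part ρ i) → length ν ≤ length ρ
contained-length ρ {ν} ν>0 ν≤ρ = ≮⇒≥ λ lt → <⇒≱ (positive-part ν>0 lt)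
  (subst (part ν (length ρ) ≤_) (part-beyond ρ ≤-refl) (ν≤ρ (length ρ)))

-- A step changes the row by at most one, so the path must pass from row `i` to row i + 1 somewhere,
-- and such a step stays in one column.
row-crossing : ∀ {ρ ν i c d} → proj₁ c ≤ i → i < proj₁ d →
               Star (λ a b → Adjacent a b × InSkew ρ ν a × InSkew ρ ν b) c d →
               ∃ λ j → InSkew ρ ν (i , j) × InSkew ρ ν (suc i , j)
row-crossing c≤i i<d ε = contradiction i<d (≤⇒≯ c≤i)
row-crossing {ρ} {ν} {i} {c} {d} c≤i i<d (_◅_ {j = b} (adj , sc , sb) rest) with proj₁ b ℕₚ.≤? i
... | yes b≤i = row-crossing {ρ} {ν} b≤i i<d rest
... | no  b≰i = step adj
  where
  step : Adjacent c b → ∃ λ j → InSkew ρ ν (i , j) × InSkew ρ ν (suc i , j)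
  step (inj₁ (eq , ≡.refl)) with ≤-antisym c≤i (≤-pred (≤-trans (≰⇒> b≰i) (≤-reflexive (≡.sym eq))))
  ... | ≡.refl = proj₂ c , sc , subst (λ z → InSkew ρ ν (z , proj₂ b)) (≡.sym eq) sb
  step (inj₂ (inj₁ (eq , _)))        = contradiction (≤-trans (n≤1+n _) (subst (_≤ i) eq c≤i)) b≰i
  step (inj₂ (inj₂ (inj₁ (eq , _)))) = contradiction (subst (_≤ i) eq c≤i) b≰i
  step (inj₂ (inj₂ (inj₂ (eq , _)))) = contradiction (subst (_≤ i) eq c≤i) b≰i

module _ (m : ℕ) where
  open BetaSets m

  -- `p` and `q` are the first and last row met by the strip. Connectedness gives consecutive rows
  -- between them a common column, and the absence of 2×2 squares allows only one, so ρ_(i+1) = ν_i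
  -- + 1: the beta number of row i of ν is that of row i + 1 of ρ. The one remaining bead then falls
  -- by the whole size `t`.
  strip-shifted : ∀ {t ρ ν} → 1 ≤ t → Sorted ρ → length ρ ≤ m → RemoveStrip t ρ ν →
                  ∃ λ p → ∃ λ q → Shifted m (beta ρ) (beta ν) p q × beta ρ p ≡ beta ν q + t
  strip-shifted {t} {ρ} {ν} 1≤t ρ-sorted ρ≤m ((ν-sorted , ν>0) , ν≤ρ , sums , connected , thin) =
    find (first-below changed? m) (last-below changed? m)
    where
    Changed : ℕ → Set
    Changed i = part ν i < part ρ i
    changed? : Decidable Changed
    changed? i = part ν i ℕₚ.<? part ρ i
    ν≤m = ≤-trans (contained-length ρ ν>0 ν≤ρ) ρ≤m
    sumTo-parts : sumTo (part ρ) m ≡ sumTo (part ν) m + t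
    sumTo-parts = ≡.trans (≡.sym (sum-part ρ m ρ≤m)) (≡.trans sums (cong (_+ t) (sum-part ν m ν≤m)))
    some-changed : ¬ (∀ {i} → i < m → ¬ Changed i)
    some-changed none = <⇒≱ (m<m+n (sumTo (part ν) m) 1≤t)
      (subst (_≤ sumTo (part ν) m) sumTo-parts (sumTo-mono m (λ i i<m → ≮⇒≥ (none i<m))))
    unchanged : ∀ {i} → ¬ Changed i → beta ν i ≡ beta ρ i
    unchanged {i} same = cong (_+ (m ∸ suc i)) (≤-antisym (ν≤ρ i) (≮⇒≥ same))
    find : (∃ λ p → p < m × Changed p × (∀ {i} → i < p → ¬ Changed i)) ⊎ (∀ {i} → i < m → ¬ Changed i) →
           (∃ λ q → q < m × Changed q × (∀ {i} → q < i → i < m → ¬ Changed i)) ⊎ (∀ {i} → i < m → ¬ Changed i) →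
           ∃ λ p → ∃ λ q → Shifted m (beta ρ) (beta ν) p q × beta ρ p ≡ beta ν q + t
    find (inj₂ none) _ = ⊥-elim (some-changed none)
    find _ (inj₂ none) = ⊥-elim (some-changed none)
    find (inj₁ (p , p<m , p-changed , p-first)) (inj₁ (q , q<m , q-changed , q-last)) = p , q , shifted , total
      where
      rows-meet : ∀ {i} → p ≤ i → i < q → part ρ (suc i) ≡ suc (part ν i)
      rows-meet {i} p≤i i<q with row-crossing {ρ} {ν} p≤i i<q
        (connected (p , part ν p) (q , part ν q) (p-changed , ≤-refl) (q-changed , ≤-refl))
      ... | j , (_ , ν≤j) , (j<ρ , _) = ≤-antisym (≮⇒≥ square) (≤-<-trans ν≤j j<ρ)
        where
        -- The cells of rows i and i + 1 in the columns ν_i and ν_i + 1 would form a square.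
        square : ¬ (suc (part ν i) < part ρ (suc i))
        square lt = thin i (part ν i)
          ( (<-≤-trans (<-trans (n<1+n _) lt) row≤ , ≤-refl)
          , (<-trans (n<1+n _) lt , part-antitone ν-sorted (n≤1+n i))
          , (<-≤-trans lt row≤ , n≤1+n _)
          , (lt , ≤-trans (part-antitone ν-sorted (n≤1+n i)) (n≤1+n _)) )
          where row≤ = part-antitone ρ-sorted (n≤1+n i)
      shifted : Shifted m (beta ρ) (beta ν) p q
      shifted = record
        { p≤q = ≮⇒≥ (λ q<p → p-first q<p q-changed)
        ; q<m = q<m
        ; before = λ i<p → unchanged (p-first i<p)
        ; within = λ {i} p≤i i<q → ≡.trans (cong (part ν i +_) (≡.sym (suc-pred (m ∸ suc i) {{ℕ.>-nonZero (m<n⇒0<n∸m (≤-<-trans i<q q<m))}})))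
            (≡.trans (+-suc (part ν i) _) (cong₂ _+_ (≡.sym (rows-meet p≤i i<q)) (pred[m∸n]≡m∸[1+n] m (suc i))))
        ; after = λ q<i i<m → unchanged (q-last q<i i<m) }
      total : beta ρ p ≡ beta ν q + t
      total = +-cancelˡ-≡ (sumTo (beta ν) m) _ _ (begin
        sumTo (beta ν) m + beta ρ p
          ≡⟨ shifted-sum shifted ⟩
        sumTo (beta ρ) m + beta ν q
          ≡⟨ cong (_+ beta ν q) (sumTo-+ (part ρ) (λ i → m ∸ suc i) m) ⟩
        sumTo (part ρ) m + R + beta ν q
          ≡⟨ cong (λ z → z + R + beta ν q) sumTo-parts ⟩
        sumTo (part ν) m + t + R + beta ν q
          ≡⟨ lemma (sumTo (part ν) m) t R (beta ν q) ⟩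
        sumTo (part ν) m + R + (beta ν q + t)
          ≡⟨ cong (_+ (beta ν q + t)) (sumTo-+ (part ν) (λ i → m ∸ suc i) m) ⟨
        sumTo (beta ν) m + (beta ν q + t) ∎)
        where
        open ≡-Reasoning
        R = sumTo (λ i → m ∸ suc i) m
        lemma : ∀ s t r b → s + t + r + b ≡ s + r + (b + t)
        lemma = solve-∀

  -- Only one bead value changes, and it changes by `suc w`, so its residue stays.
  strip-nRes : ∀ {w ρ ν} → Sorted ρ → length ρ ≤ m → RemoveStrip (suc w) ρ ν →
               ∀ i → nRes m (suc w) ρ i ≡ nRes m (suc w) ν i
  strip-nRes {w} {ρ} {ν} ρ-sorted ρ≤m strip i with strip-shifted (s≤s z≤n) ρ-sorted ρ≤m strip
  ... | p , q , shifted , total = begin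
    nRes m t ρ i               ≡⟨ count-sumTo (λ x → x % t ≡ᵇ i) (beta ρ) m ⟩
    sumTo (ind ∘ beta ρ) m     ≡⟨ +-cancelʳ-≡ (ind (beta ν q)) _ _ (≡.trans (≡.sym (shifted-sum (shifted-map ind shifted))) (cong (sumTo (ind ∘ beta ν) m +_) same)) ⟩
    sumTo (ind ∘ beta ν) m     ≡⟨ count-sumTo (λ x → x % t ≡ᵇ i) (beta ν) m ⟨
    nRes m t ν i               ∎
    where
    open ≡-Reasoning
    t = suc w
    ind : ℕ → ℕ
    ind x = if x % t ≡ᵇ i then 1 else 0
    same : ind (beta ρ p) ≡ ind (beta ν q)
    same = cong (λ z → if z ≡ᵇ i then 1 else 0) (≡.trans (cong (_% t) total) (DivMod.[m+n]%n≡m%n (beta ν q) t))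

  strips-nRes : ∀ {w ρ ν} → IsPartition ρ → length ρ ≤ m → Star (RemoveStrip (suc w)) ρ ν →
                IsPartition ν × length ν ≤ m × (∀ i → nRes m (suc w) ρ i ≡ nRes m (suc w) ν i)
  strips-nRes ρ-part ρ≤m ε = ρ-part , ρ≤m , λ i → ≡.refl
  strips-nRes {ρ = ρ} ρ-part ρ≤m (strip@((μ-part@(_ , μ>0)) , μ≤ρ , _) ◅ strips)
    with strips-nRes μ-part (≤-trans (contained-length ρ μ>0 μ≤ρ) ρ≤m) strips
  ... | ν-part , ν≤m , same = ν-part , ν≤m , λ i → ≡.trans (strip-nRes (proj₁ ρ-part) ρ≤m strip i) (same i)

-- The values are cut at the first zero because `IsPartition` demands positive parts.
trim : (ℕ → ℕ) → ℕ → List ℕ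
trim f zero    = []
trim f (suc m) with f 0
... | zero  = []
... | suc a = suc a ∷ trim (f ∘ suc) m

trim-length : ∀ f m → length (trim f m) ≤ m
trim-length f zero    = z≤n
trim-length f (suc m) with f 0
... | zero  = z≤n
... | suc a = s≤s (trim-length (f ∘ suc) m)

trim-positive : ∀ f m → All (0 <_) (trim f m)
trim-positive f zero    = []
trim-positive f (suc m) with f 0
... | zero  = []
... | suc a = s≤s z≤n ∷ trim-positive (f ∘ suc) m

trim-part : ∀ f m → (∀ i → suc i < m → f (suc i) ≤ f i) → ∀ {i} → i < m → part (trim f m) i ≡ f i
trim-part f (suc m) anti {i} i<m with f 0 in eq
... | zero = ≡.sym (vanishes i i<m)
  where
  vanishes : ∀ i → i < suc m → f i ≡ 0
  vanishes zero    _  = eq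
  vanishes (suc i) lt = n≤0⇒n≡0 (≤-trans (anti i lt) (≤-reflexive (vanishes i (<-trans (n<1+n i) lt))))
trim-part f (suc m) anti {zero}  i<m       | suc a = ≡.sym eq
trim-part f (suc m) anti {suc i} (s≤s i<m) | suc a = trim-part (f ∘ suc) m (λ i lt → anti (suc i) (s≤s lt)) i<m

linked-parts : ∀ ρ → (∀ i → part ρ (suc i) ≤ part ρ i) → Sorted ρ
linked-parts []          anti = []
linked-parts (x ∷ [])    anti = [-]
linked-parts (x ∷ y ∷ ρ) anti = anti 0 ∷ linked-parts (y ∷ ρ) (anti ∘ suc)

≢⇒if-false : ∀ {a} {A : Set a} {m n} {x y : A} → m ≢ n → (if m ≡ᵇ n then x else y) ≡ y
≢⇒if-false ne rewrite ≢⇒≡ᵇ≡false ne = ≡.refl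

≮⇒if-false : ∀ {a} {A : Set a} {m n} {x y : A} → ¬ (m < n) → (if m <ᵇ n then x else y) ≡ y
≮⇒if-false nlt rewrite ≮⇒<ᵇ≡false nlt = ≡.refl

<⇒if-true : ∀ {a} {A : Set a} {m n} {x y : A} → m < n → (if m <ᵇ n then x else y) ≡ x
<⇒if-true lt rewrite <⇒<ᵇ≡true lt = ≡.refl

-- Moving the bead at beta p to the free position x = beta p − t, which lies between the
-- beads q and q + 1, removes a border strip of size t.
module BeadMove (m w : ℕ) (ρ : List ℕ) (ρ-sorted : Sorted ρ) (ρ≤m : length ρ ≤ m)
  (x p q : ℕ) (p≤q : p ≤ q) (q<m : q < m)
  (bead : BetaSets.beta m ρ p ≡ x + suc w) (x<q : x < BetaSets.beta m ρ q)
  (above : ∀ {i} → q < i → i < m → BetaSets.beta m ρ i < x) where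
  open BetaSets m

  b = beta ρ

  b′ : ℕ → ℕ
  b′ i = if i <ᵇ p then b i else if i <ᵇ q then b (suc i) else if i ≡ᵇ q then x else b i

  b′-before : ∀ {i} → i < p → b′ i ≡ b i
  b′-before = <⇒if-true

  b′-within : ∀ {i} → p ≤ i → i < q → b′ i ≡ b (suc i)
  b′-within p≤i i<q = ≡.trans (≮⇒if-false (≤⇒≯ p≤i)) (<⇒if-true i<q)

  b′-at : b′ q ≡ x
  b′-at = ≡.trans (≮⇒if-false (≤⇒≯ p≤q)) (≡.trans (≮⇒if-false (n≮n q)) (cong (if_then x else b q) (≡ᵇ-refl q)))

  b′-after : ∀ {i} → q < i → b′ i ≡ b i
  b′-after q<i = ≡.trans (≮⇒if-false (≤⇒≯ (≤-trans p≤q (<⇒≤ q<i))))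
    (≡.trans (≮⇒if-false (<⇒≯ q<i)) (≢⇒if-false (λ eq → <⇒≢ q<i (≡.sym eq))))

  data Position (i : ℕ) : Set where
    low  : i < p → Position i
    mid  : p ≤ i → i < q → Position i
    at   : i ≡ q → Position i
    high : q < i → Position i

  position : ∀ i → Position i
  position i with i ℕₚ.<? p | <-cmp i q
  ... | yes i<p | _            = low i<p
  ... | no i≮p  | tri< i<q _ _ = mid (≮⇒≥ i≮p) i<q
  ... | no i≮p  | tri≈ _ i≡q _ = at i≡q
  ... | no i≮p  | tri> _ _ i>q = high i>q

  b-decreasing : ∀ {i j} → i < j → j < m → b j < b i
  b-decreasing = beta-decreasing ρ ρ-sorted

  b′≤b : ∀ {i} → i < m → b′ i ≤ b i
  b′≤b {i} i<m with position i
  ... | low i<p     = ≤-reflexive (b′-before i<p)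
  ... | mid p≤i i<q = ≤-trans (≤-reflexive (b′-within p≤i i<q)) (<⇒≤ (b-decreasing (n<1+n i) (≤-<-trans i<q q<m)))
  ... | at ≡.refl   = ≤-trans (≤-reflexive b′-at) (<⇒≤ x<q)
  ... | high q<i    = ≤-reflexive (b′-after q<i)

  b′-decreasing : ∀ {i} → suc i < m → b′ (suc i) < b′ i
  b′-decreasing {i} si<m with position i
  ... | low i<p = ≤-<-trans (b′≤b si<m) (subst (b (suc i) <_) (≡.sym (b′-before i<p)) (b-decreasing (n<1+n i) si<m))
  ... | at ≡.refl = subst₂ _<_ (≡.sym (b′-after (n<1+n q))) (≡.sym b′-at) (above (n<1+n q) si<m)
  ... | high q<i = subst₂ _<_ (≡.sym (b′-after (m<n⇒m<1+n q<i))) (≡.sym (b′-after q<i)) (b-decreasing (n<1+n i) si<m)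
  ... | mid p≤i i<q with m≤n⇒m<n∨m≡n i<q
  ...   | inj₁ si<q = subst₂ _<_ (≡.sym (b′-within (m≤n⇒m≤1+n p≤i) si<q)) (≡.sym (b′-within p≤i i<q))
                        (b-decreasing (n<1+n (suc i)) (≤-<-trans si<q q<m))
  ...   | inj₂ ≡.refl = subst₂ _<_ (≡.sym b′-at) (≡.sym (b′-within p≤i i<q)) x<q

  -- Strictly decreasing natural numbers dominate the staircase, so the truncated subtraction in
  -- `height` is exact.
  b′-floor : ∀ {i} → i < m → m ∸ suc i ≤ b′ i
  b′-floor {i} i<m = go (m ∸ suc i) i (≡.trans (+-suc i _) (m+[n∸m]≡n i<m))
    where
    go : ∀ d i → i + suc d ≡ m → d ≤ b′ i
    go zero    i eq = z≤n
    go (suc d) i eq = ≤-<-trans (go d (suc i) eq′) (b′-decreasing (subst (suc i <_) eq′ (m<m+n (suc i) (s≤s z≤n))))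
      where eq′ = ≡.trans (≡.sym (+-suc i (suc d))) eq

  height : ℕ → ℕ
  height i = b′ i ∸ (m ∸ suc i)

  height-b′ : ∀ {i} → i < m → height i + (m ∸ suc i) ≡ b′ i
  height-b′ i<m = m∸n+n≡m (b′-floor i<m)

  ∸-step : ∀ {i} → suc i < m → m ∸ suc i ≡ suc (m ∸ suc (suc i))
  ∸-step {i} si<m = +-∸-assoc 1 si<m

  height-antitone : ∀ i → suc i < m → height (suc i) ≤ height i
  height-antitone i si<m = +-cancelʳ-≤ (suc (m ∸ suc (suc i))) (height (suc i)) (height i)
    (subst₂ _≤_ (≡.trans (cong suc (≡.sym (height-b′ si<m))) (≡.sym (+-suc (height (suc i)) _)))
      (≡.trans (≡.sym (height-b′ (<-trans (n<1+n i) si<m))) (cong (height i +_) (∸-step si<m))) (b′-decreasing si<m))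

  ν : List ℕ
  ν = trim height m

  part-ν : ∀ {i} → i < m → part ν i ≡ height i
  part-ν = trim-part height m height-antitone

  part-ν-beyond : ∀ {i} → m ≤ i → part ν i ≡ 0
  part-ν-beyond m≤i = part-beyond ν (≤-trans (trim-length height m) m≤i)

  part-ρ-beyond : ∀ {i} → m ≤ i → part ρ i ≡ 0
  part-ρ-beyond m≤i = part-beyond ρ (≤-trans ρ≤m m≤i)

  beta-ν : ∀ {i} → i < m → beta ν i ≡ b′ i
  beta-ν {i} i<m = ≡.trans (cong (_+ (m ∸ suc i)) (part-ν i<m)) (height-b′ i<m)

  ν-sorted : Sorted ν
  ν-sorted = linked-parts ν λ i → step i (suc i ℕₚ.<? m)
    where
    step : ∀ i → Dec (suc i < m) → part ν (suc i) ≤ part ν i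
    step i (yes si<m) = subst₂ _≤_ (≡.sym (part-ν si<m)) (≡.sym (part-ν (<-trans (n<1+n i) si<m))) (height-antitone i si<m)
    step i (no si≮m)  = subst (_≤ part ν i) (≡.sym (part-ν-beyond (≮⇒≥ si≮m))) z≤n

  ν≤ρ : ∀ i → part ν i ≤ part ρ i
  ν≤ρ i with i ℕₚ.<? m
  ... | yes i<m = +-cancelʳ-≤ (m ∸ suc i) (part ν i) (part ρ i) (subst (_≤ b i) (≡.sym (beta-ν i<m)) (b′≤b i<m))
  ... | no i≮m  = subst (_≤ part ρ i) (≡.sym (part-ν-beyond (≮⇒≥ i≮m))) z≤n

  shifted : Shifted m b (beta ν) p q
  shifted = record { p≤q = p≤q ; q<m = q<m
    ; before = λ i<p → ≡.trans (beta-ν (<-trans i<p (≤-<-trans p≤q q<m))) (b′-before i<p)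
    ; within = λ p≤i i<q → ≡.trans (beta-ν (<-trans i<q q<m)) (b′-within p≤i i<q)
    ; after = λ q<i i<m → ≡.trans (beta-ν i<m) (b′-after q<i) }

  sums : sum ρ ≡ sum ν + suc w
  sums = +-cancelʳ-≡ (R + x) (sum ρ) (sum ν + t) (begin
    sum ρ + (R + x)                       ≡⟨ cong (_+ (R + x)) (sum-part ρ m ρ≤m) ⟩
    sumTo (part ρ) m + (R + x)            ≡⟨ ℕₚ.+-assoc (sumTo (part ρ) m) R x ⟨
    sumTo (part ρ) m + R + x              ≡⟨ cong (_+ x) (sumTo-+ (part ρ) (λ i → m ∸ suc i) m) ⟨
    sumTo b m + x                         ≡⟨ cong (sumTo b m +_) (≡.trans (beta-ν q<m) b′-at) ⟨
    sumTo b m + beta ν q                  ≡⟨ shifted-sum shifted ⟨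
    sumTo (beta ν) m + b p                ≡⟨ cong₂ _+_ (sumTo-+ (part ν) (λ i → m ∸ suc i) m) bead ⟩
    sumTo (part ν) m + R + (x + t)        ≡⟨ lemma (sumTo (part ν) m) R x t ⟩
    sumTo (part ν) m + t + (R + x)        ≡⟨ cong (λ z → z + t + (R + x)) (sum-part ν m (trim-length height m)) ⟨
    sum ν + t + (R + x)                   ∎)
    where
    open ≡-Reasoning
    t = suc w
    R = sumTo (λ i → m ∸ suc i) m
    lemma : ∀ s r x t → s + r + (x + t) ≡ s + t + (r + x)
    lemma = solve-∀

  next-row : ∀ {i} → p ≤ i → i < q → part ρ (suc i) ≡ suc (part ν i)
  next-row {i} p≤i i<q = +-cancelʳ-≡ (m ∸ suc (suc i)) _ _ (≡.trans (≡.sym (Shifted.within shifted p≤i i<q))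
    (≡.trans (cong (part ν i +_) (∸-step (≤-<-trans i<q q<m))) (+-suc (part ν i) _)))

  equal-parts : ∀ {i} → beta ν i ≡ b i → part ν i ≡ part ρ i
  equal-parts {i} = +-cancelʳ-≡ (m ∸ suc i) (part ν i) (part ρ i)

  changed-rows : ∀ {i} → part ν i < part ρ i → p ≤ i × i ≤ q
  changed-rows {i} lt = ≮⇒≥ (λ i<p → <⇒≢ lt (equal-parts (Shifted.before shifted i<p))) ,
    ≮⇒≥ (λ q<i → <⇒≢ lt (beyond q<i (i ℕₚ.<? m)))
    where
    beyond : q < i → Dec (i < m) → part ν i ≡ part ρ i
    beyond q<i (yes i<m) = equal-parts (Shifted.after shifted q<i i<m)
    beyond q<i (no i≮m)  = ≡.trans (part-ν-beyond (≮⇒≥ i≮m)) (≡.sym (part-ρ-beyond (≮⇒≥ i≮m)))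

  row-nonempty : ∀ {i} → p ≤ i → i < q → part ν i < part ρ i
  row-nonempty {i} p≤i i<q = ≤-trans (≤-reflexive (≡.sym (next-row p≤i i<q))) (part-antitone ρ-sorted (n≤1+n i))

  in-row : ∀ {i j} → InSkew ρ ν (i , j) → part ν i < part ρ i
  in-row (j<ρ , ν≤j) = ≤-<-trans ν≤j j<ρ

  thin : NoTwoByTwo ρ ν
  thin i j (c₁ , _ , _ , c₄) = <⇒≱ (proj₁ c₄) (≤-trans (≤-reflexive
    (next-row (proj₁ (changed-rows (in-row c₁))) (proj₂ (changed-rows (in-row c₄))))) (s≤s (proj₂ c₁)))

  Step : ℕ × ℕ → ℕ × ℕ → Set
  Step a b = Adjacent a b × InSkew ρ ν a × InSkew ρ ν b

  step-sym : ∀ {a b} → Step a b → Step b a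
  step-sym (adj , sa , sb) = adjacent-sym adj , sb , sa
    where
    adjacent-sym : ∀ {a b} → Adjacent a b → Adjacent b a
    adjacent-sym (inj₁ (r , s))               = inj₂ (inj₁ (≡.sym r , ≡.sym s))
    adjacent-sym (inj₂ (inj₁ (r , s)))        = inj₁ (≡.sym r , ≡.sym s)
    adjacent-sym (inj₂ (inj₂ (inj₁ (r , s)))) = inj₂ (inj₂ (inj₂ (≡.sym r , ≡.sym s)))
    adjacent-sym (inj₂ (inj₂ (inj₂ (r , s)))) = inj₂ (inj₂ (inj₁ (≡.sym r , ≡.sym s)))

  rightwards : ∀ {i j k} → j ℕ.≤′ k → part ν i ≤ j → k < part ρ i → Star Step (i , j) (i , k)
  rightwards ℕ.≤′-refl ν≤j k<ρ = ε
  rightwards {i} {j} {suc k} (ℕ.≤′-step j≤k) ν≤j k<ρ = rightwards j≤k ν≤j (<⇒≤ k<ρ) ◅◅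
    ((inj₂ (inj₂ (inj₁ (≡.refl , ≡.refl))) , (<⇒≤ k<ρ , ν≤k) , (k<ρ , m≤n⇒m≤1+n ν≤k)) ◅ ε)
    where ν≤k = ≤-trans ν≤j (≤′⇒≤ j≤k)

  -- Consecutive rows of the strip meet in column ν_i, which holds the first cell of row i and the
  -- last cell of row i + 1. A cell moves inside its row to that column, climbs, and finally reaches
  -- the leftmost cell of row `p`.
  to-top : ∀ d {i j} → i ≡ p + d → InSkew ρ ν (i , j) → Star Step (i , j) (p , part ν p)
  to-top zero    {j = j} eq cell rewrite ≡.trans eq (ℕₚ.+-identityʳ p) =
    Star.reverse step-sym (rightwards (≤⇒≤′ (proj₂ cell)) ≤-refl (proj₁ cell))
  to-top (suc d) {j = j} eq cell rewrite ≡.trans eq (+-suc p d) =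
    rightwards (≤⇒≤′ j≤) (proj₂ cell) end ◅◅ ((inj₂ (inj₁ (≡.refl , ≡.refl)) ,
      (end , ≤-trans (proj₂ cell) j≤) , (row-nonempty p≤ <q , ≤-refl)) ◅ to-top d ≡.refl (row-nonempty p≤ <q , ≤-refl))
    where
    p≤ = m≤m+n p d
    <q : p + d < q
    <q = proj₂ (changed-rows (in-row cell))
    end : part ν (p + d) < part ρ (suc (p + d))
    end = ≤-reflexive (≡.sym (next-row p≤ <q))
    j≤ : j ≤ part ν (p + d)
    j≤ = ≤-pred (≤-trans (proj₁ cell) (≤-reflexive (next-row p≤ <q)))

  connected : SkewConnected ρ ν
  connected (i , j) (i′ , j′) c d = top c ◅◅ Star.reverse step-sym (top d)
    where
    top : ∀ {i j} → InSkew ρ ν (i , j) → Star Step (i , j) (p , part ν p)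
    top {i} cell = to-top (i ∸ p) (≡.sym (m+[n∸m]≡n (proj₁ (changed-rows (in-row cell))))) cell

  strip : RemoveStrip (suc w) ρ ν
  strip = (ν-sorted , trim-positive height m) , ν≤ρ , sums , connected , thin

-- Otherwise the bead at x + t could slide down to the free position `x`, and `BeadMove` would
-- remove a border strip. The row `q` is the last one whose bead lies above `x`.
core-closed : ∀ {m w ρ} → Sorted ρ → length ρ ≤ m → IsTCore (suc w) ρ →
              ∀ {x} → x + suc w ∈ betaSet m ρ → x ∈ betaSet m ρ
core-closed {m} {w} {ρ} ρ-sorted ρ≤m core {x} x+t∈ with x ∈? betaSet m ρ
... | yes x∈ = x∈
... | no  x∉ with BetaSets.∈-betaSet⁻ m ρ x+t∈
...   | p , p<m , bead = ⊥-elim (move (last-below (λ i → x ℕₚ.<? beta i) m))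
  where
  open BetaSets m ρ
  x<p : x < beta p
  x<p = subst (x <_) bead (m<m+n x (s≤s z≤n))
  move : (∃ λ q → q < m × x < beta q × (∀ {i} → q < i → i < m → ¬ (x < beta i))) ⊎ (∀ {i} → i < m → ¬ (x < beta i)) → ⊥
  move (inj₂ none) = none p<m x<p
  move (inj₁ (q , q<m , x<q , last)) = core (BeadMove.ν m w ρ ρ-sorted ρ≤m x p q p≤q q<m (≡.sym bead) x<q above ,
                                             BeadMove.strip m w ρ ρ-sorted ρ≤m x p q p≤q q<m (≡.sym bead) x<q above)
    where
    p≤q : p ≤ q
    p≤q = ≮⇒≥ (λ q<p → last q<p p<m x<p)
    above : ∀ {i} → q < i → i < m → beta i < x
    above q<i i<m = ≤∧≢⇒< (≮⇒≥ (last q<i i<m)) (λ eq → x∉ (subst (_∈ betaSet m ρ) eq (∈-betaSet⁺ i<m)))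

module ClosedClass (w i : ℕ) where
  t = suc w

  multiples : ℕ → List ℕ
  multiples N = map (λ k → i + k * t) (downFrom N)

  ∈-multiples⁺ : ∀ {k N} → k < N → i + k * t ∈ multiples N
  ∈-multiples⁺ k<N = ∈ₚ.∈-map⁺ (λ k → i + k * t) (∈ₚ.∈-downFrom⁺ k<N)

  ∈-multiples⁻ : ∀ {k N} → i + k * t ∈ multiples N → k < N
  ∈-multiples⁻ {k} x∈ with ∈ₚ.∈-map⁻ (λ k → i + k * t) x∈
  ... | k′ , k′∈ , eq = subst (_< _) (≡.sym (*-cancelʳ-≡ k k′ t (+-cancelˡ-≡ i (k * t) (k′ * t) eq))) (∈ₚ.∈-downFrom⁻ k′∈)

  -- The tail is again closed, because a position `t` below one of its entries cannot be the larger
  -- head `a`; by induction it consists of the first `length L` positions. The head is none of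
  -- these, and unless it is `i` itself, a - t lies in the tail, so `a` is the next position.
  closed-class : ∀ L → Decreasing L → All (λ x → x % t ≡ i) L → (∀ {x} → x + t ∈ L → x ∈ L) → L ≡ multiples (length L)
  closed-class []      d        es       closed = ≡.refl
  closed-class (a ∷ L) (gt ∷ d) (e ∷ es) closed = cong₂ _∷_ a≡ L≡
    where
    N = length L
    closed′ : ∀ {x} → x + t ∈ L → x ∈ L
    closed′ {x} x+t∈ with closed (there x+t∈)
    ... | here ≡.refl = contradiction (All.lookup gt x+t∈) (≤⇒≯ (m≤m+n x t))
    ... | there x∈    = x∈
    L≡ : L ≡ multiples N
    L≡ = closed-class L d es closed′
    a-form : a ≡ i + (a / t) * t
    a-form = ≡.trans (DivMod.m≡m%n+[m/n]*n a t) (cong (_+ (a / t) * t) e)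
    lower : N ≤ a / t
    lower = ≮⇒≥ λ k<N → n≮n a (All.lookup gt (subst₂ _∈_ (≡.sym a-form) (≡.sym L≡) (∈-multiples⁺ k<N)))
    upper : ∀ k → a ≡ i + k * t → k ≤ N
    upper zero    eq = z≤n
    upper (suc k) eq with closed {i + k * t} (here (≡.trans (lemma i k t) (≡.sym eq)))
      where
      lemma : ∀ i k t → i + k * t + t ≡ i + (t + k * t)
      lemma = solve-∀
    ... | here same = contradiction (≡.trans same eq) (<⇒≢ (+-monoʳ-< i (m<n+m (k * t) (s≤s z≤n))))
    ... | there x∈  = ∈-multiples⁻ (subst (i + k * t ∈_) L≡ x∈)
    a≡ : a ≡ i + N * t
    a≡ = ≡.trans a-form (cong (λ z → i + z * t) (≤-antisym (upper (a / t) a-form) lower))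

-- Orthogonal partitions

≤⇒≤ᵇ≡true : ∀ {m n} → m ≤ n → (m ≤ᵇ n) ≡ true
≤⇒≤ᵇ≡true le = T⇒true (≤⇒≤ᵇ le)

≰⇒≤ᵇ≡false : ∀ {m n} → ¬ (m ≤ n) → (m ≤ᵇ n) ≡ false
≰⇒≤ᵇ≡false {m} {n} nle = ¬T⇒false (λ le → nle (≤ᵇ⇒≤ m n le))

conjPart⁺ : ∀ {ρ} → Sorted ρ → ∀ {k j} → 1 ≤ k → k ≤ part ρ j → j < conjPart ρ k
conjPart⁺ {[]}    _ 1≤k k≤0 = contradiction (≤-trans 1≤k k≤0) (λ ())
conjPart⁺ {a ∷ ρ} l {k} {j} 1≤k k≤ with k ℕₚ.≤? a
... | no k≰a = contradiction (≤-trans k≤ (part-antitone l {0} {j} z≤n)) k≰a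
... | yes k≤a rewrite ≤⇒≤ᵇ≡true k≤a = go j k≤
  where
  go : ∀ j → k ≤ part (a ∷ ρ) j → j < suc (conjPart ρ k)
  go zero    _  = s≤s z≤n
  go (suc j) k≤ = s≤s (conjPart⁺ (Linked.tail l) 1≤k k≤)

conjPart⁻ : ∀ {ρ} → Sorted ρ → ∀ {k j} → j < conjPart ρ k → k ≤ part ρ j
conjPart⁻ {a ∷ ρ} l {k} {j} lt with k ℕₚ.≤? a
... | yes k≤a rewrite ≤⇒≤ᵇ≡true k≤a = go j lt
  where
  go : ∀ j → j < suc (conjPart ρ k) → k ≤ part (a ∷ ρ) j
  go zero    _        = k≤a
  go (suc j) (s≤s lt) = conjPart⁻ (Linked.tail l) lt
... | no k≰a rewrite ≰⇒≤ᵇ≡false k≰a = contradiction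
  (≤-trans (conjPart⁻ (Linked.tail l) {k} {j} lt) (part-antitone l {0} {suc j} z≤n)) k≰a

conjPart-length : ∀ ρ k → conjPart ρ k ≤ length ρ
conjPart-length ρ k = Listₚ.length-filter (λ a → T? (k ≤ᵇ a)) ρ

conjPart-antitone : ∀ {ρ} → Sorted ρ → ∀ {k l} → 1 ≤ k → k ≤ l → conjPart ρ l ≤ conjPart ρ k
conjPart-antitone {ρ} s {k} {l} 1≤k k≤l = ≮⇒≥ λ lt →
  n≮n _ (conjPart⁺ s 1≤k (≤-trans k≤l (conjPart⁻ s {l} lt)))

maxℕ-upper : ∀ {x} xs → x ∈ xs → x ≤ maxℕ xs
maxℕ-upper (y ∷ xs) (here ≡.refl) = m≤m⊔n y (maxℕ xs)
maxℕ-upper (y ∷ xs) (there x∈)    = ≤-trans (maxℕ-upper xs x∈) (m≤n⊔m y (maxℕ xs))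

maxℕ-∈ : ∀ xs → maxℕ xs ≡ 0 ⊎ maxℕ xs ∈ xs
maxℕ-∈ [] = inj₁ ≡.refl
maxℕ-∈ (y ∷ xs) with ⊔-sel y (maxℕ xs) | maxℕ-∈ xs
... | inj₁ eq | _         = inj₂ (here eq)
... | inj₂ eq | inj₁ z    = inj₁ (≡.trans eq z)
... | inj₂ eq | inj₂ x∈   = inj₂ (there (subst (_∈ xs) (≡.sym eq) x∈))

module _ {ρ : List ℕ} (l : Sorted ρ) where
  private
    candidate : ℕ → ℕ
    candidate k = if k ≤ᵇ part ρ (k ∸ 1) then k else 0

  part-positive : ∀ {j} → 0 < part ρ j → j < length ρ
  part-positive {j} pos′ = ≰⇒> λ le → <⇒≢ pos′ (≡.sym (part-beyond ρ le))

  rank⁺ : ∀ {j} → j < part ρ j → j < rank ρ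
  rank⁺ {j} j<part = maxℕ-upper _ (subst (_∈ map candidate (applyUpTo suc (length ρ))) value
    (∈ₚ.∈-map⁺ candidate (∈ₚ.∈-applyUpTo⁺ suc (part-positive (≤-<-trans z≤n j<part)))))
    where
    value : candidate (suc j) ≡ suc j
    value rewrite ≤⇒≤ᵇ≡true j<part = ≡.refl

  rank⁻ : ∀ {j} → j < rank ρ → j < part ρ j
  rank⁻ {j} j<r with maxℕ-∈ (map candidate (applyUpTo suc (length ρ)))
  ... | inj₁ z  = contradiction (subst (j <_) z j<r) (λ ())
  ... | inj₂ r∈ with ∈ₚ.∈-map⁻ candidate r∈
  ...   | k , _ , eq with k ℕₚ.≤? part ρ (k ∸ 1)
  ...     | no k≰ rewrite ≰⇒≤ᵇ≡false k≰ = contradiction (subst (j <_) eq j<r) (λ ())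
  ...     | yes k≤ rewrite ≤⇒≤ᵇ≡true k≤ = ≤-trans j<k (≤-trans k≤ (part-antitone l (∸-monoˡ-≤ 1 j<k)))
    where
    j<k : j < k
    j<k = subst (j <_) eq j<r

  rank-conj⁺ : ∀ {j} → j < conjPart ρ (suc j) → j < rank ρ
  rank-conj⁺ lt = rank⁺ (conjPart⁻ l lt)

  rank-conj⁻ : ∀ {j} → j < rank ρ → j < conjPart ρ (suc j)
  rank-conj⁻ lt = conjPart⁺ l (s≤s z≤n) (rank⁻ lt)

  Orthogonal⁻ : Orthogonal ρ → ∀ {j} → j < rank ρ → conjPart ρ (suc j) + 1 ≡ part ρ j
  Orthogonal⁻ orth {j} j<r = ℤₚ.+-injective (≡.trans (≡.sym (left (pos (conjPart ρ (suc j))) (pos (suc j))))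
    (≡.trans (cong (ℤ._+ (pos (suc j) ℤ.+ pos 1)) (orth (suc j) (s≤s z≤n) j<r)) (right (pos (part ρ j)) (pos (suc j)))))
    where
    left : ∀ a k → (a ℤ.- k) ℤ.+ (k ℤ.+ pos 1) ≡ a ℤ.+ pos 1
    left = ℤRing.solve-∀
    right : ∀ a k → ((a ℤ.- k) ℤ.- pos 1) ℤ.+ (k ℤ.+ pos 1) ≡ a
    right = ℤRing.solve-∀

  Orthogonal⁺ : (∀ {j} → j < rank ρ → conjPart ρ (suc j) + 1 ≡ part ρ j) → Orthogonal ρ
  Orthogonal⁺ e zero    () _
  Orthogonal⁺ e (suc j) _ j<r = ≡.trans (lemma (pos (conjPart ρ (suc j))) (pos (suc j)))
    (cong (λ z → (pos z ℤ.- pos (suc j)) ℤ.- pos 1) (e j<r))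
    where
    lemma : ∀ a k → a ℤ.- k ≡ ((a ℤ.+ pos 1) ℤ.- k) ℤ.- pos 1
    lemma = ℤRing.solve-∀

-- At least `j` values lie below that of `j` and at least r - 1 - j above it, which leaves only `j`.
-- A proof of j < r is an argument of `κ` because mirror images exist only for indices below the
-- rank.
increasing-self-map : ∀ r (κ : ∀ j → j < r → ℕ) → (∀ j p → κ j p < r) →
                      (∀ {i j} p q → i < j → κ i p < κ j q) → ∀ j p → κ j p ≡ j
increasing-self-map r κ κ<r mono j p = ≤-antisym
  (+-cancelʳ-≤ (suc (r ∸ suc j)) (κ j p) j (≤-trans (upper (r ∸ suc j) j p r≡) (≤-reflexive (≡.sym r≡)))) (lower j p)
  where
  r≡ : j + suc (r ∸ suc j) ≡ r
  r≡ = ≡.trans (+-suc j _) (m+[n∸m]≡n p)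
  lower : ∀ j p → j ≤ κ j p
  lower zero    p = z≤n
  lower (suc j) p = ≤-<-trans (lower j (<-trans (n<1+n j) p)) (mono _ p (n<1+n j))
  upper : ∀ d j p → j + suc d ≡ r → κ j p + suc d ≤ r
  upper zero    j p eq = subst (_≤ r) (ℕₚ.+-comm 1 (κ j p)) (κ<r j p)
  upper (suc d) j p eq = ≤-trans (≤-reflexive (+-suc (κ j p) (suc d)))
    (≤-trans (+-monoˡ-≤ (suc d) (mono p p′ (n<1+n j))) (upper d (suc j) p′ eq′))
    where
    eq′ = ≡.trans (≡.sym (+-suc j (suc d))) eq
    p′ : suc j < r
    p′ = subst (suc j <_) eq′ (m<m+n (suc j) (s≤s z≤n))

-- Reflection at `m` is expressed by pairs with x + y = 2m, which avoids subtraction; `bound`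
-- excludes beads above 2m, which have no mirror position among the natural numbers.
record SymmetricBeads (m : ℕ) (L : List ℕ) : Set where
  field
    centre : m ∉ L
    bound  : ∀ {x} → x ∈ L → x ≤ m + m
    excl   : ∀ {x y} → x + y ≡ m + m → x ∈ L → y ∈ L → ⊥
    cover  : ∀ {x y} → x + y ≡ m + m → x ≢ m → x ∈ L ⊎ y ∈ L

module Gaps (m : ℕ) {ρ : List ℕ} (l : Sorted ρ) (ρ≤m : length ρ ≤ m) where
  open BetaSets m ρ

  beta-complement : ∀ {j} → j < m → beta j + suc j ≡ part ρ j + m
  beta-complement {j} j<m = ≡.trans (ℕₚ.+-assoc (part ρ j) (m ∸ suc j) (suc j)) (cong (part ρ j +_) (m∸n+n≡m j<m))

  -- the bead-free position of the k-th column
  gap : ∀ {g k} → 1 ≤ k → g + suc (conjPart ρ k) ≡ m + k → g ∉ betaSet m ρ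
  gap {g} {k} 1≤k eq g∈ with ∈-betaSet⁻ g∈
  ... | j , j<m , ≡.refl = compare (j ℕₚ.<? c)
    where
    c = conjPart ρ k
    lemma : ∀ x j c → x + suc j + c ≡ x + suc c + j
    lemma = solve-∀
    lemma′ : ∀ p m c → p + m + c ≡ m + (p + c)
    lemma′ = solve-∀
    -- A bead at `g` would force this equality. As `j < c` holds exactly when k ≤ ρ_j, the left side
    -- is larger if `j < c` and smaller otherwise.
    balance : part ρ j + c ≡ k + j
    balance = +-cancelˡ-≡ m _ _ (≡.trans (≡.sym (lemma′ (part ρ j) m c)) (≡.trans (cong (_+ c) (≡.sym (beta-complement j<m)))
      (≡.trans (lemma (beta j) j c) (≡.trans (cong (_+ j) eq) (ℕₚ.+-assoc m k j)))))
    compare : Dec (j < c) → ⊥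
    compare (yes j<c) = <⇒≢ (+-mono-≤-< (conjPart⁻ l {k} j<c) j<c) (≡.sym balance)
    compare (no j≮c)  = <⇒≢ (+-mono-<-≤ (≰⇒> (λ k≤ → j≮c (conjPart⁺ l 1≤k k≤))) (≮⇒≥ j≮c)) balance

  -- If `N` beads lie above the free position `g`, its column is g + N - m, counted from 0, and has
  -- length `N`: the rows with beads above `g` reach this column, and the next row stops short of
  -- it.
  gap-column : ∀ {g} → g ∉ betaSet m ρ → ∃ λ j → g + suc (conjPart ρ (suc j)) ≡ m + suc j
  gap-column {g} g∉ = found (first-below (λ i → beta i ℕₚ.≤? g) m)
    where
    column : ∀ N → N ≤ m → m ≤ g + N → (∀ {i} → i < N → g < beta i) → (∀ k → m + suc k ≡ g + suc N → ¬ (suc k ≤ part ρ N)) →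
             ∃ λ j → g + suc (conjPart ρ (suc j)) ≡ m + suc j
    column N N≤m m≤ larger stop = j , ≡.trans (cong (λ z → g + suc z) conj≡) (≡.sym j-eq)
      where
      j = (g + N) ∸ m
      j-eq : m + suc j ≡ g + suc N
      j-eq = ≡.trans (+-suc m j) (≡.trans (cong suc (m+[n∸m]≡n m≤)) (≡.sym (+-suc g N)))
      reach : ∀ M → M ≤ N → M ≤ conjPart ρ (suc j)
      reach zero    _   = z≤n
      reach (suc i) i<N = conjPart⁺ l (s≤s z≤n) (≤-trans grow (part-antitone l (≤-pred i<N′)))
        where
        N≥1 : 1 ≤ N
        N≥1 = ≤-trans (s≤s z≤n) i<N
        N′ = N ∸ 1
        N≡ : suc N′ ≡ N
        N≡ = m+[n∸m]≡n N≥1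
        i<N′ : suc i ≤ suc N′
        i<N′ = ≤-trans i<N (≤-reflexive (≡.sym N≡))
        N′<N : N′ < N
        N′<N = ≤-reflexive N≡
        grow : suc j ≤ part ρ N′
        grow = +-cancelʳ-≤ m (suc j) (part ρ N′) (≤-trans (≤-reflexive (≡.trans (ℕₚ.+-comm (suc j) m) (≡.trans j-eq (≡.trans (+-suc g N) (cong (λ z → suc (g + z)) (≡.sym N≡))))))
          (≤-trans (+-monoˡ-≤ (suc N′) (larger N′<N)) (≤-reflexive (beta-complement (<-≤-trans N′<N N≤m)))))
      conj≡ : conjPart ρ (suc j) ≡ N
      conj≡ = ≤-antisym (≮⇒≥ (λ N<c → stop j j-eq (conjPart⁻ l N<c))) (reach N ≤-refl)
    found : (∃ λ N → N < m × beta N ≤ g × (∀ {i} → i < N → ¬ (beta i ≤ g))) ⊎ (∀ {i} → i < m → ¬ (beta i ≤ g)) →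
            ∃ λ j → g + suc (conjPart ρ (suc j)) ≡ m + suc j
    found (inj₂ none) = column m ≤-refl (m≤n+m m g) (λ i<m → ≰⇒> (none i<m))
      (λ k _ le → n≮0 (≤-trans le (≤-reflexive (part-beyond ρ ρ≤m))))
    found (inj₁ (N , N<m , b≤g , first)) = column N (<⇒≤ N<m) m≤ (λ i<N → ≰⇒> (first i<N)) stop
      where
      b<g : beta N < g
      b<g = ≤∧≢⇒< b≤g (λ eq → g∉ (subst (_∈ betaSet m ρ) eq (∈-betaSet⁺ N<m)))
      b-sum : part ρ N + m < g + suc N
      b-sum = subst (_< g + suc N) (beta-complement N<m) (+-monoˡ-< (suc N) b<g)
      m≤ : m ≤ g + N
      m≤ = ≤-pred (subst (suc m ≤_) (+-suc g N) (≤-<-trans (m≤n+m m (part ρ N)) b-sum))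
      stop : ∀ k → m + suc k ≡ g + suc N → ¬ (suc k ≤ part ρ N)
      stop k eq le = <⇒≱ b-sum (≤-trans (≤-reflexive (≡.sym eq)) (subst (_≤ part ρ N + m) (ℕₚ.+-comm (suc k) m) (+-monoˡ-≤ m le)))

  -- The beads at or above `m` belong to the rows through the Durfee square, and `d` is the
  -- Frobenius coordinate α of the row.
  large-bead : ∀ {d} → m + d ∈ betaSet m ρ → ∃ λ j → j < rank ρ × part ρ j ≡ d + suc j
  large-bead {d} x∈ with ∈-betaSet⁻ x∈
  ... | j , j<m , eq = j , rank⁺ l (subst (j <_) (≡.sym part≡) (m≤n+m (suc j) d)) , part≡
    where
    part≡ : part ρ j ≡ d + suc j
    part≡ = +-cancelʳ-≡ m _ _ (≡.trans (≡.sym (beta-complement j<m)) (≡.trans (cong (_+ suc j) (≡.sym eq)) (lemma m d (suc j))))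
      where
      lemma : ∀ m d s → m + d + s ≡ d + s + m
      lemma = solve-∀

  rank<m : ∀ {j} → j < rank ρ → j < m
  rank<m j<r = <-≤-trans (part-positive l (≤-<-trans z≤n (rank⁻ l j<r))) ρ≤m

  rank-bead : ∀ {j} → j < rank ρ → m + (part ρ j ∸ suc j) ∈ betaSet m ρ
  rank-bead {j} j<r = subst (_∈ betaSet m ρ) eq (∈-betaSet⁺ (rank<m j<r))
    where
    eq : beta j ≡ m + (part ρ j ∸ suc j)
    eq = +-cancelʳ-≡ (suc j) _ _ (≡.trans (beta-complement (rank<m j<r)) (≡.trans (ℕₚ.+-comm (part ρ j) m)
      (≡.trans (cong (m +_) (≡.sym (m∸n+n≡m (rank⁻ l j<r)))) (≡.sym (ℕₚ.+-assoc m _ (suc j))))))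

  module _ (orth : Orthogonal ρ) where
    private
      L = betaSet m ρ

      -- Orthogonality gives the column paired with the bead m + d the length d + j. By `gap` the
      -- free position of that column is m - d, the mirror image of the bead.
      column-of : ∀ {d} → m + d ∈ L → ∃ λ j → j < rank ρ × conjPart ρ (suc j) ≡ d + j
      column-of {d} x∈ with large-bead x∈
      ... | j , j<r , part≡ = j , j<r , +-cancelʳ-≡ 1 _ _ (≡.trans (Orthogonal⁻ l orth j<r)
        (≡.trans part≡ (≡.trans (cong (d +_) (ℕₚ.+-comm 1 j)) (≡.sym (ℕₚ.+-assoc d j 1)))))

      centre : m ∉ L
      centre m∈ with column-of {0} (subst (_∈ L) (≡.sym (ℕₚ.+-identityʳ m)) m∈)
      ... | j , j<r , conj≡ = <⇒≢ (rank-conj⁻ l j<r) (≡.sym conj≡)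

      d≤m : ∀ {d} → m + d ∈ L → d ≤ m
      d≤m {d} x∈ with column-of x∈
      ... | j , j<r , conj≡ = ≤-trans (m≤m+n d j) (≤-trans (≤-reflexive (≡.sym conj≡)) (≤-trans (conjPart-length ρ (suc j)) ρ≤m))

      up : ∀ {d g} → g + d ≡ m → m + d ∈ L → g ∉ L
      up {d} {g} eq x∈ with column-of x∈
      ... | j , j<r , conj≡ = gap (s≤s z≤n) (≡.trans (cong (λ z → g + suc z) conj≡) (≡.trans (lemma g d j) (cong (_+ suc j) eq)))
        where
        lemma : ∀ g d j → g + suc (d + j) ≡ g + d + suc j
        lemma = solve-∀

      down : ∀ {d g} → g + d ≡ m → 1 ≤ d → g ∉ L → m + d ∈ L
      down {d} {g} eq 1≤d g∉ with gap-column g∉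
      ... | j , j-eq = subst (λ z → m + z ∈ L) d≡ (rank-bead j<r)
        where
        conj≡ : conjPart ρ (suc j) ≡ d + j
        conj≡ = suc-injective (+-cancelˡ-≡ g _ _ (≡.trans j-eq (≡.trans (cong (_+ suc j) (≡.sym eq)) (lemma g d j))))
          where
          lemma : ∀ g d j → g + d + suc j ≡ g + suc (d + j)
          lemma = solve-∀
        j<r : j < rank ρ
        j<r = rank-conj⁺ l (subst (j <_) (≡.sym conj≡) (m<n+m j 1≤d))
        d≡ : part ρ j ∸ suc j ≡ d
        d≡ = ≡.trans (cong (_∸ suc j) (≡.trans (≡.sym (Orthogonal⁻ l orth j<r)) (≡.trans (cong (_+ 1) conj≡)
          (≡.trans (ℕₚ.+-assoc d j 1) (cong (d +_) (ℕₚ.+-comm j 1)))))) (m+n∸n≡m d (suc j))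

    orthogonal-symmetric : SymmetricBeads m (betaSet m ρ)
    orthogonal-symmetric = record { centre = centre ; bound = bound ; excl = excl ; cover = cover }
      where
      shift-pair : ∀ {x y} d → x + y ≡ m + m → y ≡ m + d → x + d ≡ m
      shift-pair {x} d eq ≡.refl = +-cancelˡ-≡ m _ _ (≡.trans (lemma m x d) eq)
        where
        lemma : ∀ m x d → m + (x + d) ≡ x + (m + d)
        lemma = solve-∀
      bound : ∀ {x} → x ∈ L → x ≤ m + m
      bound {x} x∈ with m ℕₚ.≤? x
      ... | no m≰x  = ≤-trans (<⇒≤ (≰⇒> m≰x)) (m≤m+n m m)
      ... | yes m≤x = ≤-trans (≤-reflexive (≡.sym x≡)) (+-monoʳ-≤ m (d≤m (subst (_∈ L) (≡.sym x≡) x∈)))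
        where x≡ = m+[n∸m]≡n m≤x
      excl′ : ∀ {x y} → m ≤ y → x + y ≡ m + m → x ∈ L → y ∈ L → ⊥
      excl′ {x} {y} m≤y eq x∈ y∈ = up (shift-pair (y ∸ m) eq (≡.sym y≡)) (subst (_∈ L) (≡.sym y≡) y∈) x∈
        where y≡ = m+[n∸m]≡n m≤y
      larger : ∀ {x y} → x + y ≡ m + m → ¬ (m ≤ y) → m ≤ x
      larger eq m≰y = ≮⇒≥ λ x<m → <⇒≢ (+-mono-< x<m (≰⇒> m≰y)) eq
      excl : ∀ {x y} → x + y ≡ m + m → x ∈ L → y ∈ L → ⊥
      excl {x} {y} eq x∈ y∈ with m ℕₚ.≤? y
      ... | yes m≤y = excl′ m≤y eq x∈ y∈
      ... | no m≰y  = excl′ (larger eq m≰y) (≡.trans (ℕₚ.+-comm y x) eq) y∈ x∈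
      cover′ : ∀ {x y} → m < y → x + y ≡ m + m → x ∉ L → y ∈ L
      cover′ {x} {y} m<y eq x∉ = subst (_∈ L) y≡ (down (shift-pair (y ∸ m) eq (≡.sym y≡)) (m<n⇒0<n∸m m<y) x∉)
        where y≡ = m+[n∸m]≡n (<⇒≤ m<y)
      cover : ∀ {x y} → x + y ≡ m + m → x ≢ m → x ∈ L ⊎ y ∈ L
      cover {x} {y} eq x≢m with x ∈? L | y ∈? L | <-cmp x m
      ... | yes x∈ | _      | _           = inj₁ x∈
      ... | no _   | yes y∈ | _           = inj₂ y∈
      ... | no x∉  | no y∉  | tri≈ _ e _  = contradiction e x≢m
      ... | no x∉  | no y∉  | tri< x<m _ _ = inj₂ (cover′ (≰⇒> (λ y≤m → <⇒≢ (+-mono-<-≤ x<m y≤m) eq)) eq x∉)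
      ... | no x∉  | no y∉  | tri> _ _ m<x = inj₁ (cover′ m<x (≡.trans (ℕₚ.+-comm y x) eq) y∉)

  -- The i-th largest bead above m must be the mirror image of the i-th smallest gap below m,
  -- because the reflection is an increasing map between sets of the same size, rank ρ.
  symmetric-orthogonal : SymmetricBeads m (betaSet m ρ) → Orthogonal ρ
  symmetric-orthogonal sym-beads = Orthogonal⁺ l λ {j} j<r → ≡.trans (cong (_+ 1)
      (≡.trans (cong (conjPart ρ ∘ suc) (≡.sym (κ-id j j<r))) (≡.trans (proj₂ (mirror j j<r)) (cong (excess j +_) (κ-id j j<r)))))
      (≡.trans (ℕₚ.+-assoc (excess j) j 1) (≡.trans (cong (excess j +_) (ℕₚ.+-comm j 1)) (m∸n+n≡m (rank⁻ l j<r))))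
    where
    open SymmetricBeads sym-beads
    L = betaSet m ρ
    excess : ℕ → ℕ
    excess j = part ρ j ∸ suc j
    excess≤m : ∀ {j} → j < rank ρ → excess j ≤ m
    excess≤m j<r = +-cancelˡ-≤ m _ _ (bound (rank-bead j<r))
    mirror : ∀ j → j < rank ρ → ∃ λ κ → conjPart ρ (suc κ) ≡ excess j + κ
    mirror j j<r with gap-column {m ∸ excess j} (λ g∈ → excl mirrored g∈ (rank-bead j<r))
      where
      mirrored : m ∸ excess j + (m + excess j) ≡ m + m
      mirrored = ≡.trans (lemma (m ∸ excess j) m (excess j)) (cong (m +_) (m∸n+n≡m (excess≤m j<r)))
        where
        lemma : ∀ g m d → g + (m + d) ≡ m + (g + d)
        lemma = solve-∀
    ... | κ , eq = κ , suc-injective (+-cancelˡ-≡ (m ∸ excess j) _ _ (≡.trans eq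
      (≡.trans (cong (_+ suc κ) (≡.sym (m∸n+n≡m (excess≤m j<r)))) (lemma (m ∸ excess j) (excess j) κ))))
      where
      lemma : ∀ g d j → g + d + suc j ≡ g + suc (d + j)
      lemma = solve-∀
    excess>0 : ∀ {j} → j < rank ρ → 0 < excess j
    excess>0 {j} j<r = n≢0⇒n>0 λ z → centre (subst (_∈ L) (≡.trans (cong (m +_) z) (ℕₚ.+-identityʳ m)) (rank-bead j<r))
    excess-decreasing : ∀ {i j} → i < j → j < rank ρ → excess j < excess i
    excess-decreasing {i} {j} i<j j<r = ≤-<-trans (∸-monoˡ-≤ (suc j) (part-antitone l (<⇒≤ i<j)))
      (∸-monoʳ-< (s≤s i<j) (≤-trans (rank⁻ l j<r) (part-antitone l (<⇒≤ i<j))))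
    κ-id : ∀ j j<r → proj₁ (mirror j j<r) ≡ j
    κ-id = increasing-self-map (rank ρ) (λ j j<r → proj₁ (mirror j j<r))
      (λ j j<r → rank-conj⁺ l (subst (proj₁ (mirror j j<r) <_) (≡.sym (proj₂ (mirror j j<r))) (m<n+m _ (excess>0 j<r))))
      (λ {i} {j} i<r j<r i<j → ≰⇒> λ κj≤κi → <⇒≱ (+-mono-<-≤ (excess-decreasing i<j j<r) κj≤κi)
        (subst₂ _≤_ (proj₂ (mirror i i<r)) (proj₂ (mirror j j<r)) (conjPart-antitone l (s≤s z≤n) (s≤s κj≤κi))))

-- Bead counts of cores and symmetry about `m`

residue-unique : ∀ w {i} k → i < suc w → (i + k * suc w) % suc w ≡ i
residue-unique w {i} k i<t = ≡.trans (DivMod.[m+kn]%n≡m%n i k (suc w)) (DivMod.m<n⇒m%n≡m i<t)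

quotient-unique : ∀ w {i} k → i < suc w → (i + k * suc w) / suc w ≡ k
quotient-unique w {i} k i<t = *-cancelʳ-≡ _ k (suc w) (+-cancelˡ-≡ i _ _
  (≡.trans (cong (_+ (x / suc w) * suc w) (≡.sym (residue-unique w k i<t))) (≡.sym (DivMod.m≡m%n+[m/n]*n x (suc w)))))
  where x = i + k * suc w

module ClosedBeads (w n : ℕ) (ρ : List ℕ) (l : Sorted ρ)
  (closed : ∀ {x} → x + suc w ∈ betaSet (suc w * n) ρ → x ∈ betaSet (suc w * n) ρ) where
  open BetaSets (suc w * n) ρ public
  open Residues w public

  m = t * n

  N : ℕ → ℕ
  N i = nRes m t ρ i

  class-multiples : ∀ i → class i ≡ ClosedClass.multiples w i (N i)
  class-multiples i = ClosedClass.closed-class w i (class i) (class-decreasing l i) (All.tabulate (λ x∈ → proj₂ (∈-class⁻ x∈)))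
    (λ {x} x+t∈ → ∈-class⁺ (closed (proj₁ (∈-class⁻ x+t∈))) (≡.trans (≡.sym (DivMod.[m+n]%n≡m%n x t)) (proj₂ (∈-class⁻ {i = i} x+t∈))))

  bead⁺ : ∀ x → x / t < N (x % t) → x ∈ betaSet m ρ
  bead⁺ x lt = proj₁ (∈-class⁻ (subst₂ _∈_ (≡.sym (DivMod.m≡m%n+[m/n]*n x t)) (≡.sym (class-multiples (x % t)))
    (ClosedClass.∈-multiples⁺ w (x % t) lt)))

  bead⁻ : ∀ {x} → x ∈ betaSet m ρ → x / t < N (x % t)
  bead⁻ {x} x∈ = ClosedClass.∈-multiples⁻ w (x % t) (subst₂ _∈_ (DivMod.m≡m%n+[m/n]*n x t) (class-multiples (x % t)) (∈-class⁺ x∈ ≡.refl))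

  bead-at⁺ : ∀ {i} k → i < t → k < N i → i + k * t ∈ betaSet m ρ
  bead-at⁺ {i} k i<t lt = bead⁺ (i + k * t) (subst₂ (λ p q → p < N q) (≡.sym (quotient-unique w k i<t)) (≡.sym (residue-unique w k i<t)) lt)

  bead-at⁻ : ∀ {i} k → i < t → i + k * t ∈ betaSet m ρ → k < N i
  bead-at⁻ {i} k i<t x∈ = subst₂ (λ p q → p < N q) (quotient-unique w k i<t) (residue-unique w k i<t) (bead⁻ x∈)

  module _ (sb : SymmetricBeads m (betaSet m ρ)) where
    open SymmetricBeads sb

    private
      m≡ : m ≡ n * t
      m≡ = ℕₚ.*-comm t n

      2m≡ : m + m ≡ (n + n) * t
      2m≡ = ≡.trans (cong₂ _+_ m≡ m≡) (≡.sym (*-distribʳ-+ t n n))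

    -- The centre m = n t lies in class 0 and is not a bead, so at most `n` beads fit below it. If
    -- there were fewer, the mirror pair N 0 · t and (2n - N 0) · t would both be free.
    symmetric⇒N₀ : N 0 ≡ n
    symmetric⇒N₀ = ≤-antisym (≮⇒≥ (λ n<N → centre (subst (_∈ betaSet m ρ) (≡.sym m≡) (bead-at⁺ n (s≤s z≤n) n<N)))) (≮⇒≥ deficit)
      where
      deficit : ¬ (N 0 < n)
      deficit N<n with cover {N 0 * t} {(n + n ∸ N 0) * t} (≡.trans (≡.sym (*-distribʳ-+ t (N 0) (n + n ∸ N 0)))
                          (≡.trans (cong (_* t) (m+[n∸m]≡n (≤-trans (<⇒≤ N<n) (m≤m+n n n)))) (≡.sym 2m≡)))
                        (λ eq → <⇒≢ N<n (*-cancelʳ-≡ (N 0) n t (≡.trans eq m≡)))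
      ... | inj₁ x∈ = n≮n _ (bead-at⁻ (N 0) (s≤s z≤n) x∈)
      ... | inj₂ y∈ = <⇒≱ (bead-at⁻ (n + n ∸ N 0) (s≤s z≤n) y∈) (≤-trans (<⇒≤ N<n)
                        (≤-trans (≤-reflexive (≡.sym (m+n∸n≡m n n))) (∸-monoʳ-≤ (n + n) (<⇒≤ N<n))))

    -- The mirror image of i + k t is (t - i) + (2n - 1 - k) t. If the two counts exceed 2n, the
    -- topmost bead of class `i` faces another bead; if they fall short, the first free position of
    -- class `i` faces a free position.
    symmetric⇒balanced : Balanced class t n
    symmetric⇒balanced i 1≤i i<t = ≤-antisym (≮⇒≥ surplus) (≮⇒≥ deficit)
      where
      i′ = t ∸ i
      i+i′ : i + i′ ≡ t
      i+i′ = m+[n∸m]≡n (<⇒≤ i<t)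
      i′<t : i′ < t
      i′<t = ∸-monoʳ-< 1≤i (<⇒≤ i<t)
      1≤i′ : 1 ≤ i′
      1≤i′ = m<n⇒0<n∸m i<t
      mirrored : ∀ k k′ → suc (k + k′) ≡ n + n → (i + k * t) + (i′ + k′ * t) ≡ m + m
      mirrored k k′ eq = ≡.trans (lemma i k i′ k′ t) (≡.trans (cong (_+ (k + k′) * t) i+i′) (≡.trans (cong (_* t) eq) (≡.sym 2m≡)))
        where
        lemma : ∀ i k i′ k′ t → (i + k * t) + (i′ + k′ * t) ≡ (i + i′) + (k + k′) * t
        lemma = solve-∀
      off-centre : ∀ k → i + k * t ≢ m
      off-centre k eq = <⇒≢ 1≤i (≡.sym (≡.trans (≡.sym (residue-unique w k i<t))
        (≡.trans (cong (_% t) (≡.trans eq m≡)) (DivMod.m*n%n≡0 n t))))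
      N≤2n : ∀ {j} → 1 ≤ j → j < t → N j ≤ n + n
      N≤2n {j} 1≤j j<t = ≮⇒≥ λ lt → <⇒≱ (m<n+m ((n + n) * t) 1≤j) (subst (j + (n + n) * t ≤_) 2m≡ (bound (bead-at⁺ (n + n) j<t lt)))
      surplus : ¬ (n + n < N i + N i′)
      surplus lt = excl (mirrored k k′ total) (bead-at⁺ k i<t (≤-reflexive k+1)) (bead-at⁺ k′ i′<t k′<)
        where
        1≤N : 1 ≤ N i
        1≤N = +-cancelʳ-≤ (N i′) 1 (N i) (≤-trans (s≤s (N≤2n 1≤i′ i′<t)) lt)
        k = N i ∸ 1
        k+1 : suc k ≡ N i
        k+1 = m+[n∸m]≡n 1≤N
        k′ = n + n ∸ N i
        total : suc (k + k′) ≡ n + n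
        total = ≡.trans (cong (_+ k′) k+1) (m+[n∸m]≡n (N≤2n 1≤i i<t))
        k′< : k′ < N i′
        k′< = +-cancelˡ-< (N i) k′ (N i′) (subst (_< N i + N i′) (≡.sym (m+[n∸m]≡n (N≤2n 1≤i i<t))) lt)
      deficit : ¬ (N i + N i′ < n + n)
      deficit lt with cover (mirrored (N i) k′ total) (off-centre (N i))
        where
        k′ = n + n ∸ suc (N i)
        total : suc (N i + k′) ≡ n + n
        total = m+[n∸m]≡n (≤-trans (s≤s (m≤m+n (N i) (N i′))) lt)
      ... | inj₁ x∈ = n≮n _ (bead-at⁻ (N i) i<t x∈)
      ... | inj₂ y∈ = <⇒≱ (bead-at⁻ (n + n ∸ suc (N i)) i′<t y∈) (≤-trans (≤-reflexive (≡.sym (m+n∸m≡n (suc (N i)) (N i′)))) (∸-monoˡ-≤ (suc (N i)) lt))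

  -- Either both positions lie in class 0, or their residues add up to `t`; this carry is the
  -- missing one in the sum of the quotients.
  mirrored-residues : ∀ x y → x + y ≡ m + m →
    (x % t ≡ 0 × y % t ≡ 0 × x / t + y / t ≡ n + n) ⊎ (x % t + y % t ≡ t × suc (x / t + y / t) ≡ n + n)
  mirrored-residues x y eq = go (residue-sum w (x % t) (y % t) (DivMod.m%n<n y t) zero-sum)
    where
    total : x % t + y % t + (x / t + y / t) * t ≡ (n + n) * t
    total = ≡.trans (≡.sym (lemma (x % t) (y % t) (x / t) (y / t) t)) (≡.trans (cong₂ _+_ (≡.sym (DivMod.m≡m%n+[m/n]*n x t)) (≡.sym (DivMod.m≡m%n+[m/n]*n y t)))
      (≡.trans eq (≡.trans (cong₂ _+_ (ℕₚ.*-comm t n) (ℕₚ.*-comm t n)) (≡.sym (*-distribʳ-+ t n n)))))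
      where
      lemma : ∀ a b k l t → (a + k * t) + (b + l * t) ≡ a + b + (k + l) * t
      lemma = solve-∀
    zero-sum : (x % t + y % t) % t ≡ 0
    zero-sum = ≡.trans (≡.sym (DivMod.[m+kn]%n≡m%n (x % t + y % t) (x / t + y / t) t)) (≡.trans (cong (_% t) total) (DivMod.m*n%n≡0 (n + n) t))
    same : x % t % t ≡ x % t
    same = DivMod.m%n%n≡m%n x t
    go : x % t % t + y % t ≡ 0 ⊎ x % t % t + y % t ≡ t →
         (x % t ≡ 0 × y % t ≡ 0 × x / t + y / t ≡ n + n) ⊎ (x % t + y % t ≡ t × suc (x / t + y / t) ≡ n + n)
    go (inj₁ z) = inj₁ (m+n≡0⇒m≡0 (x % t) z′ , m+n≡0⇒n≡0 (x % t) z′ ,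
        *-cancelʳ-≡ (x / t + y / t) (n + n) t (≡.trans (cong (_+ (x / t + y / t) * t) (≡.sym z′)) total))
      where z′ = ≡.trans (cong (_+ y % t) (≡.sym same)) z
    go (inj₂ s) = inj₂ (s′ , *-cancelʳ-≡ (suc (x / t + y / t)) (n + n) t (≡.trans (cong (_+ (x / t + y / t) * t) (≡.sym s′)) total))
      where s′ = ≡.trans (cong (_+ y % t) (≡.sym same)) s

  balanced⇒symmetric : N 0 ≡ n → Balanced class t n → SymmetricBeads m (betaSet m ρ)
  balanced⇒symmetric N₀ bal = record { centre = centre ; bound = bound ; excl = excl ; cover = cover }
    where
    m≡ : m ≡ n * t
    m≡ = ℕₚ.*-comm t n
    pair : ∀ {i j} → i < t → j < t → i + j ≡ t → N i + N j ≡ n + n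
    pair {i} {j} i<t j<t eq = subst (λ z → N i + N z ≡ n + n) (≡.trans (cong (_∸ i) (≡.sym eq)) (m+n∸m≡n i j)) (bal i 1≤i i<t)
      where
      1≤i : 1 ≤ i
      1≤i = n≢0⇒n>0 λ { ≡.refl → <⇒≢ j<t eq }
    N≤2n : ∀ i → i < t → N i ≤ n + n
    N≤2n zero    i<t = ≤-trans (≤-reflexive N₀) (m≤m+n n n)
    N≤2n (suc i) i<t = ≤-trans (m≤m+n (N (suc i)) (N (t ∸ suc i))) (≤-reflexive (bal (suc i) (s≤s z≤n) i<t))
    centre : m ∉ betaSet m ρ
    centre m∈ = n≮n n (subst (n <_) N₀ (bead-at⁻ n (s≤s z≤n) (subst (_∈ betaSet m ρ) m≡ m∈)))
    bound : ∀ {x} → x ∈ betaSet m ρ → x ≤ m + m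
    bound {x} x∈ = ≤-trans (≤-reflexive (DivMod.m≡m%n+[m/n]*n x t)) (≤-trans (+-monoˡ-≤ ((x / t) * t) (<⇒≤ (DivMod.m%n<n x t)))
      (≤-trans (*-monoˡ-≤ t (<-≤-trans (bead⁻ x∈) (N≤2n (x % t) (DivMod.m%n<n x t))))
        (≤-reflexive (≡.trans (*-distribʳ-+ t n n) (cong₂ _+_ (ℕₚ.*-comm n t) (ℕₚ.*-comm n t))))))
    excl : ∀ {x y} → x + y ≡ m + m → x ∈ betaSet m ρ → y ∈ betaSet m ρ → ⊥
    excl {x} {y} eq x∈ y∈ with mirrored-residues x y eq
    ... | inj₁ (rx , ry , q) = <⇒≢ (+-mono-< (at rx x∈) (at ry y∈)) q
      where
      at : ∀ {z} → z % t ≡ 0 → z ∈ betaSet m ρ → z / t < n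
      at {z} r z∈ = subst (z / t <_) (≡.trans (cong N r) N₀) (bead⁻ z∈)
    ... | inj₂ (r , q) = n≮n _ (subst (_≤ suc (x / t + y / t)) (cong suc (+-suc (x / t) (y / t)))
            (≤-trans (+-mono-≤ (bead⁻ x∈) (bead⁻ y∈)) (≤-reflexive (≡.trans (pair (DivMod.m%n<n x t) (DivMod.m%n<n y t) r) (≡.sym q)))))
    cover : ∀ {x y} → x + y ≡ m + m → x ≢ m → x ∈ betaSet m ρ ⊎ y ∈ betaSet m ρ
    cover {x} {y} eq x≢m with mirrored-residues x y eq
    ... | inj₁ (rx , ry , q) = side (<-cmp (x / t) n)
      where
      at : ∀ {z} → z % t ≡ 0 → z / t < n → z ∈ betaSet m ρ
      at {z} r lt = bead⁺ z (subst (z / t <_) (≡.sym (≡.trans (cong N r) N₀)) lt)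
      side : Tri (x / t < n) (x / t ≡ n) (n < x / t) → x ∈ betaSet m ρ ⊎ y ∈ betaSet m ρ
      side (tri< lt _ _) = inj₁ (at rx lt)
      side (tri≈ _ e _)  = contradiction (≡.trans (DivMod.m≡m%n+[m/n]*n x t) (≡.trans (cong₂ (λ p q → p + q * t) rx e) (≡.sym m≡))) x≢m
      side (tri> _ _ gt) = inj₂ (at ry (≰⇒> λ n≤y → <⇒≢ (+-mono-<-≤ gt n≤y) (≡.sym q)))
    ... | inj₂ (r , q) with x / t ℕₚ.<? N (x % t)
    ...   | yes lt = inj₁ (bead⁺ x lt)
    ...   | no ≮N  = inj₂ (bead⁺ y (≰⇒> λ N≤y → <⇒≢ (≤-trans (s≤s (+-mono-≤ (≮⇒≥ ≮N) N≤y)) (≤-reflexive q)) (pair (DivMod.m%n<n x t) (DivMod.m%n<n y t) r)))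

  count-multiples : ∀ {i} → i < t → ∀ M → length (filterᵇ (m ≤ᵇ_) (ClosedClass.multiples w i M)) ≡ M ∸ n
  count-multiples i<t zero = ≡.sym (0∸n≡0 n)
  count-multiples {i} i<t (suc M) with n ℕₚ.≤? M
  ... | yes n≤M rewrite ≤⇒≤ᵇ≡true (≤-trans (≤-trans (≤-reflexive (ℕₚ.*-comm t n)) (*-monoˡ-≤ t n≤M)) (m≤n+m (M * t) i)) =
    ≡.trans (cong suc (count-multiples i<t M)) (≡.sym (+-∸-assoc 1 n≤M))
  ... | no n≰M rewrite ≰⇒≤ᵇ≡false {m} {i + M * t} (<⇒≱ (<-≤-trans (+-monoˡ-< (M * t) i<t)
                 (≤-trans (*-monoˡ-≤ t (≰⇒> n≰M)) (≤-reflexive (ℕₚ.*-comm n t))))) =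
    ≡.trans (count-multiples i<t M) (≡.trans (m≤n⇒m∸n≡0 (<⇒≤ (≰⇒> n≰M))) (≡.sym (m≤n⇒m∸n≡0 (≰⇒> n≰M))))

  -- A beta number is at least `m` exactly in the rows with j < ρ_j, which are the first `rank ρ`
  -- rows. Class i of a closed bead set consists of the i + k t with k < N i, and those with k ≥ n
  -- are the ones not below m = n t.
  rank-sum : length ρ ≤ m → rank ρ ≡ sum (cat (λ i → (N i ∸ n) ∷ []) 0 t)
  rank-sum ρ≤m = begin
    rank ρ
      ≡⟨ sumTo-below (rank ρ) m rank≤m (λ j j<r → in-range (rank<m j<r) (rank⁻ l j<r)) (λ j r≤j j<m → out-of-range j<m (λ lt → <⇒≱ (rank⁺ l lt) r≤j)) ⟨
    sumTo (λ j → if m ≤ᵇ beta j then 1 else 0) m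
      ≡⟨ count-sumTo (m ≤ᵇ_) beta m ⟨
    length (filterᵇ (m ≤ᵇ_) (betaSet m ρ))
      ≡⟨ length-filterᵇ-↭ (m ≤ᵇ_) betaSet-classes ⟨
    length (filterᵇ (m ≤ᵇ_) (cat class 0 t))
      ≡⟨ count-cat 0 t ≤-refl ⟩
    sum (cat (λ i → (N i ∸ n) ∷ []) 0 t) ∎
    where
    open ≡-Reasoning
    open Gaps m l ρ≤m using (rank<m; beta-complement)
    rank≤m : rank ρ ≤ m
    rank≤m = ≮⇒≥ λ lt → n≮n m (rank<m lt)
    in-range : ∀ {j} → j < m → j < part ρ j → (if m ≤ᵇ beta j then 1 else 0) ≡ 1
    in-range {j} j<m lt rewrite ≤⇒≤ᵇ≡true {m} {beta j} (+-cancelʳ-≤ (suc j) m (beta j) (subst (m + suc j ≤_) (≡.trans (ℕₚ.+-comm m (part ρ j)) (≡.sym (beta-complement j<m))) (+-monoʳ-≤ m lt))) = ≡.refl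
    out-of-range : ∀ {j} → j < m → ¬ (j < part ρ j) → (if m ≤ᵇ beta j then 1 else 0) ≡ 0
    out-of-range {j} j<m nlt rewrite ≰⇒≤ᵇ≡false {m} {beta j} (λ le → nlt (+-cancelʳ-≤ m (suc j) (part ρ j)
      (subst₂ _≤_ (ℕₚ.+-comm m (suc j)) (beta-complement j<m) (+-monoˡ-≤ (suc j) le)))) = ≡.refl
    sumTo-below : ∀ {f : ℕ → ℕ} r m → r ≤ m → (∀ j → j < r → f j ≡ 1) → (∀ j → r ≤ j → j < m → f j ≡ 0) → sumTo f m ≡ r
    sumTo-below r zero    r≤m one nil = ≡.sym (n≤0⇒n≡0 r≤m)
    sumTo-below r (suc m) r≤m one nil with m≤n⇒m<n∨m≡n r≤m
    ... | inj₁ r<1+m = ≡.trans (cong₂ _+_ (sumTo-below r m (≤-pred r<1+m) one (λ j r≤j j<m → nil j r≤j (m<n⇒m<1+n j<m)))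
                                          (nil m (≤-pred r<1+m) (n<1+n m))) (ℕₚ.+-identityʳ r)
    ... | inj₂ ≡.refl = ≡.trans (cong₂ _+_ (sumTo-below m m ≤-refl (λ j j<m → one j (m<n⇒m<1+n j<m)) (λ j m≤j j<m → contradiction j<m (≤⇒≯ m≤j)))
                                           (one m (n<1+n m))) (ℕₚ.+-comm m 1)
    count-cat : ∀ lo k → lo + k ≤ t → length (filterᵇ (m ≤ᵇ_) (cat class lo k)) ≡ sum (cat (λ i → (N i ∸ n) ∷ []) lo k)
    count-cat lo zero    le = ≡.refl
    count-cat lo (suc k) le = ≡.trans (cong length (Listₚ.filter-++ (λ x → T? (m ≤ᵇ x)) (class lo) (cat class (suc lo) k)))
      (≡.trans (Listₚ.length-++ (filterᵇ (m ≤ᵇ_) (class lo)))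
        (cong₂ _+_ (≡.trans (cong (length ∘ filterᵇ (m ≤ᵇ_)) (class-multiples lo)) (count-multiples (<-≤-trans (m<m+n lo (s≤s z≤n)) le) (N lo)))
                   (count-cat (suc lo) k (subst (_≤ t) (+-suc lo k) le))))

-- Parities of the sign exponents

upperSum : (ℕ → ℕ) → ℕ → ℕ → ℕ → ℕ
upperSum f t lo zero    = 0
upperSum f t lo (suc k) = f (t ∸ lo) + upperSum f t (suc lo) k

-- For L + H = 2n the truncated differences add up to |H - n|, and |H - n| + 2 min(H, n) = H + n;
-- this gives the witness. In the application the sum on the left is the rank of the core.
excess-parity : ∀ {a} {A : Set a} (b : ℕ → List A) t n e → Balanced b t n → e ≤ 1 → ∀ lo k → 1 ≤ lo → lo + lo + width e k ≡ suc t →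
  ∃ λ z → sum (paired (λ i → (length (b i) ∸ n) ∷ []) t id e lo k) + (z + z) ≡ upperSum (length ∘ b) t lo k + k * n
excess-parity b t n .0 bal z≤n       lo zero 1≤lo eq = 0 , ≡.refl
excess-parity b t n .1 bal (s≤s z≤n) lo zero 1≤lo eq = 0 , ≡.trans (cong (λ z → z ∸ n + 0 + 0) len) (cong (λ z → z + 0 + 0) (n∸n≡0 n))
  where
  len : length (b lo) ≡ n
  len = ≡.trans (cong length (≡.sym (Listₚ.++-identityʳ (b lo)))) (≡.trans (length-cat b t 1 n bal (s≤s z≤n) lo 0 1≤lo eq) (ℕₚ.*-identityʳ n))
excess-parity b t n e bal e≤1 lo (suc k) 1≤lo eq with excess-parity b t n e bal e≤1 (suc lo) k (s≤s z≤n) (next b t e lo k eq)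
... | z , ih = ℕ._⊓_ H n + z , (begin
  (L ∸ n) + ((H ∸ n) + P) + (H ℕ.⊓ n + z + (H ℕ.⊓ n + z))
    ≡⟨ lemma₁ (L ∸ n) (H ∸ n) P (H ℕ.⊓ n) z ⟩
  ((L ∸ n) + (H ∸ n) + (H ℕ.⊓ n + H ℕ.⊓ n)) + (P + (z + z))
    ≡⟨ cong₂ _+_ (split L H (bal lo 1≤lo (proj₂ (upper-index b t lo (width e k) eq)))) ih ⟩
  (H + n) + (U + k * n)
    ≡⟨ lemma₂ H n U (k * n) ⟩
  H + U + (n + k * n) ∎)
  where
  open ≡-Reasoning
  L = length (b lo)
  H = length (b (t ∸ lo))
  P = sum (paired (λ i → (length (b i) ∸ n) ∷ []) t id e (suc lo) k)
  U = upperSum (length ∘ b) t (suc lo) k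
  lemma₁ : ∀ l h p m z → l + (h + p) + (m + z + (m + z)) ≡ (l + h + (m + m)) + (p + (z + z))
  lemma₁ = solve-∀
  lemma₂ : ∀ h n u k → (h + n) + (u + k) ≡ h + u + (n + k)
  lemma₂ = solve-∀
  opposite : ∀ L H → L + H ≡ n + n → n ≤ H → L ≤ n
  opposite L H eq n≤H = +-cancelʳ-≤ n L n (≤-trans (+-monoʳ-≤ L n≤H) (≤-reflexive eq))
  split : ∀ L H → L + H ≡ n + n → (L ∸ n) + (H ∸ n) + (H ℕ.⊓ n + H ℕ.⊓ n) ≡ H + n
  split L H eq with ≤-total H n
  ... | inj₁ H≤n rewrite m≤n⇒m∸n≡0 H≤n | m≤n⇒m⊓n≡m H≤n = +-cancelʳ-≡ n _ _ (≡.trans (lemma (L ∸ n) H n) (≡.trans (cong (_+ (H + H)) (m∸n+n≡m n≤L)) (≡.trans (lemma′ L H) (≡.trans (cong (_+ H) eq) (lemma″ n H)))))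
    where
    n≤L : n ≤ L
    n≤L = +-cancelʳ-≤ n n L (≤-trans (≤-reflexive (≡.sym eq)) (+-monoʳ-≤ L H≤n))
    lemma : ∀ d h n → d + 0 + (h + h) + n ≡ d + n + (h + h)
    lemma = solve-∀
    lemma′ : ∀ l h → l + (h + h) ≡ l + h + h
    lemma′ = solve-∀
    lemma″ : ∀ n h → n + n + h ≡ h + n + n
    lemma″ = solve-∀
  ... | inj₂ n≤H rewrite m≥n⇒m⊓n≡n n≤H | m≤n⇒m∸n≡0 (opposite L H eq n≤H) = ≡.trans (≡.sym (ℕₚ.+-assoc (H ∸ n) n n)) (cong (_+ n) (m∸n+n≡m n≤H))

width-sum : ∀ e k → width e k ≡ e + (k + k)
width-sum e zero    = ≡.sym (ℕₚ.+-identityʳ e)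
width-sum e (suc k) = ≡.trans (cong (suc ∘ suc) (width-sum e k)) (lemma e k)
  where
  lemma : ∀ e k → suc (suc (e + (k + k))) ≡ e + (suc k + suc k)
  lemma = solve-∀

-- Since width e k = e + 2k, crossing the 2k paired blocks costs no sign. For even `t` the block of
-- t/2 remains and contributes n · n_(t-i), the origin of the term n r in ε.
pairingSign-parity : ∀ {a} {A : Set a} (b : ℕ → List A) t n e lo k →
  ∃ λ z → pairingSign b t n e lo k ≡ upperSum (triangle ∘ length ∘ b) t lo k + e * (n * upperSum (length ∘ b) t lo k) + (z + z)
pairingSign-parity b t n e lo zero = 0 , ≡.sym (≡.trans (ℕₚ.+-identityʳ (e * (n * 0))) (≡.trans (cong (e *_) (*-zeroʳ n)) (*-zeroʳ e)))
pairingSign-parity b t n e lo (suc k) with pairingSign-parity b t n e (suc lo) k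
... | z , ih = n * k * H + z , ≡.trans (cong₂ (λ p q → n * p * H + (triangle H + q)) (width-sum e k) ih)
    (lemma n e k H (triangle H) (upperSum (triangle ∘ length ∘ b) t (suc lo) k) (upperSum (length ∘ b) t (suc lo) k) z)
  where
  H = length (b (t ∸ lo))
  lemma : ∀ n e k H τ T S z → n * (e + (k + k)) * H + (τ + (T + e * (n * S) + (z + z))) ≡
          τ + T + e * (n * (H + S)) + (n * k * H + z + (n * k * H + z))
  lemma = solve-∀

range : ℕ → ℕ → List ℕ
range lo zero    = []
range lo (suc k) = lo ∷ range (suc lo) k

applyUpTo-range : ∀ lo k → applyUpTo (λ i → lo + i) k ≡ range lo k
applyUpTo-range lo k = go (λ i → lo + i) lo k (λ _ → ≡.refl)
  where
  go : ∀ (f : ℕ → ℕ) lo k → (∀ i → f i ≡ lo + i) → applyUpTo f k ≡ range lo k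
  go f lo zero    e = ≡.refl
  go f lo (suc k) e = cong₂ _∷_ (≡.trans (e 0) (ℕₚ.+-identityʳ lo)) (go (f ∘ suc) (suc lo) k (λ i → ≡.trans (e (suc i)) (+-suc lo i)))

decreasing-last : ∀ {L x} → Decreasing L → x ∈ L → ∀ {k} → length L ≡ suc k → part L k ≤ x
decreasing-last {a ∷ []}     d        (here ≡.refl) {zero} _  = ≤-refl
decreasing-last {a ∷ b ∷ L}  (gt ∷ d) (here ≡.refl) {suc k} eq =
  ≤-trans (decreasing-last d (here ≡.refl) {k} (suc-injective eq)) (<⇒≤ (All.lookup gt (here ≡.refl)))
decreasing-last {a ∷ b ∷ L}  (gt ∷ d) (there x∈)    {suc k} eq = decreasing-last d x∈ {k} (suc-injective eq)

nC2-triangle : ∀ n → n C 2 ≡ triangle n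
nC2-triangle zero    = ≡.refl
nC2-triangle (suc n) = ≡.trans (≡.sym (nCk+nC[k+1]≡[n+1]C[k+1] n 1))
  (≡.trans (cong₂ _+_ (nC1≡n n) (nC2-triangle n)) (ℕₚ.+-comm n (triangle n)))

-- The binomial coefficient is h(2h + 1) = h + 2h².
triangle-odd : ∀ h → ∃ λ z → triangle (suc (h + h)) ≡ h + (z + z)
triangle-odd zero    = 0 , ≡.refl
triangle-odd (suc h) with triangle-odd h
... | z , eq rewrite +-suc h h = z + h + h + 1 , ≡.trans (cong (λ s → s + suc (h + h) + suc (suc (h + h))) eq) (lemma h z)
  where
  lemma : ∀ h z → h + (z + z) + suc (h + h) + suc (suc (h + h)) ≡ suc h + (z + h + h + 1 + (z + h + h + 1))
  lemma = solve-∀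

double-triangle : ∀ n → triangle (suc n) + triangle (suc n) ≡ n * suc n
double-triangle zero    = ≡.refl
double-triangle (suc n) = ≡.trans (lemma (triangle (suc n)) n) (≡.trans (cong (_+ (suc n + suc n)) (double-triangle n)) (lemma′ n))
  where
  lemma : ∀ τ n → τ + suc n + (τ + suc n) ≡ τ + τ + (suc n + suc n)
  lemma = solve-∀
  lemma′ : ∀ n → n * suc n + (suc n + suc n) ≡ suc n * suc (suc n)
  lemma′ = solve-∀

half-double : ∀ {x} y → x ≡ y + y → x / 2 ≡ y
half-double y ≡.refl = ≡.trans (cong (_/ 2) (lemma y)) (DivMod.m*n/n≡m y 2)
  where
  lemma : ∀ y → y + y ≡ y * 2
  lemma = solve-∀

half-double+1 : ∀ {x} y → x ≡ suc (y + y) → x / 2 ≡ y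
half-double+1 y ≡.refl = ≡.trans (cong (_/ 2) (lemma y)) (quotient-unique 1 {1} y (s≤s (s≤s z≤n)))
  where
  lemma : ∀ y → suc (y + y) ≡ 1 + y * 2
  lemma = solve-∀

isEven-odd : ∀ h → isEven (suc (width 0 h)) ≡ false
isEven-odd h = cong (_≡ᵇ 0) (≡.trans (cong (_% 2) (≡.trans (cong suc (width-sum 0 h)) (lemma h))) (residue-unique 1 {1} h (s≤s (s≤s z≤n))))
  where
  lemma : ∀ h → suc (h + h) ≡ 1 + h * 2
  lemma = solve-∀

isEven-even : ∀ h → isEven (suc (width 1 h)) ≡ true
isEven-even h = cong (_≡ᵇ 0) (≡.trans (cong (_% 2) (≡.trans (cong suc (width-sum 1 h)) (lemma h))) (DivMod.m*n%n≡0 (suc h) 2))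
  where
  lemma : ∀ h → suc (1 + (h + h)) ≡ suc h * 2
  lemma = solve-∀

parity-form : ∀ w → ∃ λ e → ∃ λ h → e ≤ 1 × w ≡ width e h
parity-form zero          = 0 , 0 , z≤n , ≡.refl
parity-form (suc zero)    = 1 , 0 , s≤s z≤n , ≡.refl
parity-form (suc (suc w)) with parity-form w
... | e , h , e≤1 , eq = e , suc h , e≤1 , cong (suc ∘ suc) eq

half-width : ∀ {e} h → e ≤ 1 → width e h / 2 ≡ h
half-width h z≤n       = half-double h (width-sum 0 h)
half-width h (s≤s z≤n) = half-double+1 h (width-sum 1 h)

upperSum-constant : ∀ f t {a} → (∀ i → i < t → f i ≡ a) → 1 ≤ t → ∀ lo k → 1 ≤ lo → upperSum f t lo k ≡ k * a
upperSum-constant f t e 1≤t lo zero    1≤lo = ≡.refl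
upperSum-constant f (suc w) e 1≤t (suc lo) (suc k) 1≤lo =
  cong₂ _+_ (e (w ∸ lo) (s≤s (m∸n≤m w lo))) (upperSum-constant f (suc w) e 1≤t (suc (suc lo)) k (s≤s z≤n))

sum-upTo : ∀ (f : ℕ → ℕ) m → sum (map f (upTo m)) ≡ sumTo f m
sum-upTo f m rewrite Listₚ.map-upTo f m = go f m
  where
  go : ∀ f m → sum (applyUpTo f m) ≡ sumTo f m
  go f zero    = ≡.refl
  go f (suc m) = ≡.trans (cong (f 0 +_) (go (f ∘ suc) m)) (≡.sym (sumTo-suc f m))

filterᵇ-≤-upTo : ∀ a h → filterᵇ (a ≤ᵇ_) (upTo (a + h)) ≡ map (λ i → a + i) (upTo h)
filterᵇ-≤-upTo a h = begin
  filterᵇ (a ≤ᵇ_) (upTo (a + h))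
    ≡⟨ cong (filterᵇ (a ≤ᵇ_)) (≡.trans (≡.sym (Listₚ.map-id _)) (map-upTo-+ id a h)) ⟩
  filterᵇ (a ≤ᵇ_) (map id (upTo a) ++ map (λ i → a + i) (upTo h))
    ≡⟨ Listₚ.filter-++ (λ x → T? (a ≤ᵇ x)) (map id (upTo a)) _ ⟩
  filterᵇ (a ≤ᵇ_) (map id (upTo a)) ++ filterᵇ (a ≤ᵇ_) (map (λ i → a + i) (upTo h))
    ≡⟨ cong₂ _++_ (Listₚ.filter-none (λ x → T? (a ≤ᵇ x)) (Allₚ.map⁺ (All.map (λ i<a le → <⇒≱ i<a (≤ᵇ⇒≤ _ _ le)) (Allₚ.all-upTo a))))
                  (Listₚ.filter-all (λ x → T? (a ≤ᵇ x)) (Allₚ.map⁺ (All.universal (λ i → ≤⇒≤ᵇ (m≤m+n a i)) _))) ⟩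
  map (λ i → a + i) (upTo h) ∎
  where open ≡-Reasoning

upperSum-sumTo : ∀ g a h lo k → lo + k ≡ suc h → upperSum g (a + h) lo k ≡ sumTo (λ i → g (a + i)) k
upperSum-sumTo g a h lo zero    eq = ≡.refl
upperSum-sumTo g a h lo (suc k) eq = ≡.trans (cong₂ _+_ (cong g index) (upperSum-sumTo g a h (suc lo) k (≡.trans (≡.sym (+-suc lo k)) eq)))
  (ℕₚ.+-comm (g (a + k)) _)
  where
  index : a + h ∸ lo ≡ a + k
  index = ≡.trans (cong (λ z → a + z ∸ lo) (≡.sym (suc-injective (≡.trans (≡.sym (+-suc lo k)) eq))))
    (≡.trans (cong (_∸ lo) (lemma a lo k)) (m+n∸m≡n lo (a + k)))
    where
    lemma : ∀ a lo k → a + (lo + k) ≡ lo + (a + k)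
    lemma = solve-∀

-- The bound ⌊(t + 2)/2⌋ equals h + 1 + e, which leaves the `h` residues above t/2: the upper
-- members of the pairs.
binomial-sum : ∀ e h → e ≤ 1 → ∀ (N : ℕ → ℕ) → let t = suc (width e h) in
  sum (map (λ i → N i C 2) (filterᵇ (λ i → ((t + 2) / 2) ≤ᵇ i) (upTo t))) ≡ upperSum (triangle ∘ N) t 1 h
binomial-sum e h e≤1 N = begin
  sum (map (λ i → N i C 2) (filterᵇ (λ i → ((t + 2) / 2) ≤ᵇ i) (upTo t)))
    ≡⟨ cong₂ (λ p q → sum (map (λ i → N i C 2) (filterᵇ (λ i → p ≤ᵇ i) (upTo q)))) (half e≤1) t≡ ⟩
  sum (map (λ i → N i C 2) (filterᵇ (a ≤ᵇ_) (upTo (a + h))))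
    ≡⟨ cong (λ z → sum (map (λ i → N i C 2) z)) (filterᵇ-≤-upTo a h) ⟩
  sum (map (λ i → N i C 2) (map (λ i → a + i) (upTo h)))
    ≡⟨ cong sum (≡.trans (≡.sym (Listₚ.map-∘ (upTo h))) (Listₚ.map-cong (λ i → nC2-triangle (N (a + i))) (upTo h))) ⟩
  sum (map (λ i → triangle (N (a + i))) (upTo h))
    ≡⟨ sum-upTo _ h ⟩
  sumTo (λ i → triangle (N (a + i))) h
    ≡⟨ upperSum-sumTo (triangle ∘ N) a h 1 h ≡.refl ⟨
  upperSum (triangle ∘ N) (a + h) 1 h
    ≡⟨ cong (λ z → upperSum (triangle ∘ N) z 1 h) t≡ ⟨
  upperSum (triangle ∘ N) t 1 h ∎
  where
  open ≡-Reasoning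
  t = suc (width e h)
  a = suc h + e
  t≡ : t ≡ a + h
  t≡ = ≡.trans (cong suc (width-sum e h)) (lemma e h)
    where
    lemma : ∀ e h → suc (e + (h + h)) ≡ suc h + e + h
    lemma = solve-∀
  half : ∀ {e} → e ≤ 1 → (suc (width e h) + 2) / 2 ≡ suc h + e
  half z≤n       = half-double+1 (suc h + 0) (≡.trans (cong (λ z → suc z + 2) (width-sum 0 h)) (lemma h))
    where
    lemma : ∀ h → suc (h + h) + 2 ≡ suc (suc h + 0 + (suc h + 0))
    lemma = solve-∀
  half (s≤s z≤n) = half-double (suc h + 1) (≡.trans (cong (λ z → suc z + 2) (width-sum 1 h)) (lemma h))
    where
    lemma : ∀ h → suc (1 + (h + h)) + 2 ≡ suc h + 1 + (suc h + 1)
    lemma = solve-∀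

-- The empty partition, which supplies the denominators

module EmptyPartition (w n : ℕ) where
  private
    m = suc w * n
    t = suc w
  open BetaSets m []

  ∈-empty⁻ : ∀ {x} → x ∈ betaSet m [] → x < m
  ∈-empty⁻ x∈ with ∈-betaSet⁻ x∈
  ... | j , j<m , ≡.refl = ∸-monoʳ-< (s≤s z≤n) j<m

  ∈-empty⁺ : ∀ {x} → x < m → x ∈ betaSet m []
  ∈-empty⁺ {x} x<m = subst (_∈ betaSet m []) eq (∈-betaSet⁺ (∸-monoʳ-< {m} (s≤s z≤n) x<m))
    where
    eq : m ∸ suc (m ∸ suc x) ≡ x
    eq = ≡.trans (cong (m ∸_) (≡.sym (+-∸-assoc 1 x<m))) (m∸[m∸n]≡n (<⇒≤ x<m))

  closed : ∀ {x} → x + t ∈ betaSet m [] → x ∈ betaSet m []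
  closed {x} x+t∈ = ∈-empty⁺ (≤-<-trans (m≤m+n x t) (∈-empty⁻ x+t∈))

  open ClosedBeads w n [] [] closed public using (N; class-multiples; bead-at⁺; bead-at⁻)

  N-empty : ∀ i → i < t → N i ≡ n
  N-empty i i<t = ≤-antisym
    (≮⇒≥ (λ n<N → <⇒≱ (∈-empty⁻ (bead-at⁺ n i<t n<N)) (≤-trans (≤-reflexive (ℕₚ.*-comm t n)) (m≤n+m (n * t) i))))
    (≮⇒≥ (λ N<n → n≮n (N i) (bead-at⁻ (N i) i<t (∈-empty⁺ (<-≤-trans (+-monoˡ-< (N i * t) i<t)
      (≤-trans (*-monoˡ-≤ t N<n) (≤-reflexive (ℕₚ.*-comm n t))))))))

  class-empty : ∀ i → i < t → betaRes m t [] i ≡ map (λ k → i + k * t) (downFrom n)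
  class-empty i i<t = ≡.trans (class-multiples i) (cong (λ z → map (λ k → i + k * t) (downFrom z)) (N-empty i i<t))

  quot-empty : ∀ i → i < t → ∀ j → part (quot m t [] i) j ≡ 0
  quot-empty i i<t j with j ℕₚ.<? N i
  ... | no j≮N = part-beyond (quot m t [] i) (≤-trans (≤-reflexive (Residues.length-quot w [] i)) (≮⇒≥ j≮N))
  ... | yes j<N = +-cancelʳ-≡ (N i ∸ suc j) _ 0 (≡.trans (Residues.part-quot w [] i j<N)
      (≡.trans (cong (λ z → part z j / t) (class-multiples i)) (≡.trans (cong (_/ t) (multiple (N i) j<N)) (quotient-unique w (N i ∸ suc j) i<t))))
    where
    multiple : ∀ M {j} → j < M → part (map (λ k → i + k * t) (downFrom M)) j ≡ i + (M ∸ suc j) * t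
    multiple (suc M) {zero}  lt       = ≡.refl
    multiple (suc M) {suc j} (s≤s lt) = multiple M lt

  betaSet-empty : betaSet m [] ≡ map id (downFrom (n * t))
  betaSet-empty = ≡.trans (Listₚ.map-upTo (λ j → m ∸ suc j) m) (≡.trans (go m) (≡.trans (cong downFrom (ℕₚ.*-comm t n)) (≡.sym (Listₚ.map-id _))))
    where
    go : ∀ m → applyUpTo (λ j → m ∸ suc j) m ≡ downFrom m
    go zero    = ≡.refl
    go (suc m) = cong (m ∷_) (go m)

  balanced-empty : Balanced (betaRes m t []) t n
  balanced-empty i 1≤i i<t = cong₂ _+_ (N-empty i i<t) (N-empty (t ∸ i) (∸-monoʳ-< 1≤i (<⇒≤ i<t)))

cat-cong : ∀ {a} {A : Set a} (b c : ℕ → List A) lo k → (∀ i → i < lo + k → b i ≡ c i) → cat b lo k ≡ cat c lo k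
cat-cong b c lo zero    e = ≡.refl
cat-cong b c lo (suc k) e = cong₂ _++_ (e lo (m<m+n lo (s≤s z≤n))) (cat-cong b c (suc lo) k (λ i lt → e i (subst (i <_) (≡.sym (+-suc lo k)) lt)))

-- Value of the transformed numerator

module SpecializedValues {c ℓ} (K : Field c ℓ) (e h n : ℕ) (ω : Field.Carrier K)
  (ω-root : Field._≈_ K (FieldDefs.pow K ω (suc (width e h))) (Field.1# K))
  (X : Fin n → Field.Carrier K) (X≉0 : ∀ b → ¬ (Field._≈_ K (X b) (Field.0# K)))
  (e≤1 : e ≤ 1) (ρ : List ℕ) (ρ-sorted : Sorted ρ)
  (N₀ : nRes (suc (width e h) * n) (suc (width e h)) ρ 0 ≡ n)
  (bal : Balanced (betaRes (suc (width e h) * n) (suc (width e h)) ρ) (suc (width e h)) n) where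
  open BlockFactorization K e h n ω ω-root X X≉0 e≤1 ρ ρ-sorted public

  sNumAt : ℕ → Carrier
  sNumAt i = sNum (n + n) (mu2 t n ρ i) (powInvVars n t X)

  -- For odd `t` an empty determinant, that is 1; for even `t` and lo = h + 1 the block of the
  -- residue t/2.
  tailBlock : ℕ → Carrier
  tailBlock lo = Det B (cat rowBlock lo e) (cat class lo e)

  blockProduct-value : ∀ lo k → 1 ≤ lo → lo + lo + width e k ≡ suc t →
                       blockProduct lo k ≈ prodOver sNumAt (range lo k) *ᴷ tailBlock (lo + k)
  blockProduct-value lo zero    1≤lo eq = sym (trans (*-identityˡ _) (reflexive (cong tailBlock (ℕₚ.+-identityʳ lo))))
  blockProduct-value lo (suc k) 1≤lo eq = begin
    Det B (pairRows lo) (pairColumns lo) *ᴷ blockProduct (suc lo) k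
      ≈⟨ *-cong (PairBlock.pair-block lo 1≤lo 2lo<t (bal lo 1≤lo (proj₂ up))) (blockProduct-value (suc lo) k (s≤s z≤n) (next class t e lo k eq)) ⟩
    sNumAt lo *ᴷ (prodOver sNumAt (range (suc lo) k) *ᴷ tailBlock (suc lo + k))
      ≈⟨ sym (*-assoc _ _ _) ⟩
    prodOver sNumAt (range lo (suc k)) *ᴷ tailBlock (suc lo + k)
      ≡⟨ cong (λ z → prodOver sNumAt (range lo (suc k)) *ᴷ tailBlock z) (≡.sym (+-suc lo k)) ⟩
    prodOver sNumAt (range lo (suc k)) *ᴷ tailBlock (lo + suc k) ∎
    where
    up = upper-index class t lo (width e k) eq
    2lo<t : lo + lo < t
    2lo<t = ≤-pred (subst (suc (suc (lo + lo)) ≤_) eq (≤-trans (≤-reflexive (ℕₚ.+-comm 2 (lo + lo))) (+-monoʳ-≤ (lo + lo) (s≤s (s≤s z≤n)))))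

  value : Carrier
  value = oNum n (seqOf n (quotient 0)) (powVars n t X) *ᴷ (prodOver sNumAt (range 1 h) *ᴷ tailBlock (suc h))

  D-value : D (cat class 0 t) ≈ signR (pairingSign class t n e 1 h) *ᴷ value
  D-value = trans
    (pair-blocks (antisymmetric-prefix D-antisymmetric (class 0)) class t n e bal e≤1 1 h (s≤s z≤n) ≡.refl)
    (*-congˡ (trans D-factor (*-cong (zero-block N₀) (blockProduct-value 1 h (s≤s z≤n) ≡.refl))))

  D-sorted : D (betaSet (t * n) ρ) ≈ signR (inversions (sigmaList (t * n) t ρ)) *ᴷ D (cat class 0 t)
  D-sorted = sym (begin
    signR (inversions σ) *ᴷ D (cat class 0 t)
      ≡⟨ cong (λ z → signR (inversions σ) *ᴷ D z) (≡.sym map-sigma) ⟩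
    signR (inversions σ) *ᴷ D (map (part (betaSet (t * n) ρ)) σ)
      ≈⟨ sort-sign (antisymmetric-map D-antisymmetric (part (betaSet (t * n) ρ))) sigma-permutation ⟩
    signR (inversions (upTo (t * n))) *ᴷ D (map (part (betaSet (t * n) ρ)) (upTo (t * n)))
      ≡⟨ cong₂ (λ p q → signR p *ᴷ D q) (inversions-increasing id id (t * n)) upTo-betaSet ⟩
    1# *ᴷ D (betaSet (t * n) ρ)
      ≈⟨ *-identityˡ _ ⟩
    D (betaSet (t * n) ρ) ∎)
    where σ = sigmaList (t * n) t ρ

-- Signs and the character formula

if-same : ∀ {a} {A : Set a} b {x y z : A} → x ≡ z → y ≡ z → (if b then x else y) ≡ z
if-same true  p q = p
if-same false p q = q

module Signs {c ℓ} (K : Field c ℓ) where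
  open Powers K public

  signZ-difference : ∀ a b → signZ (ℤ.- (pos a) ℤ.+ pos b) ≈ signR (a + b)
  signZ-difference a b = trans (reflexive (cong signZ (ℤₚ.-m+n≡n⊖m a b))) (cases (≤-total a b))
    where
    lemma : ∀ d a → d + (a + a) ≡ a + (d + a)
    lemma = solve-∀
    cases : a ≤ b ⊎ b ≤ a → signZ (b ℤ.⊖ a) ≈ signR (a + b)
    cases (inj₁ a≤b) = trans (reflexive (cong signZ (ℤₚ.⊖-≥ a≤b)))
      (signR-parity (b ∸ a) (a + b) a 0 (≡.trans (lemma (b ∸ a) a) (≡.trans (cong (a +_) (m∸n+n≡m a≤b)) (≡.sym (ℕₚ.+-identityʳ _)))))
    cases (inj₂ b≤a) = trans (reflexive (cong signR (ℤₚ.∣⊖∣-≤ b≤a)))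
      (signR-parity (a ∸ b) (a + b) b 0 (≡.trans (lemma (a ∸ b) b) (≡.trans (cong (b +_) (m∸n+n≡m b≤a)) (≡.trans (ℕₚ.+-comm b a) (≡.sym (ℕₚ.+-identityʳ _))))))

  -- `p` and `p₀` are the pairing exponents of λ and of the empty partition, and
  -- `triangle t * triangle (suc n)` is the exponent of the sorting sign of the empty partition.
  -- Signs are their own inverses, so (-1)^ε being the quotient of these signs amounts to a
  -- comparison of parities.
  sign-identity : ∀ e h n → e ≤ 1 → ∀ ρ r p p₀ → let t = suc (width e h) ; N = nRes (t * n) t ρ in
    (∃ λ z → r + (z + z) ≡ upperSum N t 1 h + h * n) →
    (∃ λ z → p ≡ upperSum (triangle ∘ N) t 1 h + e * (n * upperSum N t 1 h) + (z + z)) →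
    (∃ λ z → p₀ ≡ h * triangle n + e * (n * (h * n)) + (z + z)) →
    signR p ≈ signZ (epsilon t n ρ r) *ᴷ (signR (triangle t * triangle (suc n)) *ᴷ signR p₀)
  sign-identity e h n e≤1 ρ r p p₀ (z₄ , r≡) (z₁ , p≡) (z₂ , p₀≡) = begin
    signR p
      ≈⟨ parity e≤1 p≡ p₀≡ ⟩
    signR ((Tλ + E) + (triangle t * triangle (suc n) + p₀))
      ≈⟨ trans (signR-+ (Tλ + E) _) (*-congˡ (signR-+ (triangle t * triangle (suc n)) p₀)) ⟩
    signR (Tλ + E) *ᴷ (signR (triangle t * triangle (suc n)) *ᴷ signR p₀)
      ≈⟨ *-congʳ (sym (trans (reflexive (cong signZ ε≡)) (signZ-difference Tλ E))) ⟩
    signZ (epsilon t n ρ r) *ᴷ (signR (triangle t * triangle (suc n)) *ᴷ signR p₀) ∎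
    where
    t = suc (width e h)
    N = nRes (t * n) t ρ
    Tλ = upperSum (triangle ∘ N) t 1 h
    S = upperSum N t 1 h
    -- The second part of ε with its division by 2 carried out, for t = 2h + 1 + e. For even `t`,
    -- n(n + t - 1)/2 = n(n + 1)/2 + n h.
    exponent : ℕ → ℕ
    exponent zero    = h * n
    exponent (suc _) = triangle (suc n) + n * h + n * r
    E = exponent e
    last-term : ∀ {e} → e ≤ 1 → let t = suc (width e h) in
                (if isEven t then pos ((n * (n + t ∸ 1)) / 2 + n * r) else pos (((t ∸ 1) * n) / 2)) ≡ pos (exponent e)
    last-term z≤n rewrite isEven-odd h = cong pos (half-double (h * n) (≡.trans (cong (_* n) (width-sum 0 h)) (*-distribʳ-+ n h h)))
    last-term (s≤s z≤n) rewrite isEven-even h = cong (λ z → pos (z + n * r)) (half-double (triangle (suc n) + n * h)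
      (≡.trans (cong (λ z → n * (z ∸ 1)) (≡.trans (+-suc n (width 1 h)) (cong (λ z → suc (n + z)) (width-sum 1 h))))
        (≡.trans (lemma n h) (≡.trans (cong (_+ (n * h + n * h)) (≡.sym (double-triangle n))) (lemma′ (triangle (suc n)) (n * h))))))
      where
      lemma : ∀ n h → n * (n + (1 + (h + h))) ≡ n * suc n + (n * h + n * h)
      lemma = solve-∀
      lemma′ : ∀ τ x → τ + τ + (x + x) ≡ τ + x + (τ + x)
      lemma′ = solve-∀
    ε≡ : epsilon t n ρ r ≡ ℤ.- (pos Tλ) ℤ.+ pos E
    ε≡ = cong₂ (λ x y → ℤ.- (pos x) ℤ.+ y) (binomial-sum e h e≤1 N) (last-term e≤1)
    parity : ∀ {e} → e ≤ 1 → p ≡ Tλ + e * (n * S) + (z₁ + z₁) → p₀ ≡ h * triangle n + e * (n * (h * n)) + (z₂ + z₂) →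
             signR p ≈ signR ((Tλ + exponent e) + (triangle (suc (width e h)) * triangle (suc n) + p₀))
    parity z≤n p≡ p₀≡ with triangle-odd h
    ... | z₃ , odd = signR-parity p (Tλ + h * n + (triangle (suc (width 0 h)) * (τ + n) + p₀)) k z₁
      (≡.trans (cong (_+ (k + k)) p≡) (≡.trans (lemma Tλ h n τ z₁ z₂ z₃)
        (≡.sym (cong₂ (λ x y → Tλ + h * n + (x * (τ + n) + y) + (z₁ + z₁)) (≡.trans (cong (triangle ∘ suc) (width-sum 0 h)) odd) p₀≡))))
      where
      τ = triangle n
      -- For odd `t` everything on the right except `Tλ` is even, and `k` is half of it.
      k = h * n + h * τ + z₃ * (τ + n) + z₂
      lemma : ∀ T h n τ z₁ z₂ z₃ →
        T + 0 + (z₁ + z₁) + ((h * n + h * τ + z₃ * (τ + n) + z₂) + (h * n + h * τ + z₃ * (τ + n) + z₂)) ≡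
        T + h * n + ((h + (z₃ + z₃)) * (τ + n) + (h * τ + 0 + (z₂ + z₂))) + (z₁ + z₁)
      lemma = solve-∀
    parity (s≤s z≤n) p≡ p₀≡ with triangle-odd h
    ... | z₃ , odd = signR-parity p (Tλ + (τ + n + n * h + n * r) + (triangle (suc (width 1 h)) * (τ + n) + p₀)) k (n * z₄ + z₁)
      (≡.trans (cong (_+ (k + k)) p≡) (≡.trans (lemma₁ Tλ h n τ z₁ z₂ z₃ S)
        -- The sum S + h n is exchanged for r + 2 z₄, which brings the rank into the sign.
        (≡.trans (cong (λ x → base + n * x) (≡.sym r≡)) (≡.trans (lemma₂ n r z₄ z₁ Tλ h τ z₂ z₃)
        (≡.sym (cong₂ (λ x y → Tλ + (τ + n + n * h + n * r) + (x * (τ + n) + y) + (n * z₄ + z₁ + (n * z₄ + z₁))) tri≡ p₀≡))))))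
      where
      τ = triangle n
      k = (τ + n) + n * (h * n) + z₂ + z₃ * (τ + n) + h * (τ + n) + n * h + h * τ
      base = Tλ + (τ + n + n * h) + ((h + (z₃ + z₃) + suc (h + h)) * (τ + n) + (h * τ + 1 * (n * (h * n)) + (z₂ + z₂))) + (z₁ + z₁)
      tri≡ : triangle (suc (width 1 h)) ≡ h + (z₃ + z₃) + suc (h + h)
      tri≡ = ≡.trans (cong (triangle ∘ suc) (width-sum 1 h)) (cong (_+ suc (h + h)) odd)
      lemma₁ : ∀ T h n τ z₁ z₂ z₃ S →
        T + 1 * (n * S) + (z₁ + z₁) + (((τ + n) + n * (h * n) + z₂ + z₃ * (τ + n) + h * (τ + n) + n * h + h * τ) +
          ((τ + n) + n * (h * n) + z₂ + z₃ * (τ + n) + h * (τ + n) + n * h + h * τ)) ≡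
        T + (τ + n + n * h) + ((h + (z₃ + z₃) + suc (h + h)) * (τ + n) + (h * τ + 1 * (n * (h * n)) + (z₂ + z₂))) + (z₁ + z₁) + n * (S + h * n)
      lemma₁ = solve-∀
      lemma₂ : ∀ n r z₄ z₁ T h τ z₂ z₃ →
        T + (τ + n + n * h) + ((h + (z₃ + z₃) + suc (h + h)) * (τ + n) + (h * τ + 1 * (n * (h * n)) + (z₂ + z₂))) + (z₁ + z₁) + n * (r + (z₄ + z₄)) ≡
        T + (τ + n + n * h + n * r) + ((h + (z₃ + z₃) + suc (h + h)) * (τ + n) + (h * τ + 1 * (n * (h * n)) + (z₂ + z₂))) + (n * z₄ + z₁ + (n * z₄ + z₁))
      lemma₂ = solve-∀

  divide : ∀ {x y z} → ¬ (y ≈ 0#) → x ≈ z *ᴷ y → x *ᴷ inv y ≈ z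
  divide {x} {y} {z} y≉0 e = begin
    x *ᴷ inv y          ≈⟨ *-congʳ e ⟩
    (z *ᴷ y) *ᴷ inv y   ≈⟨ *-assoc _ _ _ ⟩
    z *ᴷ (y *ᴷ inv y)   ≈⟨ trans (*-congˡ (inv-correct y y≉0)) (*-identityʳ z) ⟩
    z                   ∎

  undivide : ∀ {x y} → ¬ (y ≈ 0#) → (x *ᴷ inv y) *ᴷ y ≈ x
  undivide {x} {y} y≉0 = trans (*-assoc _ _ _) (trans (*-congˡ (trans (*-comm _ _) (inv-correct y y≉0))) (*-identityʳ x))

  oNum-cong : ∀ N {μ μ′ : Fin N → ℤ} y → (∀ j → μ j ≡ μ′ j) → oNum N μ y ≈ oNum N μ′ y
  oNum-cong N y e = det-cong N (λ i j → reflexive (cong (λ z → zpow (y i) (z ℤ.+ pos (N ∸ suc (toℕ j))) +ᴷ zpow (y i) (ℤ.- (z ℤ.+ pos (N ∸ suc (toℕ j))))) (e j)))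

  sNum-cong : ∀ N {μ μ′ : Fin N → ℤ} y → (∀ j → μ j ≡ μ′ j) → sNum N μ y ≈ sNum N μ′ y
  sNum-cong N y e = det-cong N (λ i j → reflexive (cong (λ z → zpow (y i) (z ℤ.+ pos (N ∸ suc (toℕ j)))) (e j)))

  soNum-cong : ∀ N {μ μ′ : Fin N → ℤ} y → (∀ j → μ j ≡ μ′ j) → soNum N μ y ≈ soNum N μ′ y
  soNum-cong N y e = det-cong N (λ i j → reflexive (cong (λ z → zpow (y i) ((z ℤ.+ pos (N ∸ suc (toℕ j))) ℤ.+ pos 1) -ᴷ zpow (y i) (ℤ.- (z ℤ.+ pos (N ∸ suc (toℕ j))))) (e j)))

  prodL-map : ∀ {a} {A : Set a} (f : A → Carrier) xs → prodL (map f xs) ≡ prodOver f xs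
  prodL-map f []       = ≡.refl
  prodL-map f (x ∷ xs) = cong (f x *ᴷ_) (prodL-map f xs)

  prodOver-undivide : ∀ {a} {A : Set a} (f g g′ : A → Carrier) xs → (∀ {x} → x ∈ xs → ¬ (g x ≈ 0#)) → (∀ {x} → x ∈ xs → g′ x ≈ g x) →
                      prodOver (λ x → f x *ᴷ inv (g x)) xs *ᴷ prodOver g′ xs ≈ prodOver f xs
  prodOver-undivide f g g′ xs nz e = trans (sym (prodOver-* (λ x → f x *ᴷ inv (g x)) g′ xs))
    (prodOver-cong xs (λ x∈ → trans (*-congˡ (e x∈)) (undivide (nz x∈))))

  lastZero-cong : ∀ N N′ {μ : Fin (suc N) → ℤ} {μ′ : Fin (suc N′) → ℤ} a a′ → μ (Fin.fromℕ N) ≡ pos a → μ′ (Fin.fromℕ N′) ≡ pos a′ →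
                  (a ≡ 0 → a′ ≡ 0) → (a′ ≡ 0 → a ≡ 0) → lastZero (suc N) μ ≡ lastZero (suc N′) μ′
  lastZero-cong N N′ zero    zero     p q f g rewrite p | q = ≡.refl
  lastZero-cong N N′ (suc a) (suc a′) p q f g rewrite p | q = ≡.refl
  lastZero-cong N N′ zero    (suc a′) p q f g = contradiction (f ≡.refl) (λ ())
  lastZero-cong N N′ (suc a) zero     p q f g = contradiction (g ≡.refl) (λ ())

-- The row scaling and the sign of `kappa n` are common to λ and the empty partition; what remains
-- is the quotient of the two `soNum` and the sign from the parts of λ^(t/2). For odd `t` both
-- blocks are empty.
tail-relation : ∀ {c ℓ} (K : Field c ℓ) → let open Signs K in ∀ e h n ω ω-root X X≉0 e≤1 ρ ρ-sorted N₀ bal N₀′ bal′ →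
  let t = suc (width e h)
      module Λ = SpecializedValues K e h n ω ω-root X X≉0 e≤1 ρ ρ-sorted N₀ bal
      module ∅ = SpecializedValues K e h n ω ω-root X X≉0 e≤1 [] [] N₀′ bal′ in
  (isEven t ≡ true → ¬ (soDen n (zeroSeq n) (negPowVars n t X) ≈ 0#)) →
  (if isEven t
   then signR (sum (quot (t * n) t ρ (t / 2))) *ᴷ so n (seqOf n (quot (t * n) t ρ (t / 2))) (negPowVars n t X)
   else 1#) *ᴷ ∅.tailBlock (suc h) ≈ Λ.tailBlock (suc h)
tail-relation K e h n ω ω-root X X≉0 z≤n ρ ρ-sorted N₀ bal N₀′ bal′ d rewrite isEven-odd h = *-identityˡ _
  where open Signs K
tail-relation K e h n ω ω-root X X≉0 (s≤s z≤n) ρ ρ-sorted N₀ bal N₀′ bal′ d = begin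
  (if isEven t then signR (sum (quot (t * n) t ρ (t / 2))) *ᴷ so n (seqOf n (quot (t * n) t ρ (t / 2))) y else 1#) *ᴷ ∅.tailBlock q
    ≡⟨ cong₂ (λ b i → (if b then signR (sum (quot (t * n) t ρ i)) *ᴷ so n (seqOf n (quot (t * n) t ρ i)) y else 1#) *ᴷ ∅.tailBlock q) (isEven-even h) t/2≡ ⟩
  (signR s *ᴷ (a *ᴷ inv b)) *ᴷ ∅.tailBlock q
    ≈⟨ *-congˡ (trans ∅.tail-value (*-congˡ (*-cong (reflexive (cong (λ z → signR (z + κ)) (sum-zero n q q<t))) b′≈b))) ⟩
  (signR s *ᴷ (a *ᴷ inv b)) *ᴷ (M *ᴷ (signR κ *ᴷ b))
    ≈⟨ solve 6 (λ s a i M k b → ((s :* (a :* i)) :* (M :* (k :* b))) := (M :* ((s :* k) :* ((a :* i) :* b)))) refl _ _ _ _ _ _ ⟩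
  M *ᴷ ((signR s *ᴷ signR κ) *ᴷ ((a *ᴷ inv b) *ᴷ b))
    ≈⟨ *-congˡ (*-cong (sym (signR-+ s κ)) (undivide (d (isEven-even h)))) ⟩
  M *ᴷ (signR (s + κ) *ᴷ a)
    ≈⟨ sym Λ.tail-value ⟩
  Λ.tailBlock q ∎
  where
  t = suc (width 1 h)
  q = suc h
  open Signs K
  2q : q + q ≡ t
  2q = ≡.sym (≡.trans (cong suc (width-sum 1 h)) (cong suc (≡.sym (+-suc h h))))
  q<t : q < t
  q<t = subst (q <_) 2q (m<m+n q (s≤s z≤n))
  t/2≡ : t / 2 ≡ q
  t/2≡ = half-double q (≡.sym 2q)
  y = negPowVars n t X
  κ = kappa n
  s = sum (quot (t * n) t ρ q)
  a = soNum n (seqOf n (quot (t * n) t ρ q)) y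
  b = soNum n (zeroSeq n) y
  M = prodOver (λ b → pow (inv (X b)) q) (allFin n)
  b′≈b : soNum n (seqOf n (quot (t * n) t [] q)) y ≈ b
  b′≈b = soNum-cong n y (λ j → cong pos (EmptyPartition.quot-empty (width 1 h) n q q<t (toℕ j)))
  sum-zero : ∀ n q → q < t → sum (quot (t * n) t [] q) ≡ 0
  sum-zero n q q<t = ≡.trans (sum-part (quot (t * n) t [] q) _ ≤-refl)
    (≡.trans (sumTo-cong (length (quot (t * n) t [] q)) (λ j _ → EmptyPartition.quot-empty (width 1 h) n q q<t j)) (zeros (length (quot (t * n) t [] q))))
    where
    zeros : ∀ m → sumTo (λ _ → 0) m ≡ 0
    zeros zero    = ≡.refl
    zeros (suc m) = ≡.trans (ℕₚ.+-identityʳ _) (zeros m)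
  module Tail (ρ : List ℕ) (ρ-sorted : Sorted ρ) (N₀ : nRes (t * n) t ρ 0 ≡ n) (bal : Balanced (betaRes (t * n) t ρ) t n) where
    open SpecializedValues K 1 h n ω ω-root X X≉0 (s≤s z≤n) ρ ρ-sorted N₀ bal using (tailBlock; B; rowBlock; class; module MiddleBlock) public
    N-q : nRes (t * n) t ρ q ≡ n
    N-q = ≡.trans (cong length (≡.sym (Listₚ.++-identityʳ (class q))))
      (≡.trans (length-cat class t 1 n bal (s≤s z≤n) q 0 (s≤s z≤n) (≡.trans (ℕₚ.+-comm (q + q) 1) (cong suc 2q))) (ℕₚ.*-identityʳ n))
    tail-value : tailBlock q ≈ M *ᴷ (signR (sum (quot (t * n) t ρ q) + κ) *ᴷ soNum n (seqOf n (quot (t * n) t ρ q)) y)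
    tail-value = trans (reflexive (cong₂ (Det B) (Listₚ.++-identityʳ (rowBlock q)) (Listₚ.++-identityʳ (class q))))
      (MiddleBlock.middle-block q 2q N-q)
  module Λ = Tail ρ ρ-sorted N₀ bal
  module ∅ = Tail [] [] N₀′ bal′

module CharacterFormula {c ℓ} (K : Field c ℓ) (e h n : ℕ) (ω : Field.Carrier K)
  (ω-root : Field._≈_ K (FieldDefs.pow K ω (suc (width e h))) (Field.1# K))
  (X : Fin n → Field.Carrier K) (X≉0 : ∀ b → ¬ (Field._≈_ K (X b) (Field.0# K)))
  (e≤1 : e ≤ 1) (1≤n : 1 ≤ n) (ρ : List ℕ) (ρ-sorted : Sorted ρ) where
  open Signs K
  private
    w = width e h
    t = suc w

  -- Every character on the right, multiplied by its denominator, gives a block of the factorization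
  -- for λ, and these denominators are the blocks for the empty partition, up to the factor 1 + δ.
  -- Together with the common `fourierDet` and the signs they make up `oDen` of the left side, which
  -- is divided out last.
  formula : (N₀ : nRes (t * n) t ρ 0 ≡ n) (bal : Balanced (betaRes (t * n) t ρ) t n) →
    ∀ r → (∃ λ z → r + (z + z) ≡ upperSum (nRes (t * n) t ρ) t 1 h + h * n) →
    ¬ (oDen (t * n) (seqOf (t * n) ρ) (rootVars t n ω X) ≈ 0#) →
    ¬ (oDen n (seqOf n (quot (t * n) t ρ 0)) (powVars n t X) ≈ 0#) →
    (3 ≤ t → ¬ (sDen (n + n) (zeroSeq (n + n)) (powInvVars n t X) ≈ 0#)) →
    (isEven t ≡ true → ¬ (soDen n (zeroSeq n) (negPowVars n t X) ≈ 0#)) →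
    lhs t n ω X ρ ≈ rhs t n ω X ρ r
  formula N₀ bal r r-parity d₁ d₂ d₃ d₄ = divide d₁ (begin
    oNum (t * n) (seqOf (t * n) ρ) (rootVars t n ω X)
      ≈⟨ trans (Λ.oNum-factor ρ) (*-congˡ (trans Λ.D-sorted (*-congˡ Λ.D-value))) ⟩
    f *ᴷ (σ *ᴷ (signR pλ *ᴷ Λ.value))
      ≈⟨ *-congˡ (*-congˡ (*-cong signs (*-cong (sym O-relation) (*-cong (sym Π-relation) (sym mid-relation))))) ⟩
    f *ᴷ (σ *ᴷ ((ε′ *ᴷ (κ *ᴷ p)) *ᴷ ((O *ᴷ (δ₀ *ᴷ a)) *ᴷ ((Π *ᴷ Q) *ᴷ (mid *ᴷ τ)))))
      ≈⟨ solve 12 (λ f σ ε κ p O d a Π Q m τ →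
           (f :* (σ :* ((ε :* (κ :* p)) :* ((O :* (d :* a)) :* ((Π :* Q) :* (m :* τ)))))) :=
           ((ε :* (σ :* (O :* (Π :* m)))) :* (d :* (f :* (κ :* (p :* (a :* (Q :* τ)))))))) refl f σ ε′ κ p O δ₀ a Π Q mid τ ⟩
    rhs t n ω X ρ r *ᴷ (δ₀ *ᴷ (f *ᴷ (κ *ᴷ (p *ᴷ (a *ᴷ (Q *ᴷ τ))))))
      ≈⟨ *-congˡ (*-cong (reflexive (cong delta (≡.sym last-zero))) (sym empty-value)) ⟩
    rhs t n ω X ρ r *ᴷ oDen (t * n) (seqOf (t * n) ρ) (rootVars t n ω X) ∎)
    where
    open EmptyPartition w n
    module Λ = SpecializedValues K e h n ω ω-root X X≉0 e≤1 ρ ρ-sorted N₀ bal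
    module ∅ = SpecializedValues K e h n ω ω-root X X≉0 e≤1 [] [] (N-empty 0 (s≤s z≤n)) balanced-empty
    delta : Bool → Carrier
    delta z = 1# +ᴷ (if z then 1# else 0#)
    f = Λ.fourierDet
    σ = signR (inversions (sigmaList (t * n) t ρ))
    pλ = pairingSign Λ.class t n e 1 h
    ε′ = signZ (epsilon t n ρ r)
    κ = signR (triangle t * triangle (suc n))
    p = signR (pairingSign ∅.class t n e 1 h)
    y₀ = powVars n t X
    yₛ = powInvVars n t X
    O = oEven n (seqOf n (quot (t * n) t ρ 0)) y₀
    δ₀ = delta (lastZero n (seqOf n (quot (t * n) t ρ 0)))
    a = oNum n (zeroSeq n) y₀
    Π = prodL (map (λ i → schur (n + n) (mu2 t n ρ i) yₛ) (applyUpTo suc ((t ∸ 1) / 2)))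
    Q = prodOver ∅.sNumAt (range 1 h)
    mid = if isEven t
          then signR (sum (quot (t * n) t ρ (t / 2))) *ᴷ so n (seqOf n (quot (t * n) t ρ (t / 2))) (negPowVars n t X)
          else 1#
    τ = ∅.tailBlock (suc h)
    empty-parity : ∃ λ z → pairingSign ∅.class t n e 1 h ≡ h * triangle n + e * (n * (h * n)) + (z + z)
    empty-parity with pairingSign-parity ∅.class t n e 1 h
    ... | z , eq = z , ≡.trans eq (cong₂ (λ x y → x + e * (n * y) + (z + z))
      (upperSum-constant _ t (λ i i<t → cong triangle (N-empty i i<t)) (s≤s z≤n) 1 h (s≤s z≤n))
      (upperSum-constant _ t N-empty (s≤s z≤n) 1 h (s≤s z≤n)))
    signs : signR pλ ≈ ε′ *ᴷ (κ *ᴷ p)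
    signs = sign-identity e h n e≤1 ρ r pλ _ r-parity (pairingSign-parity Λ.class t n e 1 h) empty-parity
    O-relation : O *ᴷ (δ₀ *ᴷ a) ≈ oNum n (seqOf n (quot (t * n) t ρ 0)) y₀
    O-relation = undivide d₂
    mid-relation : mid *ᴷ τ ≈ Λ.tailBlock (suc h)
    mid-relation = tail-relation K e h n ω ω-root X X≉0 e≤1 ρ ρ-sorted N₀ bal (N-empty 0 (s≤s z≤n)) balanced-empty d₄
    range-bounds : ∀ lo k {i} → i ∈ range lo k → lo ≤ i × i < lo + k
    range-bounds lo (suc k) (here ≡.refl) = ≤-refl , m<m+n lo (s≤s z≤n)
    range-bounds lo (suc k) {i} (there i∈) with range-bounds (suc lo) k i∈
    ... | lo<i , i< = <⇒≤ lo<i , subst (i <_) (≡.sym (+-suc lo k)) i<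
    h<t : h < t
    h<t = s≤s (≤-trans (m≤m+n h h) (≤-trans (m≤n+m (h + h) e) (≤-reflexive (≡.sym (width-sum e h)))))
    Π-relation : Π *ᴷ Q ≈ prodOver Λ.sNumAt (range 1 h)
    Π-relation = trans (*-congʳ (reflexive (≡.trans (cong (λ z → prodL (map (λ i → schur (n + n) (mu2 t n ρ i) yₛ) z)) indices)
        (prodL-map (λ i → schur (n + n) (mu2 t n ρ i) yₛ) (range 1 h)))))
      (prodOver-undivide Λ.sNumAt (λ _ → sNum (n + n) (zeroSeq (n + n)) yₛ) ∅.sNumAt (range 1 h)
        (λ i∈ → d₃ (at-least-three (range-bounds 1 h i∈)))
        (λ {i} i∈ → sNum-cong (n + n) yₛ (mu2-empty i (range-bounds 1 h i∈))))
      where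
      indices : applyUpTo suc ((t ∸ 1) / 2) ≡ range 1 h
      indices = ≡.trans (cong (applyUpTo suc) (half-width h e≤1)) (applyUpTo-range 1 h)
      at-least-three : ∀ {i} → 1 ≤ i × i < 1 + h → 3 ≤ t
      at-least-three (1≤i , i<) = s≤s (≤-trans (+-mono-≤ 1≤h 1≤h) (≤-trans (m≤n+m (h + h) e) (≤-reflexive (≡.sym (width-sum e h)))))
        where 1≤h = ≤-trans 1≤i (≤-pred i<)
      mu2-empty : ∀ i → 1 ≤ i × i < 1 + h → ∀ j → mu2 t n [] i j ≡ pos 0
      mu2-empty i (1≤i , i<) j = if-same (toℕ j <ᵇ nRes (t * n) t [] i)
        (cong₂ (λ x y → pos x ℤ.+ pos y) (quot-empty (t ∸ i) t∸i<t 0) (quot-empty i i<t (toℕ j)))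
        (cong₂ (λ x y → pos x ℤ.- pos y) (quot-empty (t ∸ i) t∸i<t 0) (quot-empty (t ∸ i) t∸i<t ((n + n) ∸ suc (toℕ j))))
        where
        i<t : i < t
        i<t = ≤-trans i< h<t
        t∸i<t : t ∸ i < t
        t∸i<t = ∸-monoʳ-< 1≤i (<⇒≤ i<t)
    -- The sequence of zeros is that of the empty partition, so `oNum-factor` and `D-value` apply to
    -- the denominator as well. Its sorting sign `κ` comes from `sort-residues` because the beta set
    -- is n t - 1, ..., 0.
    empty-value : oNum (t * n) (zeroSeq (t * n)) (rootVars t n ω X) ≈ f *ᴷ (κ *ᴷ (p *ᴷ (a *ᴷ (Q *ᴷ τ))))
    empty-value = trans (∅.oNum-factor []) (*-congˡ (begin
      ∅.D (betaSet (t * n) [])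
        ≡⟨ cong ∅.D betaSet-empty ⟩
      ∅.D (map id (downFrom (n * t)))
        ≈⟨ sort-residues ∅.D-antisymmetric id t n ⟩
      κ *ᴷ ∅.D (cat (λ i → map (λ k → i + k * t) (downFrom n)) 0 t)
        ≡⟨ cong (λ z → κ *ᴷ ∅.D z) (cat-cong _ ∅.class 0 t (λ i i<t → ≡.sym (class-empty i i<t))) ⟩
      κ *ᴷ ∅.D (cat ∅.class 0 t)
        ≈⟨ *-congˡ ∅.D-value ⟩
      κ *ᴷ (p *ᴷ ∅.value)
        ≈⟨ *-congˡ (*-congˡ (*-congʳ (oNum-cong n y₀ (λ j → cong pos (quot-empty 0 (s≤s z≤n) (toℕ j)))))) ⟩
      κ *ᴷ (p *ᴷ (a *ᴷ (Q *ᴷ τ))) ∎))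
    -- Both deltas ask whether 0 is a bead: as the least possible entry, lying in class 0, it would
    -- be the last beta number and also the last entry of that class. The factors 1 + δ on the two
    -- sides therefore agree.
    last-zero : lastZero (t * n) (seqOf (t * n) ρ) ≡ lastZero n (seqOf n (quot (t * n) t ρ 0))
    last-zero = go 1≤n N₀
      where
      go : ∀ {n} → 1 ≤ n → nRes (t * n) t ρ 0 ≡ n → lastZero (t * n) (seqOf (t * n) ρ) ≡ lastZero n (seqOf n (quot (t * n) t ρ 0))
      go {suc n′} _ N₀ = lastZero-cong M n′ {seqOf m ρ} {seqOf (suc n′) (quot m t ρ 0)} (part ρ M) (part (quot m t ρ 0) n′)
          (cong (λ z → pos (part ρ z)) (Finₚ.toℕ-fromℕ M)) (cong (λ z → pos (part (quot m t ρ 0) z)) (Finₚ.toℕ-fromℕ n′)) forwards backwards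
        where
        m = t * suc n′
        M = n′ + w * suc n′
        open BetaSets m ρ
        open Residues w hiding (t)
        n′<N : n′ < nRes m t ρ 0
        n′<N = subst (n′ <_) (≡.sym N₀) (n<1+n n′)
        quot-last : part (quot m t ρ 0) n′ ≡ part (class 0) n′ / t
        quot-last = ≡.trans (≡.sym (≡.trans (cong (part (quot m t ρ 0) n′ +_) (≡.trans (cong (_∸ suc n′) N₀) (n∸n≡0 n′))) (ℕₚ.+-identityʳ _))) (part-quot ρ-sorted 0 n′<N)
        beta-last : beta M ≡ part ρ M
        beta-last = ≡.trans (cong (part ρ M +_) (n∸n≡0 M)) (ℕₚ.+-identityʳ _)
        forwards : part ρ M ≡ 0 → part (quot m t ρ 0) n′ ≡ 0
        forwards z = ≡.trans quot-last (cong (_/ t) (n≤0⇒n≡0 (decreasing-last (class-decreasing ρ-sorted 0) 0∈ N₀)))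
          where
          0∈ : 0 ∈ class 0
          0∈ = ∈-class⁺ (subst (_∈ betaSet m ρ) (≡.trans beta-last z) (∈-betaSet⁺ (n<1+n M))) ≡.refl
        backwards : part (quot m t ρ 0) n′ ≡ 0 → part ρ M ≡ 0
        backwards z with ∈-class⁻ (part-∈ (class 0) n′<N)
        ... | x∈ , x%t with ∈-betaSet⁻ x∈
        ...   | j , j<m , eq = ≡.trans (cong (part ρ) (≡.sym j≡M)) (m+n≡0⇒m≡0 (part ρ j) beta≡0)
          where
          x = part (class 0) n′
          x≡0 : x ≡ 0
          x≡0 = ≡.trans (DivMod.m≡m%n+[m/n]*n x t) (cong₂ (λ p q → p + q * t) x%t (≡.trans (≡.sym quot-last) z))
          beta≡0 : beta j ≡ 0
          beta≡0 = ≡.trans (≡.sym eq) x≡0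
          j≡M : j ≡ M
          j≡M = ≤-antisym (≤-pred j<m) (m∸n≡0⇒m≤n (m+n≡0⇒n≡0 (part ρ j) beta≡0))

theorem2p15 : ∀ {c ℓ} (K : Field c ℓ) → let open FieldDefs K in
    (t n : ℕ) → 2 ≤ t → 1 ≤ n →
    (ω : Carrier) → IsPrimitiveRoot t ω →
    (X : Fin n → Carrier) → (∀ b → ¬ (X b ≈ 0#)) →
    (λp : List ℕ) → IsPartition λp → length λp ≤ t * n →
    ¬ (oDen (t * n) (seqOf (t * n) λp) (rootVars t n ω X) ≈ 0#) →
    ¬ (oDen n (seqOf n (quot (t * n) t λp 0)) (powVars n t X) ≈ 0#) →
    (3 ≤ t → ¬ (sDen (n + n) (zeroSeq (n + n)) (powInvVars n t X) ≈ 0#)) →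
    (isEven t ≡ true → ¬ (soDen n (zeroSeq n) (negPowVars n t X) ≈ 0#)) →
    ((c : List ℕ) → TCoreOf t λp c → ¬ Orthogonal c →
    lhs t n ω X λp ≈ 0#)
    ×
    ((c : List ℕ) → TCoreOf t λp c → Orthogonal c →
    lhs t n ω X λp ≈ rhs t n ω X λp (rank c))
theorem2p15 K (suc w) n 2≤t 1≤n ω (ω-root , _) X X≉0 λp λ-part λ≤m d₁ d₂ d₃ d₄ with parity-form w
... | e , h , e≤1 , ≡.refl = vanishing , equality
  where
  t = suc (width e h)
  m = t * n
  open Signs K
  module F = BlockFactorization K e h n ω ω-root X X≉0 e≤1 λp (proj₁ λ-part)

  module Core (c : List ℕ) (core : TCoreOf t λp c) where
    reduced = strips-nRes m λ-part λ≤m (proj₁ core)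
    c-sorted = proj₁ (proj₁ reduced)
    c≤m = proj₁ (proj₂ reduced)
    same = proj₂ (proj₂ reduced)
    open ClosedBeads (width e h) n c c-sorted (core-closed c-sorted c≤m (proj₂ core)) public
      using (balanced⇒symmetric; symmetric⇒N₀; symmetric⇒balanced; rank-sum)
    open Gaps m c-sorted c≤m public using (orthogonal-symmetric; symmetric-orthogonal)

  -- The counts n_i of λ and of its core agree. If they were balanced, the beads of the core would
  -- be symmetric and the core orthogonal; so the numerator is 0.
  vanishing : (c : List ℕ) → TCoreOf t λp c → ¬ Orthogonal c → lhs t n ω X λp ≈ 0#
  vanishing c core ¬orth with F.balanced-or-vanishing
  ... | inj₂ zero-D = trans (*-congʳ (trans (F.oNum-factor λp) (trans (*-congˡ zero-D) (zeroʳ _)))) (zeroˡ _)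
  ... | inj₁ (N₀ , bal) = contradiction (symmetric-orthogonal (balanced⇒symmetric (≡.trans (≡.sym (same 0)) N₀)
          (λ i 1≤i i<t → ≡.trans (cong₂ _+_ (≡.sym (same i)) (≡.sym (same (t ∸ i)))) (bal i 1≤i i<t)))) ¬orth
    where open Core c core

  equality : (c : List ℕ) → TCoreOf t λp c → Orthogonal c → lhs t n ω X λp ≈ rhs t n ω X λp (rank c)
  equality c core orth = CharacterFormula.formula K e h n ω ω-root X X≉0 e≤1 1≤n λp (proj₁ λ-part) N₀ bal (rank c) r-parity d₁ d₂ d₃ d₄
    where
    open Core c core
    beads = orthogonal-symmetric orth
    Nλ = nRes m t λp
    N₀ : Nλ 0 ≡ n
    N₀ = ≡.trans (same 0) (symmetric⇒N₀ beads)
    bal : Balanced (betaRes m t λp) t n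
    bal i 1≤i i<t = ≡.trans (cong₂ _+_ (same i) (same (t ∸ i))) (symmetric⇒balanced beads i 1≤i i<t)
    excess : ℕ → List ℕ
    excess i = (Nλ i ∸ n) ∷ []
    -- Class 0 contributes nothing since its count is `n`; the other terms are rearranged into pairs
    -- to fit `excess-parity`.
    rank≡ : rank c ≡ sum (paired excess t id e 1 h)
    rank≡ = ≡.trans (rank-sum c≤m) (≡.trans (cong sum (cat-cong _ excess 0 t (λ i _ → cong (λ z → (z ∸ n) ∷ []) (≡.sym (same i)))))
      (≡.trans (cong (_+ sum (cat excess 1 (width e h))) (≡.trans (cong (_∸ n) N₀) (n∸n≡0 n)))
        (Sumₚ.sum-↭ (↭-sym (paired-↭ excess t id (λ _ → ↭-refl) e 1 h ≡.refl)))))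
    r-parity : ∃ λ z → rank c + (z + z) ≡ upperSum Nλ t 1 h + h * n
    r-parity with excess-parity (betaRes m t λp) t n e bal e≤1 1 h (s≤s z≤n) ≡.refl
    ... | z , eq = z , ≡.trans (cong (_+ (z + z)) rank≡) eq
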